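{- For any constants $d\in\mathbb{N}$ and $\zeta>0$ there exist $\epsilon_0,n_0$ depending only on $d,\zeta$ such that the following holds. Suppose that $n>n_0$, that $\zeta n\le k\le\frac{d-1}{d}n$, and that $\mathcal{F}\subseteq\binom{[n]}{k}$ is a family that does not contain a $d$-simplex and satisfies $|\mathcal{F}|\ge(1-\epsilon_0)\binom{n-1}{k-1}$. Then $\mathcal{F}$ is contained in a $(1,1)$-star, i.e. there is $i\in[n]$ with $i\in A$ for all $A\in\mathcal{F}$.
   Context: A $d$-simplex is a family of $d+1$ sets whose intersection is empty but such that any $d$ of them have nonempty intersection. -}

module Defs where

open import Data.Nat using (ℕ; suc)
open import Data.Fin using (Fin)
open import Data.Fin.Subset using (Subset; _∈_; _∉_)
open import Data.List using (List)
import Data.List.Membership.Propositional as L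
open import Data.Product using (Σ; ∃; _×_)
open import Relation.Nullary using (¬_)
open import Relation.Binary.PropositionalEquality using (_≡_; _≢_)
open import Function.Definitions using (Injective)

IsSimplex : {n : ℕ} (d : ℕ) → (Fin (suc d) → Subset n) → Set
IsSimplex {n} d S =
  Injective _≡_ _≡_ S
  × ¬ (Σ (Fin n) λ x → (j : Fin (suc d)) → x ∈ S j)
  × ((j : Fin (suc d)) → Σ (Fin n) λ x → (j' : Fin (suc d)) → j' ≢ j → x ∈ S j')

ContainsSimplex : {n : ℕ} (d : ℕ) → List (Subset n) → Set
ContainsSimplex {n} d F =
  Σ (Fin (suc d) → Subset n) λ S → IsSimplex d S × ((j : Fin (suc d)) → S j L.∈ F)

InStar : {n : ℕ} → List (Subset n) → Set
InStar {n} F = Σ (Fin n) λ i → (A : Subset n) → A L.∈ F → i ∈ A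

{-# OPTIONS --safe #-}
module Submission where

open import Defs
open import Data.Bool using (Bool; true; false; not; _∧_; _∨_; if_then_else_) renaming (T to IsTrue)
open import Data.Empty using (⊥; ⊥-elim)
open import Data.Fin using (Fin; toℕ; fromℕ<; punchIn) renaming (zero to fz; suc to fs)
open import Data.Fin.Properties using (toℕ<n; toℕ-injective; toℕ-fromℕ<)
open import Data.List using (List; []; _∷_; length; map; concatMap; upTo; _++_)
open import Data.List.Properties using (map-applyUpTo; length-upTo)
open import Data.Nat hiding (_/_)
open import Data.Nat.Combinatorics using (_C_; nCn≡1; nCk+nC[k+1]≡[n+1]C[k+1]; nCk≡nC[n∸k]; k>n⇒nCk≡0)
open import Data.Nat.Divisibility using (n∣m*n)
open import Data.Nat.DivMod using (_%_; m%n<n; [m+n]%n≡m%n; m<n⇒m%n≡m; m≡m%n+[m/n]*n; +-distrib-/-∣ˡ; m*n/n≡m; m<n⇒m/n≡0; m<n*o⇒m/o<n) renaming (_/_ to _div_)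
open import Data.Nat.Properties
open import Data.Nat.Tactic.RingSolver using (solve-∀)
open import Data.Product using (Σ; _×_; _,_; proj₁; proj₂; ∃)
open import Data.Sum using (_⊎_; inj₁; inj₂; [_,_]′)
open import Data.Vec using (Vec; []; _∷_; zipWith; lookup; insertAt; removeAt) renaming (map to mapᵛ)
open import Data.Vec.Properties using (lookup-map; lookup-zipWith; lookup⇒[]=; []=⇒lookup; map-insertAt; insertAt-lookup; insertAt-punchIn; insertAt-removeAt)
open import Function using (_∘_; id)
open import Relation.Binary.Definitions using (tri<; tri≈; tri>)
open import Relation.Binary.PropositionalEquality using (_≡_; _≢_; refl; sym; trans; cong; cong₂; subst; subst₂; module ≡-Reasoning)
open import Relation.Nullary using (¬_; Dec; yes; no; does)
open import Relation.Nullary.Decidable using (True; toWitness)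

-- Call Y ⊆ [n] heavy if the family is sparse among the k-subsets of the complement of Y. If no class of a (d + 1)-colouring
-- of [n] is heavy, members chosen greedily in the complements of the classes form a simplex, provided the classes are large;
-- so almost every colouring has a heavy class. Katona's cycle argument, applied to the cyclic sequence of the classes of a
-- random N-colouring, turns the lower bound on the family into the bound 1 / (d + 1) + O(1 / N) for the probability that a
-- random class is heavy. Hence almost every (d + 1)-colouring has exactly one heavy class.
-- For fixed B ⊆ [n], recolouring B by permutations of the colours shows that the heavy colour of a colouring c depends only
-- on c off B, or only on c on B, and a zero-one law makes the alternative independent of c. Letting B run through the initial
-- segments of [n] yields an element i that lies in the heavy class of almost every colouring. So few members avoid i, and the
-- star of i is almost full. Finally, a member avoiding i forms a simplex with d members of the star of i: shuffle at random
-- d sets whose only common element is i.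
-- Probabilities are counts of words over finite alphabets.

-- Finite sums and properties of most words

-- Members chosen inside the complements of the classes of a (d + 1)-colouring can have no common
-- point; this is why heaviness looks at complements. Lightness is not a monotone property. The
-- cycle argument replaces monotonicity by averaging: an arc is distributed like a random part of a
-- longer arc, so a light arc inside a heavy longer one is rare once the threshold `K` for the
-- longer arc is far larger than the threshold `e` for the shorter one. The hypothesis k ≤ (d - 1) n
-- / d lets arcs of relative length k / n + O(1 / N) fit into the complement of a block, makes the
-- complement of a random class large enough for k-sets, and lets the complements of d members cover
-- all points but i in the last step.

𝟙 : Bool → ℕ
𝟙 true  = 1
𝟙 false = 0

∑ : {A : Set} → List A → (A → ℕ) → ℕ
∑ []       f = 0
∑ (x ∷ xs) f = f x + ∑ xs f

module _ {A : Set} where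

  ∑-cong : (xs : List A) {f g : A → ℕ} → (∀ x → f x ≡ g x) → ∑ xs f ≡ ∑ xs g
  ∑-cong []       e = refl
  ∑-cong (x ∷ xs) e = cong₂ _+_ (e x) (∑-cong xs e)

  ∑-mono : (xs : List A) {f g : A → ℕ} → (∀ x → f x ≤ g x) → ∑ xs f ≤ ∑ xs g
  ∑-mono []       e = z≤n
  ∑-mono (x ∷ xs) e = +-mono-≤ (e x) (∑-mono xs e)

  ∑-+ : (xs : List A) (f g : A → ℕ) → ∑ xs (λ x → f x + g x) ≡ ∑ xs f + ∑ xs g
  ∑-+ []       f g = refl
  ∑-+ (x ∷ xs) f g rewrite ∑-+ xs f g = lem (f x) (g x) (∑ xs f) (∑ xs g)
    where lem : ∀ a b c e → a + b + (c + e) ≡ a + c + (b + e)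
          lem = solve-∀

  ∑-*ˡ : (xs : List A) (c : ℕ) (f : A → ℕ) → ∑ xs (λ x → c * f x) ≡ c * ∑ xs f
  ∑-*ˡ []       c f = sym (*-zeroʳ c)
  ∑-*ˡ (x ∷ xs) c f rewrite ∑-*ˡ xs c f = sym (*-distribˡ-+ c (f x) (∑ xs f))

  ∑-*ʳ : (xs : List A) (c : ℕ) (f : A → ℕ) → ∑ xs (λ x → f x * c) ≡ ∑ xs f * c
  ∑-*ʳ []       c f = refl
  ∑-*ʳ (x ∷ xs) c f rewrite ∑-*ʳ xs c f = sym (*-distribʳ-+ c (f x) (∑ xs f))

  ∑-const : (xs : List A) (c : ℕ) → ∑ xs (λ _ → c) ≡ length xs * c
  ∑-const []       c = refl
  ∑-const (x ∷ xs) c = cong (c +_) (∑-const xs c)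

  ∑-one : (xs : List A) → ∑ xs (λ _ → 1) ≡ length xs
  ∑-one xs = trans (∑-const xs 1) (*-identityʳ _)

  ∑-zero : (xs : List A) → ∑ xs (λ _ → 0) ≡ 0
  ∑-zero xs = trans (∑-const xs 0) (*-zeroʳ (length xs))

  ∑-++ : (xs ys : List A) (f : A → ℕ) → ∑ (xs ++ ys) f ≡ ∑ xs f + ∑ ys f
  ∑-++ []       ys f = refl
  ∑-++ (x ∷ xs) ys f rewrite ∑-++ xs ys f = sym (+-assoc (f x) _ _)

  ∑-<⇒∃ : (xs : List A) {f g : A → ℕ} → ∑ xs f < ∑ xs g → ∃ λ x → f x < g x
  ∑-<⇒∃ [] ()
  ∑-<⇒∃ (x ∷ xs) {f} {g} p with f x <? g x
  ... | yes q = x , q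
  ... | no ¬q = ∑-<⇒∃ xs (≰⇒> λ q → <⇒≱ p (+-mono-≤ (≮⇒≥ ¬q) q))

module _ {A B : Set} where

  ∑-map : (h : A → B) (xs : List A) (f : B → ℕ) → ∑ (map h xs) f ≡ ∑ xs (f ∘ h)
  ∑-map h []       f = refl
  ∑-map h (x ∷ xs) f = cong (f (h x) +_) (∑-map h xs f)

  ∑-concatMap : (h : A → List B) (xs : List A) (f : B → ℕ) →
    ∑ (concatMap h xs) f ≡ ∑ xs (λ x → ∑ (h x) f)
  ∑-concatMap h []       f = refl
  ∑-concatMap h (x ∷ xs) f =
    trans (∑-++ (h x) (concatMap h xs) f) (cong (∑ (h x) f +_) (∑-concatMap h xs f))

  ∑-swap : (xs : List A) (ys : List B) (f : A → B → ℕ) →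
    ∑ xs (λ x → ∑ ys (f x)) ≡ ∑ ys (λ y → ∑ xs (λ x → f x y))
  ∑-swap []       ys f = sym (∑-zero ys)
  ∑-swap (x ∷ xs) ys f rewrite ∑-swap xs ys f = sym (∑-+ ys (f x) _)

vecs : {A : Set} → List A → (n : ℕ) → List (Vec A n)
vecs xs zero    = [] ∷ []
vecs xs (suc n) = concatMap (λ a → map (a ∷_) (vecs xs n)) xs

module _ {A : Set} (xs : List A) where

  ∑-vecs : (n : ℕ) (f : Vec A (suc n) → ℕ) →
    ∑ (vecs xs (suc n)) f ≡ ∑ xs (λ a → ∑ (vecs xs n) (λ v → f (a ∷ v)))
  ∑-vecs n f = trans (∑-concatMap (λ a → map (a ∷_) (vecs xs n)) xs f)
                     (∑-cong xs λ a → ∑-map (a ∷_) (vecs xs n) f)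

  length-vecs : (n : ℕ) → length (vecs xs n) ≡ length xs ^ n
  length-vecs zero    = refl
  length-vecs (suc n) = trans (sym (∑-one (vecs xs (suc n))))
    (trans (∑-vecs n _) (trans (∑-cong xs λ a → trans (∑-one (vecs xs n)) (length-vecs n)) (∑-const xs _)))

-- Change of alphabet: the hypothesis compares the images of one random letter, tested against every
-- function, and independence of the letters raises the factor to `c ^ n`.
∑-push : {A B T : Set} (xs : List A) (ys : List B) (p : A → T) (q : B → T) (c : ℕ) →
  (∀ f → ∑ xs (f ∘ p) ≡ c * ∑ ys (f ∘ q)) →
  ∀ n (f : Vec T n → ℕ) → ∑ (vecs xs n) (f ∘ mapᵛ p) ≡ c ^ n * ∑ (vecs ys n) (f ∘ mapᵛ q)
∑-push xs ys p q c e zero    f = sym (*-identityˡ _)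
∑-push xs ys p q c e (suc n) f = begin
  ∑ (vecs xs (suc n)) (f ∘ mapᵛ p)                                    ≡⟨ ∑-vecs xs n _ ⟩
  ∑ xs (λ a → ∑ (vecs xs n) (λ v → f (p a ∷ mapᵛ p v)))               ≡⟨ e (λ t → ∑ (vecs xs n) (λ v → f (t ∷ mapᵛ p v))) ⟩
  c * ∑ ys (λ b → ∑ (vecs xs n) (λ v → f (q b ∷ mapᵛ p v)))
    ≡⟨ cong (c *_) (∑-cong ys λ b → ∑-push xs ys p q c e n (λ v → f (q b ∷ v))) ⟩
  c * ∑ ys (λ b → c ^ n * ∑ (vecs ys n) (λ v → f (q b ∷ mapᵛ q v)))   ≡⟨ cong (c *_) (∑-*ˡ ys (c ^ n) _) ⟩
  c * (c ^ n * ∑ ys (λ b → ∑ (vecs ys n) (λ v → f (q b ∷ mapᵛ q v)))) ≡⟨ sym (*-assoc c (c ^ n) _) ⟩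
  c ^ suc n * ∑ ys (λ b → ∑ (vecs ys n) (λ v → f (q b ∷ mapᵛ q v)))   ≡⟨ cong (c ^ suc n *_) (sym (∑-vecs ys n _)) ⟩
  c ^ suc n * ∑ (vecs ys (suc n)) (f ∘ mapᵛ q) ∎
  where open ≡-Reasoning

-- Each position may be moved by its own measure-preserving map, which covers both the recolouring
-- of a fixed part and the translation by a word.
∑-zipWith : {I A : Set} (xs : List A) (τ : I → A → A) → (∀ i f → ∑ xs (f ∘ τ i) ≡ ∑ xs f) →
  ∀ {n} (is : Vec I n) (f : Vec A n → ℕ) → ∑ (vecs xs n) (f ∘ zipWith τ is) ≡ ∑ (vecs xs n) f
∑-zipWith xs τ inv []       f = refl
∑-zipWith xs τ inv (i ∷ is) f = begin
  ∑ (vecs xs _) (f ∘ zipWith τ (i ∷ is))                         ≡⟨ ∑-vecs xs _ _ ⟩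
  ∑ xs (λ a → ∑ (vecs xs _) (λ v → f (τ i a ∷ zipWith τ is v)))  ≡⟨ ∑-cong xs (λ a → ∑-zipWith xs τ inv is (λ v → f (τ i a ∷ v))) ⟩
  ∑ xs (λ a → ∑ (vecs xs _) (λ v → f (τ i a ∷ v)))               ≡⟨ inv i (λ a → ∑ (vecs xs _) (λ v → f (a ∷ v))) ⟩
  ∑ xs (λ a → ∑ (vecs xs _) (λ v → f (a ∷ v)))                   ≡⟨ sym (∑-vecs xs _ _) ⟩
  ∑ (vecs xs _) f ∎
  where open ≡-Reasoning

∑< : ℕ → (ℕ → ℕ) → ℕ
∑< n = ∑ (upTo n)

∑<-suc : ∀ n f → ∑< (suc n) f ≡ f 0 + ∑< n (f ∘ suc)
∑<-suc n f = cong (f 0 +_)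
  (trans (cong (λ l → ∑ l f) (sym (map-applyUpTo id suc n))) (∑-map suc (upTo n) f))

∑<-+ : ∀ m n f → ∑< (m + n) f ≡ ∑< m f + ∑< n (λ j → f (m + j))
∑<-+ zero    n f = refl
∑<-+ (suc m) n f = begin
  ∑< (suc (m + n)) f                                              ≡⟨ ∑<-suc (m + n) f ⟩
  f 0 + ∑< (m + n) (f ∘ suc)                                      ≡⟨ cong (f 0 +_) (∑<-+ m n (f ∘ suc)) ⟩
  f 0 + (∑< m (f ∘ suc) + ∑< n (λ j → f (suc m + j)))             ≡⟨ sym (+-assoc (f 0) _ _) ⟩
  f 0 + ∑< m (f ∘ suc) + ∑< n (λ j → f (suc m + j))               ≡⟨ cong (_+ ∑< n (λ j → f (suc m + j))) (sym (∑<-suc m f)) ⟩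
  ∑< (suc m) f + ∑< n (λ j → f (suc m + j)) ∎
  where open ≡-Reasoning

∑<-last : ∀ n f → ∑< (suc n) f ≡ ∑< n f + f n
∑<-last n f = trans (cong (λ k → ∑< k f) (+-comm 1 n)) (trans (∑<-+ n 1 f)
  (cong (∑< n f +_) (trans (+-identityʳ _) (cong f (+-identityʳ n)))))

∑<-* : ∀ r b f → ∑< (r * b) f ≡ ∑< r (λ i → ∑< b (λ j → f (i * b + j)))
∑<-* zero    b f = refl
∑<-* (suc r) b f = trans (∑<-+ b (r * b) f) (trans
  (cong (∑< b f +_) (trans (∑<-* r b (λ j → f (b + j)))
    (∑-cong (upTo r) λ i → ∑-cong (upTo b) λ j → cong f (sym (+-assoc b (i * b) j)))))
  (sym (∑<-suc r (λ i → ∑< b (λ j → f (i * b + j))))))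

∑<-cong : ∀ n {f g : ℕ → ℕ} → (∀ j → j < n → f j ≡ g j) → ∑< n f ≡ ∑< n g
∑<-cong zero    e = refl
∑<-cong (suc n) {f} {g} e = trans (∑<-suc n f) (trans
  (cong₂ _+_ (e 0 z<s) (∑<-cong n λ j l → e (suc j) (s<s l))) (sym (∑<-suc n g)))

∑<-mono : ∀ n {f g : ℕ → ℕ} → (∀ j → j < n → f j ≤ g j) → ∑< n f ≤ ∑< n g
∑<-mono zero    e = z≤n
∑<-mono (suc n) {f} {g} e = subst₂ _≤_ (sym (∑<-suc n f)) (sym (∑<-suc n g))
  (+-mono-≤ (e 0 z<s) (∑<-mono n λ j l → e (suc j) (s<s l)))

∑<-const : ∀ n c → ∑< n (λ _ → c) ≡ n * c
∑<-const n c = trans (∑-const (upTo n) c) (cong (_* c) (length-upTo n))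

∑<-term : ∀ n (f : ℕ → ℕ) j → j < n → f j ≤ ∑< n f
∑<-term (suc n) f zero    l = subst (f 0 ≤_) (sym (∑<-suc n f)) (m≤m+n _ _)
∑<-term (suc n) f (suc j) l = subst (f (suc j) ≤_) (sym (∑<-suc n f))
  (≤-trans (∑<-term n (f ∘ suc) j (s<s⁻¹ l)) (m≤n+m _ _))

∑<-shift : ∀ N f → f N ≡ f 0 → ∑< N (f ∘ suc) ≡ ∑< N f
∑<-shift N f e = +-cancelˡ-≡ (f 0) _ _ (trans (sym (∑<-suc N f)) (trans (∑<-last N f)
  (trans (cong (∑< N f +_) e) (+-comm _ (f 0)))))

∑<-rotate : ∀ N .{{_ : NonZero N}} x f → ∑< N (λ j → f ((j + x) % N)) ≡ ∑< N f
∑<-rotate N zero f = ∑<-cong N λ j l → cong f (trans (cong (_% N) (+-identityʳ j)) (m<n⇒m%n≡m l))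
∑<-rotate N (suc x) f = trans (∑-cong (upTo N) λ j → cong (λ t → f (t % N)) (+-suc j x))
  (trans (∑<-shift N (λ j → f ((j + x) % N)) (cong f (trans (cong (_% N) (+-comm N x)) ([m+n]%n≡m%n x N))))
         (∑<-rotate N x f))

# : {A : Set} → List A → (A → Bool) → ℕ
# xs b = ∑ xs (𝟙 ∘ b)

-- All but a proportion 1 / `K` of the words satisfy `P`. The exceptional set is a Boolean superset
-- of the failures, so that it can be counted while `P` stays an arbitrary type.
record Most {A : Set} (K : ℕ) (xs : List A) (P : A → Set) : Set where
  constructor most
  field
    bad   : A → Bool
    few   : K * # xs bad ≤ length xs
    holds : ∀ x → bad x ≡ false → P x
open Most public

𝟙≤1 : ∀ b → 𝟙 b ≤ 1
𝟙≤1 true  = ≤-refl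
𝟙≤1 false = z≤n

𝟙-∨ : ∀ a b → 𝟙 (a ∨ b) ≤ 𝟙 a + 𝟙 b
𝟙-∨ true  b = s≤s z≤n
𝟙-∨ false b = ≤-refl

∨-falseˡ : ∀ {a b} → a ∨ b ≡ false → a ≡ false
∨-falseˡ {false} e = refl

∨-falseʳ : ∀ {a b} → a ∨ b ≡ false → b ≡ false
∨-falseʳ {false} e = e

module _ {A : Set} {xs : List A} where

  #≤length : (b : A → Bool) → # xs b ≤ length xs
  #≤length b = subst (# xs b ≤_) (∑-one xs) (∑-mono xs (𝟙≤1 ∘ b))

  most-map : ∀ {K} {P Q : A → Set} → (∀ x → P x → Q x) → Most K xs P → Most K xs Q
  most-map f (most b l h) = most b l λ x e → f x (h x e)

  most-weaken : ∀ {K K′} {P : A → Set} → K ≤ K′ → Most K′ xs P → Most K xs P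
  most-weaken le (most b l h) = most b (≤-trans (*-monoˡ-≤ _ le) l) h

  most-all : ∀ {K} {P : A → Set} → (∀ x → P x) → Most K xs P
  most-all {K} h = most (λ _ → false)
    (subst (_≤ length xs) (sym (trans (cong (K *_) (∑-zero xs)) (*-zeroʳ K))) z≤n) λ x _ → h x

  most-× : ∀ K {P Q : A → Set} → Most (2 * K) xs P → Most (2 * K) xs Q → Most K xs (λ x → P x × Q x)
  most-× K (most b l h) (most b′ l′ h′) = most (λ x → b x ∨ b′ x)
    (*-cancelˡ-≤ 2 (begin
      2 * (K * # xs (λ x → b x ∨ b′ x)) ≤⟨ *-monoʳ-≤ 2 (*-monoʳ-≤ K (∑-mono xs λ x → 𝟙-∨ (b x) (b′ x))) ⟩
      2 * (K * ∑ xs (λ x → 𝟙 (b x) + 𝟙 (b′ x))) ≡⟨ cong (λ t → 2 * (K * t)) (∑-+ xs _ _) ⟩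
      2 * (K * (# xs b + # xs b′)) ≡⟨ lem K (# xs b) (# xs b′) ⟩
      2 * K * # xs b + 2 * K * # xs b′ ≤⟨ +-mono-≤ l l′ ⟩
      length xs + length xs ≡⟨ cong (length xs +_) (sym (+-identityʳ _)) ⟩
      2 * length xs ∎))
    λ x e → h x (∨-falseˡ e) , h′ x (∨-falseʳ {b x} e)
    where open ≤-Reasoning
          lem : ∀ K a c → 2 * (K * (a + c)) ≡ 2 * K * a + 2 * K * c
          lem = solve-∀

  any< : ℕ → (ℕ → A → Bool) → A → Bool
  any< zero    b x = false
  any< (suc m) b x = any< m b x ∨ b m x

  any<-false : ∀ m b x → any< m b x ≡ false → ∀ i → i < m → b i x ≡ false
  any<-false (suc m) b x e i l with m≤n⇒m<n∨m≡n (s≤s⁻¹ l)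
  ... | inj₁ q    = any<-false m b x (∨-falseˡ e) i q
  ... | inj₂ refl = ∨-falseʳ {any< m b x} e

  any<-few : ∀ m K b → (∀ i → i < m → K * # xs (b i) ≤ length xs) → K * # xs (any< m b) ≤ m * length xs
  any<-few zero K b l = ≤-reflexive (trans (cong (K *_) (∑-zero xs)) (*-zeroʳ K))
  any<-few (suc m) K b l = begin
    K * # xs (any< (suc m) b) ≤⟨ *-monoʳ-≤ K (∑-mono xs λ x → 𝟙-∨ (any< m b x) (b m x)) ⟩
    K * ∑ xs (λ x → 𝟙 (any< m b x) + 𝟙 (b m x)) ≡⟨ cong (K *_) (∑-+ xs _ _) ⟩
    K * (# xs (any< m b) + # xs (b m)) ≡⟨ *-distribˡ-+ K _ _ ⟩
    K * # xs (any< m b) + K * # xs (b m) ≤⟨ +-mono-≤ (any<-few m K b λ i q → l i (m<n⇒m<1+n q)) (l m ≤-refl) ⟩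
    m * length xs + length xs ≡⟨ +-comm _ (length xs) ⟩
    suc m * length xs ∎
    where open ≤-Reasoning

  -- The union bound. Its nested uses are the source of the products of ranges in the thresholds
  -- below.
  most-∀ : ∀ m K (P : ℕ → A → Set) → (∀ i → i < m → Most (m * K) xs (P i)) →
    Most K xs (λ x → ∀ i → i < m → P i x)
  most-∀ zero K P h = most-all λ x i ()
  most-∀ (suc m) K P h = most (any< (suc m) b)
    (*-cancelˡ-≤ (suc m) (subst (_≤ suc m * length xs) (*-assoc (suc m) K _) (any<-few (suc m) (suc m * K) b l)))
    λ x e i q → hh i q x (any<-false (suc m) b x e i q)
    where
      b : ℕ → A → Bool
      b i with i <? suc m
      ... | yes q = bad (h i q)
      ... | no  _ = λ _ → false
      l : ∀ i → i < suc m → suc m * K * # xs (b i) ≤ length xs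
      l i q with i <? suc m
      ... | yes q′ = few (h i q′)
      ... | no ¬q  = ⊥-elim (¬q q)
      hh : ∀ i → i < suc m → ∀ x → b i x ≡ false → P i x
      hh i q x e with i <? suc m
      ... | yes q′ = holds (h i q′) x e
      ... | no ¬q  = ⊥-elim (¬q q)

  most-∃ : ∀ {P : A → Set} → 0 < length xs → Most 2 xs P → ∃ P
  most-∃ pos (most b l h) with ∑-<⇒∃ xs {𝟙 ∘ b} {λ _ → 1} (subst (# xs b <_) (sym (∑-one xs)) lt)
    where lt : # xs b < length xs
          lt with # xs b
          ... | zero  = pos
          ... | suc y = ≤-trans (s≤s (s≤s (m≤m+n y _))) (≤-trans (≤-reflexive (lem y)) l)
            where lem : ∀ y → suc (suc (y + y)) ≡ 2 * suc y
                  lem = solve-∀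
  ... | x , q = x , h x (f (b x) q)
    where f : ∀ c → 𝟙 c < 1 → c ≡ false
          f false q = refl
          f true (s≤s ())

  most-inv : ∀ {K} {P : A → Set} (t : A → A) → (∀ f → ∑ xs (f ∘ t) ≡ ∑ xs f) →
    Most K xs P → Most K xs (P ∘ t)
  most-inv {K} t inv (most b l h) = most (b ∘ t) (subst (λ y → K * y ≤ length xs) (sym (inv (𝟙 ∘ b))) l) λ x → h (t x)

letters : ℕ → (n : ℕ) → List (Vec ℕ n)
letters r = vecs (upTo r)

length-letters : ∀ r n → length (letters r n) ≡ r ^ n
length-letters r n = trans (length-vecs (upTo r) n) (cong (_^ n) (length-upTo r))

≡ᵇ-refl : ∀ j → (j ≡ᵇ j) ≡ true
≡ᵇ-refl zero    = refl
≡ᵇ-refl (suc j) = ≡ᵇ-refl j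

≡ᵇ-≢ : ∀ {i j} → i ≢ j → (i ≡ᵇ j) ≡ false
≡ᵇ-≢ {zero}  {zero}  ne = ⊥-elim (ne refl)
≡ᵇ-≢ {zero}  {suc j} ne = refl
≡ᵇ-≢ {suc i} {zero}  ne = refl
≡ᵇ-≢ {suc i} {suc j} ne = ≡ᵇ-≢ (ne ∘ cong suc)

≡ᵇ-true : ∀ {i j} → (i ≡ᵇ j) ≡ true → i ≡ j
≡ᵇ-true {zero}  {zero}  e = refl
≡ᵇ-true {suc i} {suc j} e = cong suc (≡ᵇ-true e)

swap : ℕ → ℕ → ℕ → ℕ
swap p q j with j ≟ p | j ≟ q
... | yes _ | _     = q
... | no _  | yes _ = p
... | no _  | no _  = j

swap-ˡ : ∀ p q → swap p q p ≡ q
swap-ˡ p q with p ≟ p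
... | yes _ = refl
... | no ¬e = ⊥-elim (¬e refl)

swap-ʳ : ∀ p q → swap p q q ≡ p
swap-ʳ p q with q ≟ p | q ≟ q
... | yes e | _     = e
... | no _  | yes _ = refl
... | no _  | no ¬e = ⊥-elim (¬e refl)

swap-≢ : ∀ p q j → j ≢ p → j ≢ q → swap p q j ≡ j
swap-≢ p q j ¬p ¬q with j ≟ p | j ≟ q
... | yes e | _     = ⊥-elim (¬p e)
... | no _  | yes e = ⊥-elim (¬q e)
... | no _  | no _  = refl

swap-invol : ∀ p q j → swap p q (swap p q j) ≡ j
swap-invol p q j with j ≟ p | j ≟ q
... | yes refl | _        = swap-ʳ j q
... | no _     | yes refl = swap-ˡ p j
... | no ¬p    | no ¬q    = swap-≢ p q j ¬p ¬q

swap-< : ∀ {r} p q j → p < r → q < r → j < r → swap p q j < r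
swap-< p q j lp lq lj with j ≟ p | j ≟ q
... | yes _ | _     = lq
... | no _  | yes _ = lp
... | no _  | no _  = lj

-- Expresses, without an inverse, that `t` permutes the colours below `r`: the uniform distribution
-- on them is invariant.
Inv : ℕ → (ℕ → ℕ) → Set
Inv r t = ∀ f → ∑< r (f ∘ t) ≡ ∑< r f

inv-∘ : ∀ {r} s t → Inv r s → Inv r t → Inv r (s ∘ t)
inv-∘ s t is it f = trans (it (f ∘ s)) (is f)

∑<-update : ∀ r p (f : ℕ → ℕ) c → p < r →
  ∑< r (λ j → if (j ≡ᵇ p) then c else f j) + f p ≡ ∑< r f + c
∑<-update (suc r) p f c l with m≤n⇒m<n∨m≡n (s≤s⁻¹ l)
... | inj₁ q = begin
    ∑< (suc r) g + f p     ≡⟨ cong (_+ f p) (∑<-last r g) ⟩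
    ∑< r g + g r + f p     ≡⟨ cong (λ t → ∑< r g + t + f p) gr ⟩
    ∑< r g + f r + f p     ≡⟨ lem (∑< r g) (f r) (f p) ⟩
    ∑< r g + f p + f r     ≡⟨ cong (_+ f r) (∑<-update r p f c q) ⟩
    ∑< r f + c + f r       ≡⟨ lem (∑< r f) c (f r) ⟩
    ∑< r f + f r + c       ≡⟨ cong (_+ c) (sym (∑<-last r f)) ⟩
    ∑< (suc r) f + c ∎
  where
    open ≡-Reasoning
    g : ℕ → ℕ
    g j = if (j ≡ᵇ p) then c else f j
    gr : g r ≡ f r
    gr rewrite ≡ᵇ-≢ {r} {p} (λ e → <⇒≢ q (sym e)) = refl
    lem : ∀ a b c → a + b + c ≡ a + c + b
    lem = solve-∀
... | inj₂ refl = begin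
    ∑< (suc r) g + f r     ≡⟨ cong (_+ f r) (∑<-last r g) ⟩
    ∑< r g + g r + f r     ≡⟨ cong₂ (λ s t → s + t + f r) (∑<-cong r g<) gr ⟩
    ∑< r f + c + f r       ≡⟨ lem (∑< r f) c (f r) ⟩
    ∑< r f + f r + c       ≡⟨ cong (_+ c) (sym (∑<-last r f)) ⟩
    ∑< (suc r) f + c ∎
  where
    open ≡-Reasoning
    g : ℕ → ℕ
    g j = if (j ≡ᵇ r) then c else f j
    gr : g r ≡ c
    gr rewrite ≡ᵇ-refl r = refl
    g< : ∀ j → j < r → g j ≡ f j
    g< j l rewrite ≡ᵇ-≢ {j} {r} (<⇒≢ l) = refl
    lem : ∀ a b c → a + b + c ≡ a + c + b
    lem = solve-∀

inv-swap : ∀ r p q → p < r → q < r → Inv r (swap p q)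
inv-swap r p q lp lq f with p ≟ q
... | yes refl = ∑-cong (upTo r) λ j → cong f (lem j)
  where lem : ∀ j → swap p p j ≡ j
        lem j with j ≟ p
        ... | yes e = sym e
        ... | no _ = refl
... | no p≢q = +-cancelʳ-≡ (f q) _ _ (+-cancelʳ-≡ (f p) _ _ (begin
    ∑< r (f ∘ swap p q) + f q + f p   ≡⟨ cong (λ t → t + f q + f p) (∑-cong (upTo r) same) ⟩
    ∑< r h + f q + f p                ≡⟨ lem (∑< r h) (f q) (f p) ⟩
    ∑< r h + f p + f q                ≡⟨ cong (λ t → ∑< r h + t + f q) (sym gp) ⟩
    ∑< r h + g p + f q                ≡⟨ cong (_+ f q) (∑<-update r p g (f q) lp) ⟩
    ∑< r g + f q + f q                ≡⟨ cong (_+ f q) (∑<-update r q f (f p) lq) ⟩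
    ∑< r f + f p + f q                ≡⟨ lem (∑< r f) (f p) (f q) ⟩
    ∑< r f + f q + f p ∎))
  where
    open ≡-Reasoning
    -- `f ∘ swap p q` arises from `f` by two one-point updates, at `q` and then at `p`.
    g h : ℕ → ℕ
    g j = if (j ≡ᵇ q) then f p else f j
    h j = if (j ≡ᵇ p) then f q else g j
    same : ∀ j → f (swap p q j) ≡ h j
    same j with j ≟ p | j ≟ q
    ... | yes refl | _        rewrite ≡ᵇ-refl j = refl
    ... | no ne    | yes refl rewrite ≡ᵇ-≢ ne | ≡ᵇ-refl j = refl
    ... | no ne    | no ne′   rewrite ≡ᵇ-≢ ne | ≡ᵇ-≢ ne′ = refl
    gp : g p ≡ f p
    gp rewrite ≡ᵇ-≢ p≢q = refl
    lem : ∀ a b c → a + b + c ≡ a + c + b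
    lem = solve-∀

most-recolour : ∀ {I : Set} {K r n} {P : Vec ℕ n → Set} (τ : I → ℕ → ℕ) → (∀ i → Inv r (τ i)) →
  (is : Vec I n) → Most K (letters r n) P → Most K (letters r n) (P ∘ zipWith τ is)
most-recolour {r = r} τ inv is = most-inv (zipWith τ is) λ f → ∑-zipWith (upTo r) τ inv is f

data All< (r : ℕ) : ∀ {n} → Vec ℕ n → Set where
  []  : All< r []
  _∷_ : ∀ {n j} {c : Vec ℕ n} → j < r → All< r c → All< r (j ∷ c)

all<ᵇ : ∀ (r : ℕ) {n} → Vec ℕ n → Bool
all<ᵇ r []      = true
all<ᵇ r (j ∷ c) = (j <ᵇ r) ∧ all<ᵇ r c

all<ᵇ-sound : ∀ r {n} (c : Vec ℕ n) → not (all<ᵇ r c) ≡ false → All< r c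
all<ᵇ-sound r []      e = []
all<ᵇ-sound r (j ∷ c) e with j <ᵇ r in eq
... | true = <ᵇ⇒< j r (subst IsTrue (sym eq) _) ∷ all<ᵇ-sound r c e

-- Letters are bare numbers, so their range is recovered as a property of words. No listed word
-- violates it, hence the arbitrary `K`.
most-all< : ∀ K r n → Most K (letters r n) (All< r)
most-all< K r n = most (not ∘ all<ᵇ r) (subst (λ t → K * t ≤ length (letters r n)) (sym (lem n)) (subst (_≤ length (letters r n)) (sym (*-zeroʳ K)) z≤n)) (all<ᵇ-sound r)
  where
    first : ∀ n j → j < r → # (letters r n) (λ v → not (all<ᵇ r (j ∷ v))) ≡ # (letters r n) (not ∘ all<ᵇ r)
    first n j l with j <ᵇ r | <⇒<ᵇ l
    ... | true | _ = refl
    lem : ∀ n → # (letters r n) (not ∘ all<ᵇ r) ≡ 0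
    lem zero    = refl
    lem (suc n) = trans (∑-vecs (upTo r) n _) (trans (∑<-cong r λ j l → trans (first n j l) (lem n)) (∑-zero (upTo r)))

-- Colourings with exactly one heavy class

One : ℕ → (ℕ → Bool) → Set
One r P = (∃ λ a → a < r × P a ≡ true) × (∀ a a′ → a < r → a′ < r → P a ≡ true → P a′ ≡ true → a ≡ a′)

one-cong : ∀ {r P Q} → (∀ a → P a ≡ Q a) → One r P → One r Q
one-cong e ((a , l , p) , u) =
  (a , l , trans (sym (e a)) p) , λ b b′ k k′ q q′ → u b b′ k k′ (trans (e b) q) (trans (e b′) q′)

false≢true : ∀ {b} → b ≡ false → b ≡ true → ⊥
false≢true refl ()

¬true⇒false : ∀ {b} → ¬ (b ≡ true) → b ≡ false
¬true⇒false {true}  n = ⊥-elim (n refl)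
¬true⇒false {false} n = refl

swap-id : ∀ p j → swap p p j ≡ j
swap-id p j with j ≟ p
... | yes e = sym e
... | no _  = refl

-- Products of two transpositions comprise the identity, the transpositions and the 3-cycles: all
-- the diagonals that the dichotomy inspects.
record Diagonals (r : ℕ) (M : ℕ → ℕ → Bool) : Set where
  constructor diagonals
  field
    one-on : ∀ p q p′ q′ → p < r → q < r → p′ < r → q′ < r → One r (λ a → M a (swap p′ q′ (swap p q a)))
open Diagonals public

record Row (r : ℕ) (M : ℕ → ℕ → Bool) : Set where
  constructor row
  field
    constant : ∀ a b b′ → a < r → b < r → b′ < r → M a b ≡ M a b′
open Row public

flip′ : (ℕ → ℕ → Bool) → ℕ → ℕ → Bool
flip′ M a b = M b a

-- A 0-1 matrix all of whose generalised diagonals (under products of two transpositions) contain exactly one 1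
-- consists of one row, or one column, of ones.
module _ {r : ℕ} (3≤r : 3 ≤ r) where

  private
    0<r : 0 < r
    0<r = ≤-trans (s≤s z≤n) 3≤r
    1<r : 1 < r
    1<r = ≤-trans (s≤s (s≤s z≤n)) 3≤r
    2<r : 2 < r
    2<r = 3≤r

  diagonal : ∀ {M} → Diagonals r M → One r (λ a → M a a)
  diagonal {M} D = one-cong (λ a → cong (M a) (trans (swap-id 0 _) (swap-id 0 a))) (one-on D 0 0 0 0 0<r 0<r 0<r 0<r)

  transposed : ∀ {M} → Diagonals r M → ∀ p q → p < r → q < r → One r (λ a → M a (swap p q a))
  transposed {M} D p q lp lq = one-cong (λ a → cong (M a) (swap-id p _)) (one-on D p q p p lp lq lp lp)

  row⊥ : ∀ {M} → Diagonals r M → Row r M → Row r (flip′ M) → ⊥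
  row⊥ {M} D R Q with diagonal D
  ... | (a , la , pa) , u with u 0 1 0<r 1<r (const 0 0<r) (const 1 1<r)
    where const : ∀ b → b < r → M b b ≡ true
          const b lb = trans (constant R b b a lb lb la) (trans (constant Q a b a la lb la) pa)
  ... | ()

  third : ∀ a x → ∃ λ q → q < r × q ≢ a × q ≢ x
  third 0 0 = 1 , 1<r , (λ ()) , λ ()
  third 0 1 = 2 , 2<r , (λ ()) , λ ()
  third 0 (suc (suc x)) = 1 , 1<r , (λ ()) , λ ()
  third 1 0 = 2 , 2<r , (λ ()) , λ ()
  third (suc (suc a)) 0 = 1 , 1<r , (λ ()) , λ ()
  third (suc a) (suc x) = 0 , 0<r , (λ ()) , λ ()

  module _ {M : ℕ → ℕ → Bool} (D : Diagonals r M) {a₀ : ℕ} (l₀ : a₀ < r) (t₀ : M a₀ a₀ ≡ true) where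

    private
      diag : ∀ a → a < r → a ≢ a₀ → M a a ≡ false
      diag a l ne = ¬true⇒false λ e → ne (proj₂ (diagonal D) a a₀ l l₀ e t₀)

      off : ∀ p q → p < r → q < r → p ≢ a₀ → q ≢ a₀ → p ≢ q → M p q ≡ false
      off p q lp lq np nq n = ¬true⇒false λ e → np (proj₂ (transposed D p q lp lq) p a₀ lp l₀
        (trans (cong (M p) (swap-ˡ p q)) e)
        (trans (cong (M a₀) (swap-≢ p q a₀ (np ∘ sym) (nq ∘ sym))) t₀))

    -- Two ones never share a diagonal. Together with the ones at `(a₀ , a₀)` and `(a₀ , b₁)` this
    -- empties every other row; the diagonal of the transposition of `a₀` and `b` must then have its
    -- 1 at `(a₀ , b)`.
    row-case : ∀ b₁ → b₁ < r → b₁ ≢ a₀ → M a₀ b₁ ≡ true → Row r M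
    row-case b₁ l₁ n₁ t₁ = row go
      where
      go : ∀ a b b′ → a < r → b < r → b′ < r → M a b ≡ M a b′
      go a b b′ la lb lb′ with a ≟ a₀
      ... | yes refl = trans (ones b lb) (sym (ones b′ lb′))
        where
          cycle : ∀ b → b < r → b ≢ a₀ → b ≢ b₁ → M b a₀ ≡ true → ⊥
          cycle b lb n n′ e = n (proj₂ (one-on D a₀ b₁ a₀ b l₀ l₁ l₀ lb) b a₀ lb l₀
            (trans (cong (M b) (trans (cong (swap a₀ b) (swap-≢ a₀ b₁ b n n′)) (swap-ʳ a₀ b))) e)
            (trans (cong (M a₀) (trans (cong (swap a₀ b) (swap-ˡ a₀ b₁)) (swap-≢ a₀ b b₁ n₁ (n′ ∘ sym)))) t₁))
          ones : ∀ b → b < r → M a₀ b ≡ true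
          ones b lb with b ≟ a₀ | b ≟ b₁
          ... | yes refl | _        = t₀
          ... | no _     | yes refl = t₁
          ... | no n     | no n′ with proj₁ (transposed D a₀ b l₀ lb)
          ...   | x , lx , e with x ≟ a₀ | x ≟ b
          ...     | yes refl | _        = e
          ...     | no _     | yes refl = ⊥-elim (cycle b lb n n′ e)
          ...     | no nx    | no _     = ⊥-elim (false≢true (diag x lx nx) e)
      ... | no na = trans (zeros b lb) (sym (zeros b′ lb′))
        where
          zeros : ∀ b → b < r → M a b ≡ false
          zeros b lb with b ≟ a₀ | b ≟ a
          ... | _        | yes refl = diag a la na
          ... | no nb    | no n     = off a b la lb na nb (n ∘ sym)
          ... | yes refl | no _ with a ≟ b₁
          ...   | yes refl = ¬true⇒false λ e → na (proj₂ (transposed D b a l₀ la) a b la l₀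
                    (trans (cong (M a) (swap-ʳ b a)) e) (trans (cong (M b) (swap-ˡ b a)) t₁))
          ...   | no n₁′ = ¬true⇒false λ e → na (proj₂ (one-on D b b₁ b a l₀ l₁ l₀ la) a b la l₀
                    (trans (cong (M a) (trans (cong (swap b a) (swap-≢ b b₁ a na n₁′)) (swap-ʳ b a))) e)
                    (trans (cong (M b) (trans (cong (swap b a) (swap-ˡ b b₁)) (swap-≢ b a b₁ n₁ (n₁′ ∘ sym)))) t₁))

  -- The diagonal of the transposition of `a₀` and another colour `x` has its 1 at `(a₀ , x)` or at
  -- `(x , a₀)`, since its other entries lie on the main diagonal. This is a second 1 in the row or
  -- in the column of `(a₀ , a₀)`.
  dichotomy : ∀ {M} → Diagonals r M → Diagonals r (flip′ M) → Row r M ⊎ Row r (flip′ M)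
  dichotomy {M} D D′ with diagonal D
  ... | (a₀ , l₀ , t₀) , u with third a₀ a₀
  ... | x , lx , nx , _ with proj₁ (transposed D a₀ x l₀ lx)
  ... | y , ly , e with y ≟ a₀ | y ≟ x
  ... | yes refl | _        = inj₁ (row-case D l₀ t₀ x lx nx e)
  ... | no _     | yes refl = inj₂ (row-case D′ l₀ t₀ x lx nx e)
  ... | no ny    | no _     = ⊥-elim (ny (u y a₀ ly l₀ e t₀))

  -- Tells the two cases apart: a row of ones meets the columns 0 and 1 simultaneously, a single
  -- column of ones does not. A Boolean, because the zero-one law counts it.
  type : (ℕ → ℕ → Bool) → Bool
  type M = 0 <ᵇ ∑< r (λ a → 𝟙 (M a 0 ∧ M a 1))

  Good : (ℕ → ℕ → Bool) → Set
  Good M = Diagonals r M × Diagonals r (flip′ M)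

  type-row : ∀ {M} → Good M → Row r M → type M ≡ true
  type-row {M} (D , _) R with proj₁ (diagonal D)
  ... | a , la , e = pos _ (≤-trans (≤-reflexive (sym both)) (∑<-term r (λ a → 𝟙 (M a 0 ∧ M a 1)) a la))
    where
      both : 𝟙 (M a 0 ∧ M a 1) ≡ 1
      both rewrite trans (constant R a 0 a la 0<r la) e | trans (constant R a 1 a la 1<r la) e = refl
      pos : ∀ x → 1 ≤ x → (0 <ᵇ x) ≡ true
      pos (suc x) l = refl

  type-col : ∀ {M} → Good M → Row r (flip′ M) → type M ≡ false
  type-col {M} (D , _) Q = cong (0 <ᵇ_) (trans (∑<-cong r {g = λ _ → 0} none) (∑-zero (upTo r)))
    where
      none : ∀ a → a < r → 𝟙 (M a 0 ∧ M a 1) ≡ 0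
      none a la with M a 0 in e₀ | M a 1 in e₁
      ... | false | _     = refl
      ... | true  | false = refl
      ... | true  | true with proj₂ (diagonal D) 0 1 0<r 1<r (trans (constant Q 0 0 a 0<r 0<r la) e₀) (trans (constant Q 1 1 a 1<r 1<r la) e₁)
      ...   | ()

  type-cases : ∀ {M} → Good M → (type M ≡ true × Row r M) ⊎ (type M ≡ false × Row r (flip′ M))
  type-cases G@(D , D′) with dichotomy D D′
  ... | inj₁ R = inj₁ (type-row G R , R)
  ... | inj₂ Q = inj₂ (type-col G Q , Q)

  -- If one matrix had a row and the other a column of ones, the common row `z` would be constant
  -- and also a copy of every row of the second matrix. That matrix would be constant, against
  -- `row⊥`.
  type-share-row : ∀ {M M′} z → z < r → Good M → Good M′ → (∀ b → M z b ≡ M′ z b) → type M ≡ type M′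
  type-share-row {M} {M′} z lz G G′ e with type-cases G | type-cases G′
  ... | inj₁ (t , _) | inj₁ (t′ , _) = trans t (sym t′)
  ... | inj₂ (t , _) | inj₂ (t′ , _) = trans t (sym t′)
  ... | inj₁ (_ , R) | inj₂ (_ , Q) = ⊥-elim (row⊥ (proj₁ G′)
    (row λ a b b′ la lb lb′ → trans (constant Q b a z lb la lz) (trans (sym (e b)) (trans (constant R z b b′ lz lb lb′)
      (trans (e b′) (constant Q b′ z a lb′ lz la))))) Q)
  ... | inj₂ (_ , Q) | inj₁ (_ , R) = ⊥-elim (row⊥ (proj₁ G)
    (row λ a b b′ la lb lb′ → trans (constant Q b a z lb la lz) (trans (e b) (trans (constant R z b b′ lz lb lb′)
      (trans (sym (e b′)) (constant Q b′ z a lb′ lz la))))) Q)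

  type-share-col : ∀ {M M′} z → z < r → Good M → Good M′ → (∀ a → M a z ≡ M′ a z) → type M ≡ type M′
  type-share-col {M} {M′} z lz G G′ e with type-cases G | type-cases G′
  ... | inj₁ (t , _) | inj₁ (t′ , _) = trans t (sym t′)
  ... | inj₂ (t , _) | inj₂ (t′ , _) = trans t (sym t′)
  ... | inj₁ (_ , R) | inj₂ (_ , Q) = ⊥-elim (row⊥ (proj₁ G) R
    (row λ b a a′ lb la la′ → trans (constant R a b z la lb lz) (trans (e a) (trans (constant Q z a a′ lz la la′)
      (trans (sym (e a′)) (constant R a′ z b la′ lz lb))))))
  ... | inj₂ (_ , Q) | inj₁ (_ , R) = ⊥-elim (row⊥ (proj₁ G′) R
    (row λ b a a′ lb la la′ → trans (constant R a b z la lb lz) (trans (sym (e a)) (trans (constant Q z a a′ lz la la′)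
      (trans (e a′) (constant R a′ z b la′ lz lb))))))

cls : ∀ {n} → ℕ → Vec ℕ n → Vec Bool n
cls a = mapᵛ (_≡ᵇ a)

-- The class a of c off B, together with the class b of c on B.
mix : ∀ {n} → Vec Bool n → Vec ℕ n → ℕ → ℕ → Vec Bool n
mix B c a b = zipWith (λ e j → if e then j ≡ᵇ b else (j ≡ᵇ a)) B c

onPart : (ℕ → ℕ) → Bool → ℕ → ℕ
onPart t e j = if e then t j else j

act : ∀ {n} → Vec Bool n → (ℕ → ℕ) → Vec ℕ n → Vec ℕ n
act B t = zipWith (onPart t) B

∁ : ∀ {n} → Vec Bool n → Vec Bool n
∁ = mapᵛ not

mix-same : ∀ {n} (B : Vec Bool n) c a → mix B c a a ≡ cls a c
mix-same []          []      a = refl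
mix-same (true ∷ B)  (j ∷ c) a = cong (_ ∷_) (mix-same B c a)
mix-same (false ∷ B) (j ∷ c) a = cong (_ ∷_) (mix-same B c a)

mix-∁ : ∀ {n} (B : Vec Bool n) c a b → mix (∁ B) c a b ≡ mix B c b a
mix-∁ []          []      a b = refl
mix-∁ (true ∷ B)  (j ∷ c) a b = cong (_ ∷_) (mix-∁ B c a b)
mix-∁ (false ∷ B) (j ∷ c) a b = cong (_ ∷_) (mix-∁ B c a b)

≡ᵇ-adjoint : ∀ (t t⁻ : ℕ → ℕ) → (∀ j → t⁻ (t j) ≡ j) → (∀ j → t (t⁻ j) ≡ j) → ∀ j a → (t j ≡ᵇ a) ≡ (j ≡ᵇ t⁻ a)
≡ᵇ-adjoint t t⁻ e e′ j a with j ≟ t⁻ a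
... | yes refl rewrite e′ a | ≡ᵇ-refl a | ≡ᵇ-refl (t⁻ a) = refl
... | no ne rewrite ≡ᵇ-≢ ne = ≡ᵇ-≢ {t j} {a} λ { refl → ne (sym (e j)) }

-- This turns recolourings of `c` on `B` into generalised diagonals of the matrix with entries
-- `h (mix B c a b)`.
cls-act : ∀ {n} (t t⁻ : ℕ → ℕ) → (∀ j → t⁻ (t j) ≡ j) → (∀ j → t (t⁻ j) ≡ j) →
  ∀ (B : Vec Bool n) c a → cls a (act B t c) ≡ mix B c a (t⁻ a)
cls-act t t⁻ e e′ []          []      a = refl
cls-act t t⁻ e e′ (true ∷ B)  (j ∷ c) a = cong₂ _∷_ (≡ᵇ-adjoint t t⁻ e e′ j a) (cls-act t t⁻ e e′ B c a)
cls-act t t⁻ e e′ (false ∷ B) (j ∷ c) a = cong (_ ∷_) (cls-act t t⁻ e e′ B c a)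

inv-onPart : ∀ {r t} → Inv r t → ∀ e → Inv r (onPart t e)
inv-onPart i true  = i
inv-onPart i false = λ f → refl

∑-letters-mono : ∀ r n {f g : Vec ℕ n → ℕ} → (∀ c → All< r c → f c ≤ g c) → ∑ (letters r n) f ≤ ∑ (letters r n) g
∑-letters-mono r zero h = +-monoˡ-≤ 0 (h [] [])
∑-letters-mono r (suc n) {f} {g} h = subst₂ _≤_ (sym (∑-vecs (upTo r) n f)) (sym (∑-vecs (upTo r) n g))
  (∑<-mono r λ j l → ∑-letters-mono r n λ c A → h (j ∷ c) (l ∷ A))

neq : Bool → Bool → Bool
neq a b = if a then not b else b

neq-refl : ∀ {a b} → a ≡ b → neq a b ≡ false
neq-refl {true}  refl = refl
neq-refl {false} refl = refl

-- `x` and `y` are the sizes of an event and of its complement. The larger one is at least half of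
-- the total, so there are at least `x * (x + y)` ordered pairs on which the event disagrees.
≤-half : ∀ K x y → x ≤ y → K * (x * y + y * x) ≤ (x + y) * (x + y) → K * x ≤ x + y
≤-half K x y x≤y h with x + y in e
... | zero  = subst (λ t → K * t ≤ 0) (sym (m+n≡0⇒m≡0 x e)) (≤-reflexive (*-zeroʳ K))
... | suc s = *-cancelʳ-≤ (K * x) (suc s) (suc s) (begin
    K * x * suc s              ≡⟨ cong (K * x *_) (sym e) ⟩
    K * x * (x + y)            ≡⟨ lem K x y ⟩
    K * (x * y + x * x)        ≤⟨ *-monoʳ-≤ K (+-monoʳ-≤ (x * y) (*-monoˡ-≤ x x≤y)) ⟩
    K * (x * y + y * x)        ≤⟨ h ⟩
    suc s * suc s ∎)
  where open ≤-Reasoning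
        lem : ∀ K x y → K * x * (x + y) ≡ K * (x * y + x * x)
        lem = solve-∀

addᵛ : ∀ (r : ℕ) .{{_ : NonZero r}} {n} → Vec ℕ n → Vec ℕ n → Vec ℕ n
addᵛ r = zipWith (λ s j → (j + s) % r)

addᵛ-comm : ∀ r .{{_ : NonZero r}} {n} (w c : Vec ℕ n) → addᵛ r w c ≡ addᵛ r c w
addᵛ-comm r []      []      = refl
addᵛ-comm r (s ∷ w) (j ∷ c) = cong₂ _∷_ (cong (_% r) (+-comm j s)) (addᵛ-comm r w c)

module _ {r n} .{{_ : NonZero r}} (K : ℕ) (t : Vec ℕ n → Bool)
  (h : ∀ w → All< r w → Most K (letters r n) (λ c → t c ≡ t (addᵛ r w c))) where

  private
    Ω = letters r n
    x = # Ω t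
    y = # Ω (not ∘ t)

    total : x + y ≡ length Ω
    total = trans (sym (∑-+ Ω _ _)) (trans (∑-cong Ω λ c → lem (t c)) (∑-one Ω))
      where lem : ∀ b → 𝟙 b + 𝟙 (not b) ≡ 1
            lem true = refl
            lem false = refl

    pairs : ∑ Ω (λ w → # Ω (λ c → neq (t c) (t (addᵛ r w c)))) ≡ x * y + y * x
    pairs = begin
      ∑ Ω (λ w → # Ω (λ c → neq (t c) (t (addᵛ r w c))))   ≡⟨ ∑-swap Ω Ω _ ⟩
      ∑ Ω (λ c → # Ω (λ w → neq (t c) (t (addᵛ r w c))))
        ≡⟨ ∑-cong Ω (λ c → trans (∑-cong Ω λ w → cong (λ v → 𝟙 (neq (t c) (t v))) (addᵛ-comm r w c))
             (∑-zipWith (upTo r) (λ s j → (j + s) % r) (∑<-rotate r) c (λ v → 𝟙 (neq (t c) (t v))))) ⟩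
      ∑ Ω (λ c → # Ω (λ v → neq (t c) (t v)))              ≡⟨ ∑-cong Ω (λ c → line (t c)) ⟩
      ∑ Ω (λ c → 𝟙 (t c) * y + 𝟙 (not (t c)) * x)          ≡⟨ ∑-+ Ω _ _ ⟩
      ∑ Ω (λ c → 𝟙 (t c) * y) + ∑ Ω (λ c → 𝟙 (not (t c)) * x) ≡⟨ cong₂ _+_ (∑-*ʳ Ω y _) (∑-*ʳ Ω x _) ⟩
      x * y + y * x ∎
      where
        open ≡-Reasoning
        line : ∀ b → # Ω (λ v → neq b (t v)) ≡ 𝟙 b * y + 𝟙 (not b) * x
        line true  = sym (trans (+-identityʳ _) (*-identityˡ y))
        line false = sym (*-identityˡ x)

    main : K * (x * y + y * x) ≤ (x + y) * (x + y)
    main = begin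
      K * (x * y + y * x)                                       ≡⟨ cong (K *_) (sym pairs) ⟩
      K * ∑ Ω (λ w → # Ω (λ c → neq (t c) (t (addᵛ r w c))))    ≡⟨ sym (∑-*ˡ Ω K _) ⟩
      ∑ Ω (λ w → K * # Ω (λ c → neq (t c) (t (addᵛ r w c))))
        ≤⟨ ∑-letters-mono r n (λ w A → ≤-trans (*-monoʳ-≤ K (∑-mono Ω λ c → lem (h w A) c)) (few (h w A))) ⟩
      ∑ Ω (λ w → length Ω)                                      ≡⟨ ∑-const Ω _ ⟩
      length Ω * length Ω                                       ≡⟨ cong₂ _*_ (sym total) (sym total) ⟩
      (x + y) * (x + y) ∎
      where
        open ≤-Reasoning
        lem : ∀ {w} (m : Most K Ω (λ c → t c ≡ t (addᵛ r w c))) c → 𝟙 (neq (t c) (t (addᵛ r w c))) ≤ 𝟙 (bad m c)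
        lem m c with bad m c in e
        ... | true  = 𝟙≤1 _
        ... | false rewrite neq-refl (holds m c e) = z≤n

    not-false : ∀ {b} → not b ≡ false → b ≡ true
    not-false {true} e = refl

  -- For independent random `c` and `w` the translate of `c` by `w` is uniform and independent of
  -- `c`. Hence `t` takes different values at the two with probability 2 x y / (x + y)², and
  -- averaging the hypothesis over `w` bounds this by 1 / `K`.
  zero-one : Most K (letters r n) (λ c → t c ≡ false) ⊎ Most K (letters r n) (λ c → t c ≡ true)
  zero-one with ≤-total x y
  ... | inj₁ le = inj₁ (most t (subst (K * x ≤_) total (≤-half K x y le main)) λ _ e → e)
  ... | inj₂ le = inj₂ (most (not ∘ t)
    (subst (K * y ≤_) (trans (+-comm y x) total)
      (≤-half K y x le (subst₂ _≤_ (cong (K *_) (+-comm (x * y) (y * x))) (cong₂ _*_ (+-comm x y) (+-comm x y)) main)))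
    λ c e → not-false e)

-- γ 0, …, γ 3 interpolate between the identity and the rotation by s; consecutive ones send the same letters to 0, 1, 0
-- respectively.
γ : (r : ℕ) .{{_ : NonZero r}} → ℕ → ℕ → ℕ → ℕ
γ r 0 s       j = j
γ r 1 zero    j = j
γ r 1 (suc s) j = swap (r ∸ suc s) 2 j
γ r 2 zero    j = j
γ r 2 (suc s) j = swap 2 0 (swap (r ∸ suc s) 2 j)
γ r (suc (suc (suc _))) s j = (j + s) % r

∸suc< : ∀ r s → 0 < r → r ∸ suc s < r
∸suc< (suc r) s l = s≤s (m∸n≤m r s)

swap-adjoint : ∀ p q j a → (swap p q j ≡ᵇ a) ≡ (j ≡ᵇ swap p q a)
swap-adjoint p q = ≡ᵇ-adjoint (swap p q) (swap p q) (swap-invol p q) (swap-invol p q)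

τ : (r : ℕ) .{{_ : NonZero r}} → ℕ → ℕ → Bool × ℕ → ℕ → ℕ
τ r k k′ (e , s) j = if e then γ r k s j else γ r k′ s j

-- `γ r k` acts on `B` and `γ r k′` off `B`, each position with its own shift from `w`. The states
-- (0 , 0) and (3 , 3) are `c` and its translate by `w`.
state : (r : ℕ) .{{_ : NonZero r}} → ℕ → ℕ → ∀ {n} → Vec Bool n → Vec ℕ n → Vec ℕ n → Vec ℕ n
state r k k′ B w = zipWith (τ r k k′) (zipWith _,_ B w)

-- One factor `r` for each of the four colours in two transpositions, and 2 for the matrix together
-- with its transpose.
κG : ℕ → ℕ → ℕ
κG r K = r * (r * (r * (r * (2 * K))))

module _ {r : ℕ} .{{_ : NonZero r}} where

  record Share (z k k′ : ℕ) : Set where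
    constructor share
    field
      shared : ∀ s j → s < r → j < r → (γ r k s j ≡ᵇ z) ≡ (γ r k′ s j ≡ᵇ z)
  open Share public

  -- The two colourings differ only off `B`, where the colour `z` occupies the same positions in
  -- both; row `z` sees no other class off `B`.
  mix-share-row : ∀ {z k k₁ k₂} → Share z k₁ k₂ → ∀ {n} (B : Vec Bool n) w c → All< r w → All< r c → ∀ b →
    mix B (state r k k₁ B w c) z b ≡ mix B (state r k k₂ B w c) z b
  mix-share-row {z} {k} {k₁} {k₂} S [] [] [] _ _ b = refl
  mix-share-row {z} {k} {k₁} {k₂} S (true ∷ B)  (s ∷ w) (j ∷ c) (_ ∷ W) (_ ∷ A) b = cong (_ ∷_) (mix-share-row {z} {k} {k₁} {k₂} S B w c W A b)
  mix-share-row {z} {k} {k₁} {k₂} S (false ∷ B) (s ∷ w) (j ∷ c) (l ∷ W) (m ∷ A) b = cong₂ _∷_ (shared S s j l m) (mix-share-row {z} {k} {k₁} {k₂} S B w c W A b)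

  mix-share-col : ∀ {z k k₁ k₂} → Share z k₁ k₂ → ∀ {n} (B : Vec Bool n) w c → All< r w → All< r c → ∀ a →
    mix B (state r k₁ k B w c) a z ≡ mix B (state r k₂ k B w c) a z
  mix-share-col {z} {k} {k₁} {k₂} S [] [] [] _ _ b = refl
  mix-share-col {z} {k} {k₁} {k₂} S (false ∷ B) (s ∷ w) (j ∷ c) (_ ∷ W) (_ ∷ A) b = cong (_ ∷_) (mix-share-col {z} {k} {k₁} {k₂} S B w c W A b)
  mix-share-col {z} {k} {k₁} {k₂} S (true ∷ B)  (s ∷ w) (j ∷ c) (l ∷ W) (m ∷ A) b = cong₂ _∷_ (shared S s j l m) (mix-share-col {z} {k} {k₁} {k₂} S B w c W A b)

  state-00 : ∀ {n} (B : Vec Bool n) w c → state r 0 0 B w c ≡ c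
  state-00 []          []      []      = refl
  state-00 (true ∷ B)  (s ∷ w) (j ∷ c) = cong (j ∷_) (state-00 B w c)
  state-00 (false ∷ B) (s ∷ w) (j ∷ c) = cong (j ∷_) (state-00 B w c)

  state-33 : ∀ {n} (B : Vec Bool n) w c → state r 3 3 B w c ≡ addᵛ r w c
  state-33 []          []      []      = refl
  state-33 (true ∷ B)  (s ∷ w) (j ∷ c) = cong (_ ∷_) (state-33 B w c)
  state-33 (false ∷ B) (s ∷ w) (j ∷ c) = cong (_ ∷_) (state-33 B w c)

module _ {r : ℕ} .{{_ : NonZero r}} (3≤r : 3 ≤ r) where

  private
    0<r : 0 < r
    0<r = ≤-trans (s≤s z≤n) 3≤r
    1<r : 1 < r
    1<r = ≤-trans (s≤s (s≤s z≤n)) 3≤r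

  inv-γ : ∀ k s → Inv r (γ r k s)
  inv-γ 0 s f = refl
  inv-γ 1 zero f = refl
  inv-γ 1 (suc s) = inv-swap r (r ∸ suc s) 2 (∸suc< r s 0<r) 3≤r
  inv-γ 2 zero f = refl
  inv-γ 2 (suc s) = inv-∘ {r} (swap 2 0) (swap (r ∸ suc s) 2) (inv-swap r 2 0 3≤r 0<r) (inv-swap r (r ∸ suc s) 2 (∸suc< r s 0<r) 3≤r)
  inv-γ (suc (suc (suc k))) s = ∑<-rotate r s

  inv-τ : ∀ k k′ i → Inv r (τ r k k′ i)
  inv-τ k k′ (true , s)  = inv-γ k s
  inv-τ k k′ (false , s) = inv-γ k′ s

  share₀₁ : Share 0 0 1
  share₀₁ = share go
    where
    go : ∀ s j → s < r → j < r → (γ r 0 s j ≡ᵇ 0) ≡ (γ r 1 s j ≡ᵇ 0)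
    go zero    j l m = refl
    go (suc s) j l m = sym (trans (swap-adjoint (r ∸ suc s) 2 j 0)
        (cong (j ≡ᵇ_) (swap-≢ (r ∸ suc s) 2 0 (λ e → <⇒≢ (m<n⇒0<n∸m l) e) (λ ()))))

  share₁₂ : Share 1 1 2
  share₁₂ = share go
    where
    go : ∀ s j → s < r → j < r → (γ r 1 s j ≡ᵇ 1) ≡ (γ r 2 s j ≡ᵇ 1)
    go zero    j l m = refl
    go (suc s) j l m = sym (swap-adjoint 2 0 (swap (r ∸ suc s) 2 j) 1)

  -- For a nonzero shift `s`, the two swaps bring `r ∸ s` to 2 and then to 0, and `r ∸ s` is also
  -- the only letter that the rotation by `s` sends to 0.
  share₂₃ : Share 0 2 3
  share₂₃ = share go
    where
    go : ∀ s j → s < r → j < r → (γ r 2 s j ≡ᵇ 0) ≡ (γ r 3 s j ≡ᵇ 0)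
    go zero    j l m = cong (_≡ᵇ 0) (sym (trans (cong (_% r) (+-identityʳ j)) (m<n⇒m%n≡m m)))
    go (suc s) j l m = trans (trans (swap-adjoint 2 0 (swap (r ∸ suc s) 2 j) 0)
        (trans (swap-adjoint (r ∸ suc s) 2 j 2) (cong (j ≡ᵇ_) (swap-ʳ (r ∸ suc s) 2)))) wrap
      where
        u = r ∸ suc s
        u+s : u + suc s ≡ r
        u+s = m∸n+n≡m (<⇒≤ l)
        wrap : (j ≡ᵇ u) ≡ ((j + suc s) % r ≡ᵇ 0)
        wrap with <-cmp j u
        ... | tri< j<u ne _ = trans (≡ᵇ-≢ ne) (sym (≡ᵇ-≢ {(j + suc s) % r} {0} λ e →
                m+1+n≢0 j (trans (sym (m<n⇒m%n≡m (subst (j + suc s <_) u+s (+-monoˡ-< (suc s) j<u)))) e)))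
        ... | tri≈ _ refl _ = trans (≡ᵇ-refl u) (sym (cong (_≡ᵇ 0) (trans (cong (_% r) u+s) (trans ([m+n]%n≡m%n 0 r) (m<n⇒m%n≡m 0<r)))))
        ... | tri> _ ne u<j = trans (≡ᵇ-≢ ne) (sym (≡ᵇ-≢ {(j + suc s) % r} {0} λ e → <⇒≢ (m<n⇒0<n∸m u<j) (sym (trans (sym v) e))))
          where
            v : (j + suc s) % r ≡ j ∸ u
            v = trans (cong (_% r) (trans (cong (_+ suc s) (sym (m∸n+n≡m (<⇒≤ u<j)))) (trans (+-assoc (j ∸ u) u _) (cong (j ∸ u +_) u+s))))
                  (trans ([m+n]%n≡m%n (j ∸ u) r) (m<n⇒m%n≡m (≤-<-trans (m∸n≤m j u) m)))

  module _ {n : ℕ} (h : Vec Bool n → Bool) where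

    OneHeavy : Vec ℕ n → Set
    OneHeavy c = One r (λ a → h (cls a c))

    M : Vec Bool n → Vec ℕ n → ℕ → ℕ → Bool
    M B c a b = h (mix B c a b)

    -- By `cls-act` a diagonal of the matrix of `c` lists the classes of a recoloured `c`, and
    -- recolouring preserves the distribution.
    most-diagonals : ∀ B K → Most (r * (r * (r * (r * K)))) (letters r n) OneHeavy → Most K (letters r n) (λ c → Diagonals r (M B c))
    most-diagonals B K U = most-map (λ c f → diagonals λ p q p′ q′ lp lq lp′ lq′ →
        one-cong (λ a → cong h (cls-act (swap p q ∘ swap p′ q′) (swap p′ q′ ∘ swap p q)
            (λ j → trans (cong (swap p′ q′) (swap-invol p q (swap p′ q′ j))) (swap-invol p′ q′ j))
            (λ j → trans (cong (swap p q) (swap-invol p′ q′ (swap p q j))) (swap-invol p q j)) B c a))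
          (f p lp q lq p′ lp′ q′ lq′))
      (most-∀ r K _ λ p lp → most-∀ r (r * K) _ λ q lq → most-∀ r (r * (r * K)) _ λ p′ lp′ → most-∀ r (r * (r * (r * K))) _ λ q′ lq′ →
        most-recolour (onPart (swap p q ∘ swap p′ q′))
          (inv-onPart {r} {swap p q ∘ swap p′ q′} (inv-∘ {r} (swap p q) (swap p′ q′) (inv-swap r p q lp lq) (inv-swap r p′ q′ lp′ lq′))) B U)

    most-good : ∀ B K → Most (κG r K) (letters r n) OneHeavy → Most K (letters r n) (λ c → Good 3≤r (M B c))
    most-good B K U = most-map (λ c (D , D′) → D , diagonals λ p q p′ q′ lp lq lp′ lq′ →
        one-cong (λ a → cong h (mix-∁ B c a _)) (one-on D′ p q p′ q′ lp lq lp′ lq′))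
      (most-× K (most-diagonals B (2 * K) U) (most-diagonals (∁ B) (2 * K) U))

    -- Along the states (0 , 0), (1 , 0), (2 , 0), (3 , 0), (3 , 1), (3 , 2), (3 , 3) consecutive
    -- matrices share a column while `B` is being recoloured and a row while its complement is. The
    -- type is therefore constant on the path. The factor `4 * 4` is a union bound over the states.
    type-shift : ∀ B K → Most (4 * (4 * (2 * K))) (letters r n) (λ c → Good 3≤r (M B c)) → ∀ w → All< r w →
      Most K (letters r n) (λ c → type 3≤r (M B c) ≡ type 3≤r (M B (addᵛ r w c)))
    type-shift B K G w W = most-map chain (most-× K (most-all< (2 * K) r n)
        (most-∀ 4 (2 * K) _ λ k lk → most-∀ 4 (4 * (2 * K)) _ λ k′ lk′ → most-recolour (τ r k k′) (inv-τ k k′) (zipWith _,_ B w) G))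
      where
        t : Vec ℕ n → Bool
        t c = type 3≤r (M B c)
        chain : ∀ c → All< r c × (∀ k → k < 4 → ∀ k′ → k′ < 4 → Good 3≤r (M B (state r k k′ B w c))) → t c ≡ t (addᵛ r w c)
        chain c (A , g) = begin
          t c                       ≡⟨ cong t (sym (state-00 B w c)) ⟩
          t (state r 0 0 B w c)     ≡⟨ col 0 1 0 {z = 0} 0<r share₀₁ ⟩
          t (state r 1 0 B w c)     ≡⟨ col 1 2 0 {z = 1} 1<r share₁₂ ⟩
          t (state r 2 0 B w c)     ≡⟨ col 2 3 0 {z = 0} 0<r share₂₃ ⟩
          t (state r 3 0 B w c)     ≡⟨ ro 0 1 {z = 0} 0<r share₀₁ ⟩
          t (state r 3 1 B w c)     ≡⟨ ro 1 2 {z = 1} 1<r share₁₂ ⟩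
          t (state r 3 2 B w c)     ≡⟨ ro 2 3 {z = 0} 0<r share₂₃ ⟩
          t (state r 3 3 B w c)     ≡⟨ cong t (state-33 B w c) ⟩
          t (addᵛ r w c) ∎
          where
            open ≡-Reasoning
            col : ∀ k₁ k₂ k {l₁ : True (k₁ <? 4)} {l₂ : True (k₂ <? 4)} {l : True (k <? 4)} {z} → z < r → Share z k₁ k₂ →
              t (state r k₁ k B w c) ≡ t (state r k₂ k B w c)
            col k₁ k₂ k {l₁} {l₂} {l} {z} lz S = type-share-col 3≤r z lz (g k₁ (toWitness l₁) k (toWitness l)) (g k₂ (toWitness l₂) k (toWitness l))
              (λ a → cong h (mix-share-col {z = z} {k} {k₁} {k₂} S B w c W A a))
            ro : ∀ k₁ k₂ {l₁ : True (k₁ <? 4)} {l₂ : True (k₂ <? 4)} {z} → z < r → Share z k₁ k₂ →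
              t (state r 3 k₁ B w c) ≡ t (state r 3 k₂ B w c)
            ro k₁ k₂ {l₁} {l₂} {z} lz S = type-share-row 3≤r z lz (g 3 ≤-refl k₁ (toWitness l₁)) (g 3 ≤-refl k₂ (toWitness l₂))
              (λ b → cong h (mix-share-row {z = z} {3} {k₁} {k₂} S B w c W A b))

-- The decisive position

pre : ∀ n → ℕ → Vec Bool n
pre zero    _       = []
pre (suc n) zero    = false ∷ pre n zero
pre (suc n) (suc j) = true ∷ pre n j

mix-pre-0 : ∀ {n} (c : Vec ℕ n) a b → mix (pre n 0) c a b ≡ cls a c
mix-pre-0 []      a b = refl
mix-pre-0 (j ∷ c) a b = cong (_ ∷_) (mix-pre-0 c a b)

mix-pre-n : ∀ {n} (c : Vec ℕ n) a b → mix (pre n n) c a b ≡ cls b c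
mix-pre-n []      a b = refl
mix-pre-n (j ∷ c) a b = cong (_ ∷_) (mix-pre-n c a b)

act-pre-0 : ∀ {n} t (c : Vec ℕ n) → act (pre n 0) t c ≡ c
act-pre-0 t []      = refl
act-pre-0 t (j ∷ c) = cong (j ∷_) (act-pre-0 t c)

act-∁-pre-0 : ∀ {n} t (c : Vec ℕ n) → act (∁ (pre n 0)) t c ≡ mapᵛ t c
act-∁-pre-0 t []      = refl
act-∁-pre-0 t (j ∷ c) = cong (t j ∷_) (act-∁-pre-0 t c)

-- The two recolourings act before and after position `i`. They leave `i` itself alone, and so does
-- `t`, which fixes its colour.
act-around : ∀ {n} t (c : Vec ℕ n) (i : Fin n) → t (lookup c i) ≡ lookup c i →
  act (∁ (pre n (suc (toℕ i)))) t (act (pre n (toℕ i)) t c) ≡ mapᵛ t c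
act-around t (j ∷ c) fz     e = cong₂ _∷_ (sym e) (trans (cong (act _ t) (act-pre-0 t c)) (act-∁-pre-0 t c))
act-around t (j ∷ c) (fs i) e = cong (t j ∷_) (act-around t c i e)

act-full : ∀ {n} t (c : Vec ℕ n) → act (pre n n) t c ≡ mapᵛ t c
act-full t []      = refl
act-full t (j ∷ c) = cong (t j ∷_) (act-full t c)

module _ {r : ℕ} .{{_ : NonZero r}} (3≤r : 3 ≤ r) {n : ℕ} (h : Vec Bool n → Bool) where

  private
    0<r : 0 < r
    0<r = ≤-trans (s≤s z≤n) 3≤r
    1<r : 1 < r
    1<r = ≤-trans (s≤s (s≤s z≤n)) 3≤r
    m : Vec Bool n → Vec ℕ n → ℕ → ℕ → Bool
    m = M 3≤r h
    L = letters r n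

  -- `Row` for `B` says that heaviness of a mixed class ignores the class used on `B`; `Row` for
  -- `∁ B` says the same off `B`. Which of the two holds is a Boolean function of the colouring,
  -- nearly invariant under translations, so the zero-one law fixes it for almost all colourings at
  -- once.
  row-or-column : ∀ K {K₁} → 2 * K ≤ K₁ → 4 * (4 * (2 * (2 * K))) ≤ K₁ → ∀ B → Most K₁ L (λ c → Good 3≤r (m B c)) →
    Most K L (λ c → Row r (m B c)) ⊎ Most K L (λ c → Row r (m (∁ B) c))
  row-or-column K {K₁} 2K≤ le B G = [ (λ Z → inj₂ (most-map toCol (most-× K Z G′))) , (λ Z → inj₁ (most-map toRow (most-× K Z G′))) ]′
      (zero-one (2 * K) t (type-shift 3≤r h B (2 * K) (most-weaken le G)))
    where
      t : Vec ℕ n → Bool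
      t c = type 3≤r (m B c)
      G′ : Most (2 * K) L (λ c → Good 3≤r (m B c))
      G′ = most-weaken 2K≤ G
      toCol : ∀ c → t c ≡ false × Good 3≤r (m B c) → Row r (m (∁ B) c)
      toCol c (e , g) with type-cases 3≤r g
      ... | inj₁ (e′ , _) = ⊥-elim (false≢true e e′)
      ... | inj₂ (_ , Q)  = row λ a b b′ la lb lb′ → trans (cong h (mix-∁ B c a b))
        (trans (constant Q a b b′ la lb lb′) (sym (cong h (mix-∁ B c a b′))))
      toRow : ∀ c → t c ≡ true × Good 3≤r (m B c) → Row r (m B c)
      toRow c (e , g) with type-cases 3≤r g
      ... | inj₁ (_ , R)  = R
      ... | inj₂ (e′ , _) = ⊥-elim (false≢true e′ e)

  private
    module Search {K K₁ K₃ : ℕ} (1≤K : 1 ≤ K) (K≤K₁ : 2 * (2 * K) ≤ K₁) (K≤K₃ : r * (r * (2 * (2 * K))) ≤ K₃)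
      (U : Most K₁ L (OneHeavy 3≤r h))
      (null : ∀ B → Most K₃ L (λ c → Row r (m B c)) ⊎ Most K₃ L (λ c → Row r (m (∁ B) c))) where

      ≤r* : ∀ x → x ≤ r * x
      ≤r* x = m≤n*m x r
      U₄ : Most (2 * (2 * K)) L (OneHeavy 3≤r h)
      U₄ = most-weaken K≤K₁ U
      4≤ : 4 ≤ 2 * (2 * K)
      4≤ = *-monoʳ-≤ 2 (*-monoʳ-≤ 2 1≤K)
      down : 2 * (2 * K) ≤ K₃
      down = ≤-trans (≤r* (2 * (2 * K))) (≤-trans (≤r* (r * (2 * (2 * K)))) K≤K₃)

      FoundAt : Fin n → Set
      FoundAt i = Most K₃ L (λ c → Row r (m (pre n (toℕ i)) c)) × Most K₃ L (λ c → Row r (m (∁ (pre n (suc (toℕ i)))) c))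

      -- If heaviness ignored the colours of all positions, every class of a colouring with a heavy
      -- class would be heavy.
      full-row⊥ : Most K₃ L (λ c → Row r (m (pre n n) c)) → ⊥
      full-row⊥ R = clash (most-∃ {xs = L} (subst (0 <_) (sym (length-letters r n)) (m^n>0 r n))
                      (most-× 2 (most-weaken 4≤ U₄) (most-weaken (≤-trans 4≤ down) R)))
        where
          clash : ∃ (λ c → OneHeavy 3≤r h c × Row r (m (pre n n) c)) → ⊥
          clash (c , ((a , la , e) , u) , R′) = contra (u 0 1 0<r 1<r (heavy 0 0<r) (heavy 1 1<r))
            where heavy : ∀ b → b < r → h (cls b c) ≡ true
                  heavy b lb = trans (cong h (sym (mix-pre-n c 0 b))) (trans (constant R′ 0 b a 0<r lb la) (trans (cong h (mix-pre-n c 0 a)) e))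
                  contra : 0 ≡ 1 → ⊥
                  contra ()

      -- The empty segment can be ignored and the full one cannot, so some position is the first
      -- whose inclusion switches the alternative. Every answer of `null` comes with the same error
      -- `K₃`; the n steps accumulate none.
      search : ∀ s j → j + s ≡ n → Most K₃ L (λ c → Row r (m (pre n j) c)) → ∃ FoundAt
      search zero j e R = ⊥-elim (full-row⊥ (subst (λ j → Most K₃ L (λ c → Row r (m (pre n j) c))) (trans (sym (+-identityʳ j)) e) R))
      search (suc s) j e R = [ search s (suc j) (trans (sym (+-suc j s)) e) , found ]′ (null (pre n (suc j)))
        where
          j<n : j < n
          j<n = subst (suc j ≤_) (trans (sym (+-suc j s)) e) (m≤m+n (suc j) s)
          found : Most K₃ L (λ c → Row r (m (∁ (pre n (suc j))) c)) → ∃ FoundAt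
          found R′ = fromℕ< j<n , subst (λ t → Most K₃ L (λ c → Row r (m (pre n t) c))) (sym (toℕ-fromℕ< j<n)) R ,
                      subst (λ t → Most K₃ L (λ c → Row r (m (∁ (pre n (suc t))) c))) (sym (toℕ-fromℕ< j<n)) R′

      -- Let `a` be heavy in `c`, and suppose that `i` has another colour `x`. Take `q` different
      -- from `a` and `x`, and exchange `a` and `q` before `i` and then after `i`: class `a` stays
      -- heavy both times. The result is the exchange on all of `c`, so `q` is heavy in `c` as well,
      -- against uniqueness. The second exchange applies to an already recoloured `c`, which costs
      -- the two factors `r`.
      finish : ∃ FoundAt → Σ (Fin n) λ i → Most K L (λ c → h (cls (lookup c i) c) ≡ true)
      finish (i , R , R′) = i , most-map done
          (most-× K (most-× (2 * K) U₄ (most-weaken down R))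
            (most-∀ r (2 * K) _ λ p lp → most-∀ r (r * (2 * K)) _ λ q lq →
              most-recolour (onPart (swap p q)) (inv-onPart {r} {swap p q} (inv-swap r p q lp lq)) B
                (most-weaken (≤-trans (*-monoʳ-≤ r (*-monoʳ-≤ r (m≤n*m (2 * K) 2))) K≤K₃) R′)))
        where
          B B′ : Vec Bool n
          B  = pre n (toℕ i)
          B′ = ∁ (pre n (suc (toℕ i)))
          done : ∀ c → (OneHeavy 3≤r h c × Row r (m B c)) ×
            (∀ p → p < r → ∀ q → q < r → Row r (m B′ (act B (swap p q) c))) → h (cls (lookup c i) c) ≡ true
          done c ((((a , la , e) , u) , R₁) , R₂) = decide (a ≟ lookup c i)
            where
            decide : Dec (a ≡ lookup c i) → h (cls (lookup c i) c) ≡ true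
            decide (yes e′) = subst (λ b → h (cls b c) ≡ true) e′ e
            decide (no a≢x) = ⊥-elim (q≢a (u q a lq la q-heavy e))
              where
              other = third 3≤r a (lookup c i)
              q = proj₁ other
              lq = proj₁ (proj₂ other)
              q≢a = proj₁ (proj₂ (proj₂ other))
              q≢x = proj₂ (proj₂ (proj₂ other))
              t : ℕ → ℕ
              t = swap a q
              t< : t a < r
              t< = swap-< a q a la lq la
              adj : ∀ B c → cls a (act B t c) ≡ mix B c a (t a)
              adj B c = cls-act t t (swap-invol a q) (swap-invol a q) B c a
              c₁ = act B t c
              e₁ : h (cls a c₁) ≡ true
              e₁ = trans (cong h (adj B c)) (trans (constant R₁ a (t a) a la t< la) (trans (cong h (mix-same B c a)) e))
              e₂ : h (cls a (act B′ t c₁)) ≡ true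
              e₂ = trans (cong h (adj B′ c₁)) (trans (constant (R₂ a la q lq) a (t a) a la t< la) (trans (cong h (mix-same B′ c₁ a)) e₁))
              q-heavy : h (cls q c) ≡ true
              q-heavy = trans (cong h (sym (trans (cong (cls a) (trans (act-around t c i (swap-≢ a q _ (a≢x ∘ sym) (q≢x ∘ sym))) (sym (act-full t c))))
                (trans (adj (pre n n) c) (trans (mix-full c (t a)) (cong (λ b → cls b c) (swap-ˡ a q))))))) e₂
                where mix-full : ∀ c b → mix (pre n n) c a b ≡ cls b c
                      mix-full c b = mix-pre-n c a b

  dictator-of : ∀ {K K₁ K₂ K₃} → 1 ≤ K → 2 * (2 * K) ≤ K₁ → r * (r * (2 * (2 * K))) ≤ K₃ → 2 * K₃ ≤ K₂ →
    4 * (4 * (2 * (2 * K₃))) ≤ K₂ → κG r K₂ ≤ K₁ → Most K₁ L (OneHeavy 3≤r h) →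
    Σ (Fin n) λ i → Most K L (λ c → h (cls (lookup c i) c) ≡ true)
  dictator-of {K} {K₁} {K₂} {K₃} 1≤K a₁ a₂ a₃ a₄ a₅ U = finish (search n 0 refl (most-all λ c → row λ a b b′ _ _ _ →
      trans (cong h (mix-pre-0 c a b)) (sym (cong h (mix-pre-0 c a b′)))))
    where open Search 1≤K a₁ a₂ U (λ B → row-or-column K₃ a₃ a₄ B (most-good 3≤r h B K₂ (most-weaken a₅ U)))

-- `K₁` depends on `r` and `K` alone. This allows the number of blocks of the cycle, on which the
-- later `h` depends, to be chosen after `K₁`.
dictator : ∀ {r} .{{_ : NonZero r}} (3≤r : 3 ≤ r) K → 1 ≤ K → Σ ℕ λ K₁ → ∀ {n} (h : Vec Bool n → Bool) →
  Most K₁ (letters r n) (OneHeavy 3≤r h) → Σ (Fin n) λ i → Most K (letters r n) (λ c → h (cls (lookup c i) c) ≡ true)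
dictator {r} 3≤r K 1≤K = K₁ , λ h → dictator-of 3≤r h 1≤K (m≤m+n (2 * (2 * K)) (κG r K₂)) (≤-refl {K₃}) (b₁ K₃)
    (≤-reflexive (b₂ K₃)) (m≤n+m (κG r K₂) (2 * (2 * K)))
  where
    K₃ K₂ K₁ : ℕ
    K₃ = r * (r * (2 * (2 * K)))
    -- 64 = 4 * 4 * 2 * 2: the sixteen states of `type-shift`, and one doubling each there and in
    -- `row-or-column`.
    K₂ = 64 * K₃
    K₁ = 2 * (2 * K) + κG r K₂
    b₁ : ∀ x → 2 * x ≤ 64 * x
    b₁ x = *-monoˡ-≤ x {2} {64} (m≤m+n 2 62)
    b₂ : ∀ x → 4 * (4 * (2 * (2 * x))) ≡ 64 * x
    b₂ = solve-∀

∑-split : {A : Set} (xs : List A) (p : A → Bool) (g : Bool → ℕ) → ∑ xs (g ∘ p) ≡ # xs p * g true + # xs (not ∘ p) * g false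
∑-split xs p g = trans (∑-cong xs λ x → lem (p x))
  (trans (∑-+ xs (λ x → 𝟙 (p x) * g true) (λ x → 𝟙 (not (p x)) * g false)) (cong₂ _+_ (∑-*ʳ xs _ _) (∑-*ʳ xs _ _)))
  where lem : ∀ b → g b ≡ 𝟙 b * g true + 𝟙 (not b) * g false
        lem true  = sym (trans (+-identityʳ _) (*-identityˡ _))
        lem false = sym (*-identityˡ _)

#-total : {A : Set} (xs : List A) (p : A → Bool) → # xs p + # xs (not ∘ p) ≡ length xs
#-total xs p = trans (cong₂ _+_ (sym (*-identityʳ (# xs p))) (sym (*-identityʳ (# xs (not ∘ p)))))
  (trans (sym (∑-split xs p (λ _ → 1))) (∑-one xs))

-- Densities of uniform families

card : ∀ {n} → Vec Bool n → ℕ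
card []      = 0
card (e ∷ v) = 𝟙 e + card v

sub : ∀ {n} → Vec Bool n → Vec Bool n → Bool
sub []          []          = true
sub (true ∷ A)  (false ∷ X) = false
sub (true ∷ A)  (true ∷ X)  = sub A X
sub (false ∷ A) (_ ∷ X)     = sub A X

infixr 7 _∩_
_∩_ : ∀ {n} → Vec Bool n → Vec Bool n → Vec Bool n
_∩_ = zipWith _∧_

card≤ : ∀ {n} (A : Vec Bool n) → card A ≤ n
card≤ []          = z≤n
card≤ (true ∷ A)  = s≤s (card≤ A)
card≤ (false ∷ A) = m≤n⇒m≤1+n (card≤ A)

card-∁ : ∀ {n} (A : Vec Bool n) → card A + card (∁ A) ≡ n
card-∁ []          = refl
card-∁ (true ∷ A)  = cong suc (card-∁ A)
card-∁ (false ∷ A) = trans (+-suc (card A) _) (cong suc (card-∁ A))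

sub-card : ∀ {n} (A X : Vec Bool n) → sub A X ≡ true → card A ≤ card X
sub-card []          []          e = z≤n
sub-card (true ∷ A)  (true ∷ X)  e = s≤s (sub-card A X e)
sub-card (false ∷ A) (true ∷ X)  e = m≤n⇒m≤1+n (sub-card A X e)
sub-card (false ∷ A) (false ∷ X) e = sub-card A X e

sub-∩ : ∀ {n} (A X Y : Vec Bool n) → sub A (X ∩ Y) ≡ sub A X ∧ sub A Y
sub-∩ []          []          []          = refl
sub-∩ (true ∷ A)  (true ∷ X)  (true ∷ Y)  = sub-∩ A X Y
sub-∩ (true ∷ A)  (true ∷ X)  (false ∷ Y) with sub A X
... | true  = refl
... | false = refl
sub-∩ (true ∷ A)  (false ∷ X) (y ∷ Y)     = refl
sub-∩ (false ∷ A) (x ∷ X)     (y ∷ Y)     = sub-∩ A X Y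

𝟙-∧ : ∀ a b → 𝟙 (a ∧ b) ≡ 𝟙 a * 𝟙 b
𝟙-∧ true  b = sym (*-identityˡ _)
𝟙-∧ false b = refl

subsets : (n : ℕ) → List (Vec Bool n)
subsets = vecs (false ∷ true ∷ [])

∑-subsets : ∀ n (f : Vec Bool (suc n) → ℕ) →
  ∑ (subsets (suc n)) f ≡ ∑ (subsets n) (f ∘ (false ∷_)) + ∑ (subsets n) (f ∘ (true ∷_))
∑-subsets n f = trans (∑-vecs (false ∷ true ∷ []) n f) (cong (∑ (subsets n) (f ∘ (false ∷_)) +_) (+-identityʳ _))

-- Pascal's rule holds by computation, as the recursions over subsets require; `choose≡C` translates
-- at the end.
choose : ℕ → ℕ → ℕ
choose n       zero    = 1
choose zero    (suc k) = 0
choose (suc n) (suc k) = choose n k + choose n (suc k)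

choose≡C : ∀ n k → choose n k ≡ n C k
choose≡C n zero = sym (trans (nCk≡nC[n∸k] {0} {n} z≤n) (nCn≡1 n))
choose≡C zero (suc k) = sym (k>n⇒nCk≡0 (s≤s (z≤n {k})))
choose≡C (suc n) (suc k) = trans (cong₂ _+_ (choose≡C n k) (choose≡C n (suc k))) (nCk+nC[k+1]≡[n+1]C[k+1] n k)

choose-pos : ∀ n k → k ≤ n → 0 < choose n k
choose-pos n       zero    l       = z<s
choose-pos (suc n) (suc k) (s≤s l) = ≤-trans (choose-pos n k l) (m≤m+n _ _)

choose-zero : ∀ n k → n < k → choose n k ≡ 0
choose-zero zero    (suc k) l       = refl
choose-zero (suc n) (suc k) (s≤s l) = cong₂ _+_ (choose-zero n k l) (choose-zero n (suc k) (m<n⇒m<1+n l))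

absorb : ∀ n k → suc k * choose (suc n) (suc k) ≡ suc n * choose n k
absorb n zero = lem n
  where lem : ∀ n → 1 * choose (suc n) 1 ≡ suc n * 1
        lem zero    = refl
        lem (suc n) = cong suc (lem n)
absorb zero (suc k) = *-zeroʳ k
absorb (suc n) (suc k) = begin
  suc (suc k) * (choose (suc n) (suc k) + choose (suc n) (suc (suc k)))
    ≡⟨ *-distribˡ-+ (suc (suc k)) (choose (suc n) (suc k)) _ ⟩
  suc (suc k) * choose (suc n) (suc k) + suc (suc k) * choose (suc n) (suc (suc k))
    ≡⟨ cong₂ _+_ (cong (choose (suc n) (suc k) +_) (absorb n k)) (absorb n (suc k)) ⟩
  choose (suc n) (suc k) + suc n * choose n k + suc n * choose n (suc k)
    ≡⟨ lem (choose n k) (choose n (suc k)) n ⟩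
  suc (suc n) * choose (suc n) (suc k) ∎
  where open ≡-Reasoning
        lem : ∀ x y n → x + y + suc n * x + suc n * y ≡ suc (suc n) * (x + y)
        lem = solve-∀

kset : ∀ {n} → ℕ → Vec Bool n → Bool
kset k A = card A ≡ᵇ k

infix 9 _⟨_⟩
_⟨_⟩ : ∀ {n} → (Vec Bool n → Bool) → Vec Bool n → ℕ
m ⟨ X ⟩ = # (subsets _) (λ A → m A ∧ sub A X)

∧-false : ∀ b → b ∧ false ≡ false
∧-false true  = refl
∧-false false = refl

kset⟨⟩ : ∀ {n} k (X : Vec Bool n) → kset k ⟨ X ⟩ ≡ choose (card X) k
kset⟨⟩ zero    [] = refl
kset⟨⟩ (suc k) [] = refl
kset⟨⟩ {suc n} k (false ∷ X) = trans (∑-subsets n (λ A → 𝟙 (kset k A ∧ sub A (false ∷ X)))) (trans (cong₂ _+_ (kset⟨⟩ k X)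
  (trans (∑-cong (subsets n) λ A → cong 𝟙 (∧-false (suc (card A) ≡ᵇ k))) (∑-zero (subsets n)))) (+-identityʳ _))
kset⟨⟩ {suc n} zero (true ∷ X) = trans (∑-subsets n (λ A → 𝟙 (kset 0 A ∧ sub A (true ∷ X)))) (cong₂ _+_ (kset⟨⟩ zero X) (∑-zero (subsets n)))
kset⟨⟩ {suc n} (suc k) (true ∷ X) = trans (∑-subsets n (λ A → 𝟙 (kset (suc k) A ∧ sub A (true ∷ X))))
  (trans (cong₂ _+_ (kset⟨⟩ (suc k) X) (kset⟨⟩ k X)) (+-comm (choose (card X) (suc k)) _))

-- An integral replacement for dividing by binomial coefficients: weight w / D = 1 / choose w k.
record Scale (n k : ℕ) : Set where
  field
    D      : ℕ
    D>0    : 0 < D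
    weight : ℕ → ℕ
    exact  : ∀ w → w ≤ n → k ≤ w → weight w * choose w k ≡ D
    null   : ∀ w → w < k → weight w ≡ 0

scale : ∀ n k → Scale n k
scale zero k = record { D = 1 ; D>0 = z<s ; weight = wt k ; exact = ex k ; null = nl k }
  where wt : ℕ → ℕ → ℕ
        wt zero    w = 1
        wt (suc k) w = 0
        ex : ∀ k w → w ≤ 0 → k ≤ w → wt k w * choose w k ≡ 1
        ex zero zero l l′ = refl
        nl : ∀ k w → w < k → wt k w ≡ 0
        nl (suc k) w l = refl
scale (suc n) k = record
  { D = D S * c ; D>0 = *-mono-≤ (D>0 S) c>0 ; weight = wt ; exact = ex ; null = nl }
  where
    open Scale
    S = scale n k
    -- Equals `choose (suc n) k` when that is positive and 1 otherwise, so that `D` stays positive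
    -- for k > n + 1.
    c = suc (choose (suc n) k ∸ 1)
    c>0 : 0 < c
    c>0 = z<s
    wt : ℕ → ℕ
    wt w with w ≤? n | k ≤? w
    ... | yes _ | _     = weight S w * c
    ... | no _  | yes _ = D S
    ... | no _  | no _  = 0
    ex : ∀ w → w ≤ suc n → k ≤ w → wt w * choose w k ≡ D S * c
    ex w l l′ with w ≤? n | k ≤? w
    ... | yes q | _ = trans (lem (weight S w) c (choose w k)) (cong (_* c) (exact S w q l′))
      where lem : ∀ x y z → x * y * z ≡ x * z * y
            lem = solve-∀
    ... | no ¬q | no ¬p = ⊥-elim (¬p l′)
    ... | no ¬q | yes p with ≤-antisym l (≰⇒> ¬q)
    ...   | refl with choose (suc n) k | choose-pos (suc n) k p
    ...     | suc x | _ = refl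
    nl : ∀ w → w < k → wt w ≡ 0
    nl w l with w ≤? n | k ≤? w
    ... | yes _ | _     = cong (_* c) (null S w l)
    ... | no _  | yes p = ⊥-elim (<⇒≱ l p)
    ... | no _  | no _  = refl

module _ {A : Set} (xs : List A) (p : A → Bool) where

  private
    a = # xs p
    b = # xs (not ∘ p)

  -- The sum of C(e, w) a^w b^(e - w) κ(w) over w: an unnormalised expectation of κ under a binomial
  -- distribution.
  binomial-sum : ℕ → (ℕ → ℕ) → ℕ
  binomial-sum zero    κ = κ 0
  binomial-sum (suc e) κ = a * binomial-sum e (κ ∘ suc) + b * binomial-sum e κ

  binomial-sum-cong : ∀ e {κ κ′ : ℕ → ℕ} → (∀ w → κ w ≡ κ′ w) → binomial-sum e κ ≡ binomial-sum e κ′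
  binomial-sum-cong zero    h = h 0
  binomial-sum-cong (suc e) h = cong₂ (λ s t → a * s + b * t) (binomial-sum-cong e (h ∘ suc)) (binomial-sum-cong e h)

  -- The weight of the random set X ∩ p(v), restricted to the event that it contains A ⊆ X, depends on |X| and |A| only.
  average-above : ∀ {n} (κ : ℕ → ℕ) (X A : Vec Bool n) e → sub A X ≡ true → card A + e ≡ card X →
    ∑ (vecs xs n) (λ v → 𝟙 (sub A (mapᵛ p v)) * κ (card (X ∩ mapᵛ p v)))
      ≡ (a + b) ^ card (∁ X) * (a ^ card A * binomial-sum e (λ w → κ (card A + w)))
  average-above κ [] [] zero s eq = trans (+-identityʳ _) (sym (*-identityˡ _))
  average-above {suc n} κ (false ∷ X) (false ∷ A) e s eq = begin
    ∑ (vecs xs (suc n)) _      ≡⟨ ∑-vecs xs n _ ⟩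
    ∑ xs (λ _ → S)             ≡⟨ ∑-const xs S ⟩
    length xs * S              ≡⟨ cong₂ _*_ (sym (#-total xs p)) (average-above κ X A e s eq) ⟩
    (a + b) * ((a + b) ^ card (∁ X) * R) ≡⟨ sym (*-assoc (a + b) ((a + b) ^ card (∁ X)) R) ⟩
    (a + b) ^ suc (card (∁ X)) * R ∎
    where open ≡-Reasoning
          S = ∑ (vecs xs n) (λ v → 𝟙 (sub A (mapᵛ p v)) * κ (card (X ∩ mapᵛ p v)))
          R = a ^ card A * binomial-sum e (λ w → κ (card A + w))
  average-above {suc n} κ (true ∷ X) (true ∷ A) e s eq = begin
    ∑ (vecs xs (suc n)) _      ≡⟨ ∑-vecs xs n _ ⟩
    ∑ xs (G ∘ p)               ≡⟨ ∑-split xs p G ⟩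
    a * G true + b * G false   ≡⟨ cong₂ (λ s t → a * s + b * t) (average-above (κ ∘ suc) X A e s (suc-injective eq)) (∑-zero (vecs xs n)) ⟩
    a * (P * (a ^ card A * R)) + b * 0 ≡⟨ lem a b P (a ^ card A) R ⟩
    P * (a ^ suc (card A) * R) ∎
    where open ≡-Reasoning
          G : Bool → ℕ
          G y = ∑ (vecs xs n) (λ v → 𝟙 (sub (true ∷ A) (y ∷ mapᵛ p v)) * κ (𝟙 y + card (X ∩ mapᵛ p v)))
          P = (a + b) ^ card (∁ X)
          R = binomial-sum e (λ w → κ (suc (card A + w)))
          lem : ∀ a b P Q R → a * (P * (Q * R)) + b * 0 ≡ P * (a * Q * R)
          lem = solve-∀
  average-above {suc n} κ (true ∷ X) (false ∷ A) zero s eq = ⊥-elim (<⇒≱ (≤-reflexive (sym (trans (sym (+-identityʳ _)) eq))) (sub-card A X s))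
  average-above {suc n} κ (true ∷ X) (false ∷ A) (suc e) s eq = begin
    ∑ (vecs xs (suc n)) _      ≡⟨ ∑-vecs xs n _ ⟩
    ∑ xs (G ∘ p)               ≡⟨ ∑-split xs p G ⟩
    a * G true + b * G false   ≡⟨ cong₂ (λ s t → a * s + b * t) (average-above (κ ∘ suc) X A e s eq′) (average-above κ X A e s eq′) ⟩
    a * (P * (Q * binomial-sum e (λ w → κ (suc (card A + w))))) + b * (P * (Q * R))
      ≡⟨ cong (λ t → a * (P * (Q * t)) + b * (P * (Q * R))) (binomial-sum-cong e λ w → cong κ (sym (+-suc (card A) w))) ⟩
    a * (P * (Q * R′)) + b * (P * (Q * R)) ≡⟨ lem a b P Q R R′ ⟩
    P * (Q * (a * R′ + b * R)) ∎
    where open ≡-Reasoning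
          eq′ = suc-injective (trans (sym (+-suc (card A) e)) eq)
          G : Bool → ℕ
          G y = ∑ (vecs xs n) (λ v → 𝟙 (sub A (mapᵛ p v)) * κ (𝟙 y + card (X ∩ mapᵛ p v)))
          P = (a + b) ^ card (∁ X)
          Q = a ^ card A
          R R′ : ℕ
          R = binomial-sum e (λ w → κ (card A + w))
          R′ = binomial-sum e (λ w → κ (card A + suc w))
          lem : ∀ a b P Q R R′ → a * (P * (Q * R′)) + b * (P * (Q * R)) ≡ P * (Q * (a * R′ + b * R))
          lem = solve-∀

∧-trueˡ : ∀ {a b} → a ∧ b ≡ true → a ≡ true
∧-trueˡ {true} e = refl

∧-trueʳ : ∀ {a b} → a ∧ b ≡ true → b ≡ true
∧-trueʳ {true} e = e

#-mono : {A : Set} (xs : List A) {b c : A → Bool} → (∀ x → b x ≡ true → c x ≡ true) → # xs b ≤ # xs c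
#-mono xs {b} {c} h = ∑-mono xs λ x → lem (b x) (c x) (h x)
  where lem : ∀ b c → (b ≡ true → c ≡ true) → 𝟙 b ≤ 𝟙 c
        lem true  c h rewrite h refl = ≤-refl
        lem false c h = z≤n

≡ᵇ-of : ∀ {i j} → i ≡ j → (i ≡ᵇ j) ≡ true
≡ᵇ-of {i} refl = ≡ᵇ-refl i

module Density {n k : ℕ} (S : Scale n k) where
  open Scale S public

  -- `D` times the proportion of members among the k-subsets of `X`, and 0 if `X` has fewer than `k`
  -- elements.
  density : (Vec Bool n → Bool) → Vec Bool n → ℕ
  density m X = weight (card X) * m ⟨ X ⟩

  Uniform : (Vec Bool n → Bool) → Set
  Uniform m = ∀ A → m A ≡ true → card A ≡ k

  ⟨⟩≤choose : ∀ {m} → Uniform m → ∀ X → m ⟨ X ⟩ ≤ choose (card X) k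
  ⟨⟩≤choose {m} u X = subst (m ⟨ X ⟩ ≤_) (kset⟨⟩ k X) (#-mono (subsets n) λ A e →
    cong₂ _∧_ (≡ᵇ-of (u A (∧-trueˡ e))) (∧-trueʳ {m A} e))

  weight-choose : ∀ w → w ≤ n → weight w * choose w k ≡ 𝟙 (k ≤ᵇ w) * D
  weight-choose w l with k ≤ᵇ w in e
  ... | true  = trans (exact w l (≤ᵇ⇒≤ k w (subst IsTrue (sym e) _))) (sym (+-identityʳ D))
  ... | false = cong (_* choose w k) (null w (≰⇒> λ le → subst IsTrue e (≤⇒≤ᵇ le)))

  density≤D : ∀ {m} → Uniform m → ∀ X → density m X ≤ D
  density≤D {m} u X = ≤-trans (*-monoʳ-≤ (weight (card X)) (⟨⟩≤choose u X))
    (≤-trans (≤-reflexive (weight-choose (card X) (card≤ X))) (≤-trans (*-monoˡ-≤ D (𝟙≤1 (k ≤ᵇ card X))) (≤-reflexive (+-identityʳ D))))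

  density-pos : ∀ m X → 0 < density m X → k ≤ card X
  density-pos m X p with k ≤? card X
  ... | yes l = l
  ... | no ¬l = ⊥-elim (<⇒≢ p (sym (cong (_* m ⟨ X ⟩) (null (card X) (≰⇒> ¬l)))))

  density*choose : ∀ m X → k ≤ card X → density m X * choose (card X) k ≡ D * m ⟨ X ⟩
  density*choose m X l = trans (lem (weight (card X)) (m ⟨ X ⟩) _) (cong (_* m ⟨ X ⟩) (exact (card X) (card≤ X) l))
    where lem : ∀ x y z → x * y * z ≡ x * z * y
          lem = solve-∀

  module _ {A : Set} (xs : List A) (p : A → Bool) (X : Vec Bool n) where

    private
      a = # xs p
      b = # xs (not ∘ p)
      s = (a + b) ^ card (∁ X) * (a ^ k * binomial-sum xs p (card X ∸ k) (λ w → weight (k + w)))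

    -- Double counting of pairs of a word `v` and a member inside `X ∩ mapᵛ p v`: all members have
    -- size `k`, so by `average-above` each inside `X` contributes the same amount `s`.
    ∑-density : ∀ {m} → Uniform m → ∑ (vecs xs n) (λ v → density m (X ∩ mapᵛ p v)) ≡ m ⟨ X ⟩ * s
    ∑-density {m} u = begin
      ∑ (vecs xs n) (λ v → κ v * ∑ (subsets n) (λ A → 𝟙 (m A ∧ sub A (X ∩ mapᵛ p v))))
        ≡⟨ ∑-cong (vecs xs n) (λ v → sym (∑-*ˡ (subsets n) (κ v) _)) ⟩
      ∑ (vecs xs n) (λ v → ∑ (subsets n) (λ A → κ v * 𝟙 (m A ∧ sub A (X ∩ mapᵛ p v))))
        ≡⟨ ∑-swap (vecs xs n) (subsets n) _ ⟩
      ∑ (subsets n) (λ A → ∑ (vecs xs n) (λ v → κ v * 𝟙 (m A ∧ sub A (X ∩ mapᵛ p v))))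
        ≡⟨ ∑-cong (subsets n) (λ A → trans (∑-cong (vecs xs n) (λ v → split A v)) (∑-*ˡ (vecs xs n) (𝟙 (m A ∧ sub A X)) (λ v → 𝟙 (sub A (mapᵛ p v)) * κ v))) ⟩
      ∑ (subsets n) (λ A → 𝟙 (m A ∧ sub A X) * ∑ (vecs xs n) (λ v → 𝟙 (sub A (mapᵛ p v)) * κ v))
        ≡⟨ ∑-cong (subsets n) term ⟩
      ∑ (subsets n) (λ A → 𝟙 (m A ∧ sub A X) * s)
        ≡⟨ ∑-*ʳ (subsets n) s _ ⟩
      m ⟨ X ⟩ * s ∎
      where
        open ≡-Reasoning
        κ : Vec _ n → ℕ
        κ v = weight (card (X ∩ mapᵛ p v))
        split : ∀ A v → κ v * 𝟙 (m A ∧ sub A (X ∩ mapᵛ p v)) ≡ 𝟙 (m A ∧ sub A X) * (𝟙 (sub A (mapᵛ p v)) * κ v)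
        split A v rewrite sub-∩ A X (mapᵛ p v) | 𝟙-∧ (m A) (sub A X ∧ sub A (mapᵛ p v)) | 𝟙-∧ (sub A X) (sub A (mapᵛ p v)) | 𝟙-∧ (m A) (sub A X) =
          lem (κ v) (𝟙 (m A)) (𝟙 (sub A X)) (𝟙 (sub A (mapᵛ p v)))
          where lem : ∀ κ x y z → κ * (x * (y * z)) ≡ x * y * (z * κ)
                lem = solve-∀
        term : ∀ A → 𝟙 (m A ∧ sub A X) * ∑ (vecs xs n) (λ v → 𝟙 (sub A (mapᵛ p v)) * κ v) ≡ 𝟙 (m A ∧ sub A X) * s
        term A with m A in eₘ | sub A X in eₛ
        ... | false | _     = refl
        ... | true  | false = refl
        ... | true  | true  = cong (1 *_) (trans (average-above xs p weight X A (card X ∸ card A) eₛ (m+[n∸m]≡n (sub-card A X eₛ))) same)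
          where same : (a + b) ^ card (∁ X) * (a ^ card A * binomial-sum xs p (card X ∸ card A) (λ w → weight (card A + w))) ≡ s
                same rewrite u A eₘ = refl

    -- Averaging over random subsets of X preserves the density of m in X, up to the event of having too small a subset.
    average-density : ∀ {m} → Uniform m → choose (card X) k * ∑ (vecs xs n) (λ v → density m (X ∩ mapᵛ p v))
      ≡ m ⟨ X ⟩ * (D * # (vecs xs n) (λ v → k ≤ᵇ card (X ∩ mapᵛ p v)))
    average-density {m} u = begin
      choose (card X) k * ∑ (vecs xs n) (λ v → density m (X ∩ mapᵛ p v)) ≡⟨ cong (choose (card X) k *_) (∑-density u) ⟩
      choose (card X) k * (m ⟨ X ⟩ * s) ≡⟨ lem (choose (card X) k) (m ⟨ X ⟩) s ⟩
      m ⟨ X ⟩ * (choose (card X) k * s) ≡⟨ cong (λ t → m ⟨ X ⟩ * (t * s)) (sym (kset⟨⟩ k X)) ⟩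
      -- Since `s` is the same for every uniform family, it can be evaluated on the family of all
      -- k-sets.
      m ⟨ X ⟩ * (kset k ⟨ X ⟩ * s)       ≡⟨ cong (m ⟨ X ⟩ *_) (sym (∑-density {kset k} (λ A → ≡ᵇ-true))) ⟩
      m ⟨ X ⟩ * ∑ (vecs xs n) (λ v → density (kset k) (X ∩ mapᵛ p v))
        ≡⟨ cong (m ⟨ X ⟩ *_) (∑-cong (vecs xs n) λ v → let Y = X ∩ mapᵛ p v in
             trans (cong (weight (card Y) *_) (kset⟨⟩ k Y)) (trans (weight-choose (card Y) (card≤ Y)) (*-comm _ D))) ⟩
      m ⟨ X ⟩ * ∑ (vecs xs n) (λ v → D * 𝟙 (k ≤ᵇ card (X ∩ mapᵛ p v)))
        ≡⟨ cong (m ⟨ X ⟩ *_) (∑-*ˡ (vecs xs n) D _) ⟩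
      m ⟨ X ⟩ * (D * # (vecs xs n) (λ v → k ≤ᵇ card (X ∩ mapᵛ p v))) ∎
      where open ≡-Reasoning
            lem : ∀ x y z → x * (y * z) ≡ y * (x * z)
            lem = solve-∀

  -- The members make up at least the proportion 1 / `K` of the k-subsets of `X`. Heavy classes are
  -- those whose complements are not light.
  light : ℕ → (Vec Bool n → Bool) → Vec Bool n → Bool
  light K m X = D ≤ᵇ K * density m X

  light-true : ∀ K m X → light K m X ≡ true → D ≤ K * density m X
  light-true K m X e = ≤ᵇ⇒≤ D _ (subst IsTrue (sym e) _)

  light-false : ∀ K m X → light K m X ≡ false → K * density m X < D
  light-false K m X e = ≰⇒> λ le → subst IsTrue e (≤⇒≤ᵇ le)

  light-card : ∀ K m X → light K m X ≡ true → k ≤ card X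
  light-card K m X e with density m X in q
  ... | zero  = ⊥-elim (<⇒≱ D>0 (subst (D ≤_) (*-zeroʳ K) (subst (λ t → D ≤ K * t) q (light-true K m X (trans (cong (λ t → D ≤ᵇ K * t) q) e)))))
  ... | suc y = density-pos m X (subst (0 <_) (sym q) z<s)

  light-count : ∀ K m X → light K m X ≡ true → choose (card X) k ≤ K * m ⟨ X ⟩
  light-count K m X e = *-cancelˡ-≤ D {{>-nonZero D>0}} (begin
    D * choose (card X) k                 ≤⟨ *-monoˡ-≤ _ (light-true K m X e) ⟩
    K * density m X * choose (card X) k   ≡⟨ *-assoc K (density m X) _ ⟩
    K * (density m X * choose (card X) k) ≡⟨ cong (K *_) (density*choose m X (light-card K m X e)) ⟩
    K * (D * m ⟨ X ⟩)                     ≡⟨ lem K D (m ⟨ X ⟩) ⟩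
    D * (K * m ⟨ X ⟩) ∎)
    where open ≤-Reasoning
          lem : ∀ x y z → x * (y * z) ≡ y * (x * z)
          lem = solve-∀

  -- By `average-density` a random subset of `X` has on average at most the density of `X`; the loss
  -- comes from the subsets with fewer than `k` elements, which have density 0.
  heavy-average : ∀ {A : Set} (xs : List A) (p : A → Bool) K {m} → Uniform m → ∀ X → light K m X ≡ false →
    K * ∑ (vecs xs n) (λ v → density m (X ∩ mapᵛ p v)) ≤ D * length (vecs xs n)
  heavy-average xs p K {m} u X e with k ≤? card X
  ... | no ¬l = ≤-trans (≤-reflexive (trans (cong (K *_) zero-sum) (*-zeroʳ K))) z≤n
    where
      zero-count : m ⟨ X ⟩ ≡ 0
      zero-count = n≤0⇒n≡0 (subst (m ⟨ X ⟩ ≤_) (choose-zero (card X) k (≰⇒> ¬l)) (⟨⟩≤choose u X))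
      zero-sum : ∑ (vecs xs n) (λ v → density m (X ∩ mapᵛ p v)) ≡ 0
      zero-sum = trans (∑-density xs p X u) (cong (_* _) zero-count)
  ... | yes l = *-cancelˡ-≤ c {{>-nonZero (choose-pos (card X) k l)}} (begin
    c * (K * Σd)          ≡⟨ lem c K Σd ⟩
    K * (c * Σd)          ≡⟨ cong (K *_) (average-density xs p X u) ⟩
    K * (m ⟨ X ⟩ * (D * G)) ≡⟨ sym (*-assoc K (m ⟨ X ⟩) _) ⟩
    K * m ⟨ X ⟩ * (D * G) ≤⟨ *-mono-≤ few-sets (*-monoʳ-≤ D (#≤length {xs = vecs xs n} (λ v → k ≤ᵇ card (X ∩ mapᵛ p v)))) ⟩
    c * (D * length (vecs xs n)) ∎)
    where
      open ≤-Reasoning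
      c = choose (card X) k
      Σd = ∑ (vecs xs n) (λ v → density m (X ∩ mapᵛ p v))
      G = # (vecs xs n) (λ v → k ≤ᵇ card (X ∩ mapᵛ p v))
      lem : ∀ x y z → x * (y * z) ≡ y * (x * z)
      lem = solve-∀
      few-sets : K * m ⟨ X ⟩ ≤ c
      few-sets = *-cancelˡ-≤ D {{>-nonZero D>0}} (begin
        D * (K * m ⟨ X ⟩)     ≡⟨ lem D K (m ⟨ X ⟩) ⟩
        K * (D * m ⟨ X ⟩)     ≡⟨ cong (K *_) (sym (density*choose m X l)) ⟩
        K * (density m X * c) ≡⟨ sym (*-assoc K (density m X) c) ⟩
        K * density m X * c   ≤⟨ *-monoˡ-≤ c (<⇒≤ (light-false K m X e)) ⟩
        D * c ∎)

-- Chebyshev's inequality, scaled by N; the variance a (N - a) of N times the indicator of p is bounded by a N.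
module _ {A : Set} (xs : List A) (p : A → Bool) where

  private
    a = # xs p
    N = length xs
    w : ∀ {n} → Vec A n → ℕ
    w v = card (mapᵛ p v)

  first-moment : ∀ n → N * ∑ (vecs xs n) w ≡ n * a * N ^ n
  first-moment zero = *-zeroʳ N
  first-moment (suc n) = begin
    N * ∑ (vecs xs (suc n)) w          ≡⟨ cong (N *_) (trans (∑-vecs xs n w) (∑-cong xs λ x →
                                            trans (∑-+ (vecs xs n) _ _) (cong (_+ W) (trans (∑-const (vecs xs n) _) (cong (_* 𝟙 (p x)) (length-vecs xs n)))))) ⟩
    N * ∑ xs (λ x → N ^ n * 𝟙 (p x) + W) ≡⟨ cong (N *_) (trans (∑-+ xs _ _) (cong₂ _+_ (∑-*ˡ xs (N ^ n) _) (∑-const xs W))) ⟩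
    N * (N ^ n * a + N * W)            ≡⟨ cong (λ t → N * (N ^ n * a + t)) (first-moment n) ⟩
    N * (N ^ n * a + n * a * N ^ n)    ≡⟨ lem N (N ^ n) a n ⟩
    suc n * a * N ^ suc n ∎
    where open ≡-Reasoning
          W = ∑ (vecs xs n) w
          lem : ∀ N P a n → N * (P * a + n * a * P) ≡ suc n * a * (N * P)
          lem = solve-∀

  second-moment : ∀ n → N * (N * ∑ (vecs xs n) (λ v → w v * w v)) ≤ (n * (a * N) + n * a * (n * a)) * N ^ n
  second-moment zero = ≤-reflexive (trans (cong (N *_) (*-zeroʳ N)) (*-zeroʳ N))
  second-moment (suc n) = begin
    N * (N * ∑ (vecs xs (suc n)) (λ v → w v * w v))
      ≡⟨ cong (λ t → N * (N * t)) (trans (∑-vecs xs n _) (∑-cong xs λ x → trans (∑-cong (vecs xs n) (λ v → sq (p x) (w v)))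
           (trans (∑-+ (vecs xs n) _ _) (cong (_+ V) (trans (∑-*ˡ (vecs xs n) (𝟙 (p x)) _) (cong (𝟙 (p x) *_)
             (trans (∑-+ (vecs xs n) _ _) (cong₂ _+_ (trans (∑-one (vecs xs n)) (length-vecs xs n)) (∑-*ˡ (vecs xs n) 2 w))))))))) ⟩
    N * (N * ∑ xs (λ x → 𝟙 (p x) * (N ^ n + 2 * W) + V))
      ≡⟨ cong (λ t → N * (N * t)) (trans (∑-+ xs _ _) (cong₂ _+_ (∑-*ʳ xs _ _) (∑-const xs V))) ⟩
    N * (N * (a * (N ^ n + 2 * W) + N * V))
      ≡⟨ lem N (N ^ n) a W V ⟩
    N * (a * N * N ^ n + 2 * a * (N * W) + N * (N * V))
      ≤⟨ *-monoʳ-≤ N (+-mono-≤ (≤-reflexive (cong (λ t → a * N * N ^ n + 2 * a * t) (first-moment n))) (second-moment n)) ⟩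
    N * (a * N * N ^ n + 2 * a * (n * a * N ^ n) + (n * (a * N) + n * a * (n * a)) * N ^ n)
      ≤⟨ *-monoʳ-≤ N (m≤m+n _ (a * a * N ^ n)) ⟩
    N * (a * N * N ^ n + 2 * a * (n * a * N ^ n) + (n * (a * N) + n * a * (n * a)) * N ^ n + a * a * N ^ n)
      ≡⟨ lem′ N (N ^ n) a n ⟩
    (suc n * (a * N) + suc n * a * (suc n * a)) * N ^ suc n ∎
    where
      open ≤-Reasoning
      W = ∑ (vecs xs n) w
      V = ∑ (vecs xs n) (λ v → w v * w v)
      sq : ∀ b y → (𝟙 b + y) * (𝟙 b + y) ≡ 𝟙 b * (1 + 2 * y) + y * y
      sq true y = l y
        where l : ∀ y → (1 + y) * (1 + y) ≡ 1 * (1 + 2 * y) + y * y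
              l = solve-∀
      sq false y = refl
      lem : ∀ N P a W V → N * (N * (a * (P + 2 * W) + N * V)) ≡ N * (a * N * P + 2 * a * (N * W) + N * (N * V))
      lem = solve-∀
      lem′ : ∀ N P a n → N * (a * N * P + 2 * a * (n * a * P) + (n * (a * N) + n * a * (n * a)) * P + a * a * P)
        ≡ (suc n * (a * N) + suc n * a * (suc n * a)) * (N * P)
      lem′ = solve-∀

  chebyshev : ∀ n e (b : Vec A n → Bool) → (∀ v → b v ≡ true → N * w v + e ≤ n * a) →
    e * e * # (vecs xs n) b ≤ n * (a * N) * N ^ n
  chebyshev n e b h = +-cancelʳ-≤ (2 * (n * a) * (n * a) * N ^ n) _ _ (begin
    e * e * # (vecs xs n) b + 2 * (n * a) * (n * a) * N ^ n
      ≡⟨ cong₂ _+_ (sym (∑-*ˡ (vecs xs n) (e * e) _)) (sym mean) ⟩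
    ∑ (vecs xs n) (λ v → e * e * 𝟙 (b v)) + ∑ (vecs xs n) (λ v → 2 * (n * a) * N * w v)
      ≡⟨ sym (∑-+ (vecs xs n) _ _) ⟩
    ∑ (vecs xs n) (λ v → e * e * 𝟙 (b v) + 2 * (n * a) * N * w v)
      ≤⟨ ∑-mono (vecs xs n) (λ v → point (b v) (w v) (h v)) ⟩
    ∑ (vecs xs n) (λ v → N * N * (w v * w v) + n * a * (n * a))
      ≡⟨ trans (∑-+ (vecs xs n) _ _) (cong₂ _+_ (∑-*ˡ (vecs xs n) (N * N) _)
           (trans (∑-const (vecs xs n) _) (cong (_* (n * a * (n * a))) (length-vecs xs n)))) ⟩
    N * N * ∑ (vecs xs n) (λ v → w v * w v) + N ^ n * (n * a * (n * a))
      ≤⟨ +-monoˡ-≤ (N ^ n * (n * a * (n * a))) (≤-trans (≤-reflexive (*-assoc N N _)) (second-moment n)) ⟩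
    (n * (a * N) + n * a * (n * a)) * N ^ n + N ^ n * (n * a * (n * a))
      ≡⟨ lem (n * (a * N)) (n * a) (N ^ n) ⟩
    n * (a * N) * N ^ n + 2 * (n * a) * (n * a) * N ^ n ∎)
    where
      open ≤-Reasoning
      mean : ∑ (vecs xs n) (λ v → 2 * (n * a) * N * w v) ≡ 2 * (n * a) * (n * a) * N ^ n
      mean = trans (∑-*ˡ (vecs xs n) (2 * (n * a) * N) w) (trans (*-assoc (2 * (n * a)) N _)
        (trans (cong (2 * (n * a) *_) (first-moment n)) (sym (*-assoc (2 * (n * a)) (n * a) _))))
      lem : ∀ x y P → (x + y * y) * P + P * (y * y) ≡ x * P + 2 * y * y * P
      lem = solve-∀
      amgm : ∀ x y → x ≤ y → 2 * y * x + (y ∸ x) * (y ∸ x) ≡ x * x + y * y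
      amgm x y l = subst (λ t → 2 * t * x + (y ∸ x) * (y ∸ x) ≡ x * x + t * t) (m+[n∸m]≡n l) (id′ x (y ∸ x))
        where id′ : ∀ x d → 2 * (x + d) * x + d * d ≡ x * x + (x + d) * (x + d)
              id′ = solve-∀
      amgm≤ : ∀ x y → 2 * y * x ≤ x * x + y * y
      amgm≤ x y with ≤-total x y
      ... | inj₁ l = subst (2 * y * x ≤_) (amgm x y l) (m≤m+n _ _)
      ... | inj₂ l = subst₂ _≤_ (l₁ x y) (+-comm (y * y) (x * x)) (subst (2 * x * y ≤_) (amgm y x l) (m≤m+n _ _))
        where l₁ : ∀ x y → 2 * x * y ≡ 2 * y * x
              l₁ = solve-∀
      assoc₁ : ∀ y N w → 2 * y * N * w ≡ 2 * y * (N * w)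
      assoc₁ y N w = *-assoc (2 * y) N w
      assoc₂ : ∀ N w → N * w * (N * w) ≡ N * N * (w * w)
      assoc₂ = solve-∀
      -- The pointwise bound of e² times the indicator of the event by (N w - n a)², expanded so
      -- that no subtraction occurs.
      point : ∀ c w → (c ≡ true → N * w + e ≤ n * a) → e * e * 𝟙 c + 2 * (n * a) * N * w ≤ N * N * (w * w) + n * a * (n * a)
      point false w h = subst₂ _≤_ (sym (trans (cong (_+ 2 * (n * a) * N * w) (*-zeroʳ (e * e))) (assoc₁ (n * a) N w)))
        (cong (_+ n * a * (n * a)) (assoc₂ N w)) (amgm≤ (N * w) (n * a))
      point true w h = begin
        e * e * 1 + 2 * (n * a) * N * w ≡⟨ cong₂ _+_ (*-identityʳ _) (assoc₁ (n * a) N w) ⟩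
        e * e + 2 * (n * a) * (N * w)   ≤⟨ +-monoˡ-≤ _ (*-mono-≤ e≤ e≤) ⟩
        d * d + 2 * (n * a) * (N * w)   ≡⟨ trans (+-comm (d * d) _) (amgm (N * w) (n * a) (≤-trans (m≤m+n _ e) (h refl))) ⟩
        N * w * (N * w) + n * a * (n * a) ≡⟨ cong (_+ n * a * (n * a)) (assoc₂ N w) ⟩
        N * N * (w * w) + n * a * (n * a) ∎
        where d = n * a ∸ N * w
              e≤ : e ≤ d
              e≤ = m+n≤o⇒m≤o∸n e (subst (_≤ n * a) (+-comm (N * w) e) (h refl))

-- Simplices from families of positive density

-- U x e k is the sum of 2 ^ |T ∖ A| over the k-subsets A of a set consisting of T, |T| = e, and x further elements.
U : ℕ → ℕ → ℕ → ℕ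
U x zero    k = choose x k
U x (suc e) k = U x e k + U (suc x) e k

U-zero : ∀ x e → U (suc x) e 0 ≡ U x e 0
U-zero x zero    = refl
U-zero x (suc e) = cong₂ _+_ (U-zero x e) (U-zero (suc x) e)

U-pascal : ∀ x e k → U (suc x) e (suc k) ≡ U x e k + U x e (suc k)
U-pascal x zero    k = refl
U-pascal x (suc e) k = trans (cong₂ _+_ (U-pascal x e k) (U-pascal (suc x) e k)) (lem (U x e k) (U x e (suc k)) (U (suc x) e k) (U (suc x) e (suc k)))
  where lem : ∀ a b c f → a + b + (c + f) ≡ a + c + (b + f)
        lem = solve-∀

missing : ∀ {n} → Vec Bool n → Vec Bool n → Vec Bool n → ℕ → ℕ
missing T A X k = 𝟙 (kset k A ∧ sub A X) * 2 ^ card (T ∩ ∁ A)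

∑-missing : ∀ {n} (X T : Vec Bool n) k → sub T X ≡ true →
  ∑ (subsets n) (λ A → missing T A X k) ≡ U (card (X ∩ ∁ T)) (card T) k
∑-missing [] [] zero    s = refl
∑-missing [] [] (suc k) s = refl
∑-missing {suc n} (false ∷ X) (false ∷ T) k s = trans (∑-subsets n (λ A → missing (false ∷ T) A (false ∷ X) k))
  (trans (cong₂ _+_ (∑-missing X T k s) (trans (∑-cong (subsets n) λ A → cong (λ b → 𝟙 b * 2 ^ card (T ∩ ∁ A)) (∧-false (suc (card A) ≡ᵇ k))) (∑-zero (subsets n)))) (+-identityʳ _))
∑-missing {suc n} (true ∷ X) (false ∷ T) zero s = trans (∑-subsets n (λ A → missing (false ∷ T) A (true ∷ X) 0))
  (trans (cong₂ _+_ (∑-missing X T 0 s) (∑-zero (subsets n))) (trans (+-identityʳ _) (sym (U-zero (card (X ∩ ∁ T)) (card T)))))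
∑-missing {suc n} (true ∷ X) (false ∷ T) (suc k) s = trans (∑-subsets n (λ A → missing (false ∷ T) A (true ∷ X) (suc k)))
  (trans (cong₂ _+_ (∑-missing X T (suc k) s) (∑-missing X T k s))
    (trans (+-comm (U (card (X ∩ ∁ T)) (card T) (suc k)) _) (sym (U-pascal (card (X ∩ ∁ T)) (card T) k))))
∑-missing {suc n} (true ∷ X) (true ∷ T) zero s = trans (∑-subsets n (λ A → missing (true ∷ T) A (true ∷ X) 0))
  (trans (cong₂ _+_ (trans (∑-cong (subsets n) (λ A → l (𝟙 (kset 0 A ∧ sub A X)) (2 ^ card (T ∩ ∁ A)))) (trans (∑-*ˡ (subsets n) 2 (λ A → missing T A X 0)) (cong (2 *_) (∑-missing X T 0 s)))) (∑-zero (subsets n)))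
    (trans (l′ (U (card (X ∩ ∁ T)) (card T) 0)) (cong (U (card (X ∩ ∁ T)) (card T) 0 +_) (sym (U-zero (card (X ∩ ∁ T)) (card T))))))
  where l : ∀ a b → a * (2 * b) ≡ 2 * (a * b)
        l = solve-∀
        l′ : ∀ a → 2 * a + 0 ≡ a + a
        l′ = solve-∀
∑-missing {suc n} (true ∷ X) (true ∷ T) (suc k) s = trans (∑-subsets n (λ A → missing (true ∷ T) A (true ∷ X) (suc k)))
  (trans (cong₂ _+_ (trans (∑-cong (subsets n) (λ A → l (𝟙 (kset (suc k) A ∧ sub A X)) (2 ^ card (T ∩ ∁ A)))) (trans (∑-*ˡ (subsets n) 2 (λ A → missing T A X (suc k))) (cong (2 *_) (∑-missing X T (suc k) s)))) (∑-missing X T k s))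
    (trans (l′ (U x e (suc k)) (U x e k)) (cong (U x e (suc k) +_) (sym (U-pascal x e k)))))
  where x = card (X ∩ ∁ T)
        e = card T
        l : ∀ a b → a * (2 * b) ≡ 2 * (a * b)
        l = solve-∀
        l′ : ∀ a b → 2 * a + b ≡ a + (b + a)
        l′ = solve-∀

choose-step : ∀ M k → suc M * choose M k + k * choose (suc M) k ≡ suc M * choose (suc M) k
choose-step M zero    = +-identityʳ _
choose-step M (suc k) = trans (cong (suc M * choose M (suc k) +_) (absorb M k))
  (trans (sym (*-distribˡ-+ (suc M) (choose M (suc k)) (choose M k))) (cong (suc M *_) (+-comm (choose M (suc k)) _)))

-- C(M, k) / C(M + 1, k) = 1 - k / (M + 1), and the hypothesis bounds k / (M + 1) from below by 1 /
-- (y + 1).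
choose-ratio : ∀ y M k → suc M ≤ suc y * k → suc y * choose M k ≤ y * choose (suc M) k
choose-ratio y M k l = *-cancelˡ-≤ (suc M) (+-cancelʳ-≤ (suc M * choose (suc M) k) _ _ (begin
  suc M * (suc y * choose M k) + suc M * choose (suc M) k
    ≤⟨ +-monoʳ-≤ (suc M * (suc y * choose M k)) (*-monoˡ-≤ (choose (suc M) k) l) ⟩
  suc M * (suc y * choose M k) + suc y * k * choose (suc M) k
    ≡⟨ lem M y (choose M k) k (choose (suc M) k) ⟩
  suc y * (suc M * choose M k + k * choose (suc M) k)
    ≡⟨ cong (suc y *_) (choose-step M k) ⟩
  suc y * (suc M * choose (suc M) k)
    ≡⟨ lem′ M y (choose (suc M) k) ⟩
  suc M * (y * choose (suc M) k) + suc M * choose (suc M) k ∎))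
  where open ≤-Reasoning
        lem : ∀ M y a k b → suc M * (suc y * a) + suc y * k * b ≡ suc y * (suc M * a + k * b)
        lem = solve-∀
        lem′ : ∀ M y b → suc y * (suc M * b) ≡ suc M * (y * b) + suc M * b
        lem′ = solve-∀

-- Compared with an element outside `T`, an element of `T` costs at most the factor 1 + y / (y + 1).
-- That this is less than 2 is what `few-barely` exploits.
U-bound : ∀ y x e k → x + e ≤ suc y * k → suc y ^ e * U x e k ≤ suc (y + y) ^ e * choose (x + e) k
U-bound y x zero k l = ≤-reflexive (cong (λ t → 1 * choose t k) (sym (+-identityʳ x)))
U-bound y x (suc e) k l = begin
  suc y * P * (U x e k + U (suc x) e k)                    ≡⟨ lem (suc y) P (U x e k) (U (suc x) e k) ⟩
  suc y * (P * U x e k + P * U (suc x) e k)                ≤⟨ *-monoʳ-≤ (suc y) (+-mono-≤ (U-bound y x e k (≤-trans (n≤1+n _) l′)) (U-bound y (suc x) e k l′)) ⟩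
  suc y * (Q * choose (x + e) k + Q * choose (suc x + e) k) ≡⟨ lem′ (suc y) Q (choose (x + e) k) (choose (suc x + e) k) ⟩
  Q * (suc y * choose (x + e) k + suc y * choose (suc x + e) k)
    ≤⟨ *-monoʳ-≤ Q (+-monoˡ-≤ (suc y * choose (suc x + e) k) (choose-ratio y (x + e) k l′)) ⟩
  Q * (y * choose (suc x + e) k + suc y * choose (suc x + e) k) ≡⟨ lem″ y Q (choose (suc x + e) k) ⟩
  suc (y + y) * Q * choose (suc x + e) k                  ≡⟨ cong (λ t → suc (y + y) * Q * choose t k) (sym (+-suc x e)) ⟩
  suc (y + y) * Q * choose (x + suc e) k ∎
  where
    open ≤-Reasoning
    P = suc y ^ e
    Q = suc (y + y) ^ e
    l′ : suc x + e ≤ suc y * k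
    l′ = subst (_≤ suc y * k) (+-suc x e) l
    lem : ∀ s P a b → s * P * (a + b) ≡ s * (P * a + P * b)
    lem = solve-∀
    lem′ : ∀ s Q a b → s * (Q * a + Q * b) ≡ Q * (s * a + s * b)
    lem′ = solve-∀
    lem″ : ∀ y Q b → Q * (y * b + suc y * b) ≡ suc (y + y) * Q * b
    lem″ = solve-∀

^-distrib-* : ∀ n a b → (a * b) ^ n ≡ a ^ n * b ^ n
^-distrib-* zero    a b = refl
^-distrib-* (suc n) a b = trans (cong (a * b *_) (^-distrib-* n a b)) (l a b (a ^ n) (b ^ n))
  where l : ∀ a b p q → a * b * (p * q) ≡ a * p * (b * q)
        l = solve-∀

bernoulli : ∀ Y e → Y ^ e * (Y + e) ≤ Y * suc Y ^ e
bernoulli Y zero    = ≤-reflexive (l Y)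
  where l : ∀ Y → 1 * (Y + 0) ≡ Y * 1
        l = solve-∀
bernoulli Y (suc e) = begin
  Y * Y ^ e * (Y + suc e)                  ≤⟨ m≤m+n _ (e * Y ^ e) ⟩
  Y * Y ^ e * (Y + suc e) + e * Y ^ e      ≡⟨ l Y (Y ^ e) e ⟩
  suc Y * (Y ^ e * (Y + e))                ≤⟨ *-monoʳ-≤ (suc Y) (bernoulli Y e) ⟩
  suc Y * (Y * suc Y ^ e)                  ≡⟨ l′ Y (suc Y ^ e) ⟩
  Y * (suc Y * suc Y ^ e) ∎
  where open ≤-Reasoning
        l : ∀ Y P e → Y * P * (Y + suc e) + e * P ≡ suc Y * (P * (Y + e))
        l = solve-∀
        l′ : ∀ Y P → suc Y * (Y * P) ≡ Y * (suc Y * P)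
        l′ = solve-∀

-- Bernoulli's inequality for (1 + 1 / (Y + 1)) ^ e.
exponential : ∀ Y c e → c * suc Y ≤ e → c * suc Y ^ e ≤ suc (suc Y) ^ e
exponential Y c e l = *-cancelˡ-≤ (suc Y) (begin
  suc Y * (c * suc Y ^ e)       ≡⟨ l′ (suc Y) c (suc Y ^ e) ⟩
  suc Y ^ e * (c * suc Y)       ≤⟨ *-monoʳ-≤ (suc Y ^ e) (≤-trans l (m≤n+m e (suc Y))) ⟩
  suc Y ^ e * (suc Y + e)       ≤⟨ bernoulli (suc Y) e ⟩
  suc Y * suc (suc Y) ^ e ∎)
  where open ≤-Reasoning
        l′ : ∀ y c P → y * (c * P) ≡ P * (c * y)
        l′ = solve-∀

card-split : ∀ {n} (A T : Vec Bool n) → card (A ∩ T) + card (T ∩ ∁ A) ≡ card T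
card-split []          []          = refl
card-split (a ∷ A)     (false ∷ T) = trans (cong (λ b → 𝟙 b + card (A ∩ T) + card (T ∩ ∁ A)) (∧-false a)) (card-split A T)
card-split (true ∷ A)  (true ∷ T)  = cong suc (card-split A T)
card-split (false ∷ A) (true ∷ T)  = trans (+-suc _ _) (cong suc (card-split A T))

card-minus : ∀ {n} (T X : Vec Bool n) → sub T X ≡ true → card (X ∩ ∁ T) + card T ≡ card X
card-minus []          []          s = refl
card-minus (true ∷ T)  (true ∷ X)  s = trans (+-suc _ _) (cong suc (card-minus T X s))
card-minus (false ∷ T) (true ∷ X)  s = cong suc (card-minus T X s)
card-minus (false ∷ T) (false ∷ X) s = card-minus T X s

barely : ∀ {n} → ℕ → Vec Bool n → Vec Bool n → ℕ → Vec Bool n → Bool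
barely k X T t A = (kset k A ∧ sub A X) ∧ (card (A ∩ T) <ᵇ t)

-- Markov's inequality for the weight 2 ^ |T ∖ A|. With e = |T|, a k-set meeting `T` in fewer than
-- `t` elements has weight at least 2 ^ (e - t), whereas the average weight is at most ((2 y + 1) /
-- (y + 1)) ^ e. The quotient of the two bases is (2 y + 2) / (2 y + 1), whose e-th power exceeds K
-- 2 ^ t.
few-barely : ∀ {n} y k K t (X T : Vec Bool n) → card X ≤ suc y * k → sub T X ≡ true →
  K * 2 ^ t * suc (y + y) ≤ card T → K * # (subsets n) (barely k X T t) ≤ choose (card X) k
few-barely {n} y k K t X T lX s lT = *-cancelˡ-≤ (suc Y ^ e) {{m^n≢0 (suc Y) e}} (begin
    suc Y ^ e * (K * B)                          ≡⟨ cong (_* (K * B)) powers ⟩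
    suc y ^ e * 2 ^ e * (K * B)                  ≡⟨ l₁ (suc y ^ e) (2 ^ e) K B ⟩
    K * (suc y ^ e * (2 ^ e * B))                ≤⟨ *-monoʳ-≤ K (*-monoʳ-≤ (suc y ^ e) weighted) ⟩
    K * (suc y ^ e * (2 ^ t * U x e k))          ≡⟨ l₂ K (suc y ^ e) (2 ^ t) (U x e k) ⟩
    K * 2 ^ t * (suc y ^ e * U x e k)            ≤⟨ *-monoʳ-≤ (K * 2 ^ t) (U-bound y x e k (subst (_≤ suc y * k) (sym x+e) lX)) ⟩
    K * 2 ^ t * (Y ^ e * choose (x + e) k)       ≡⟨ sym (*-assoc (K * 2 ^ t) (Y ^ e) _) ⟩
    K * 2 ^ t * Y ^ e * choose (x + e) k         ≤⟨ *-monoˡ-≤ _ (exponential (y + y) (K * 2 ^ t) e lT) ⟩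
    suc Y ^ e * choose (x + e) k                 ≡⟨ cong (λ w → suc Y ^ e * choose w k) x+e ⟩
    suc Y ^ e * choose (card X) k ∎)
  where
    open ≤-Reasoning
    Y = suc (y + y)
    e = card T
    x = card (X ∩ ∁ T)
    B = # (subsets n) (barely k X T t)
    x+e : x + e ≡ card X
    x+e = card-minus T X s
    powers : suc Y ^ e ≡ suc y ^ e * 2 ^ e
    powers = trans (cong (_^ e) (l y)) (^-distrib-* e (suc y) 2)
      where l : ∀ y → suc (suc (y + y)) ≡ suc y * 2
            l = solve-∀
    l₁ : ∀ p q K B → p * q * (K * B) ≡ K * (p * (q * B))
    l₁ = solve-∀
    l₂ : ∀ K p q u → K * (p * (q * u)) ≡ K * q * (p * u)
    l₂ = solve-∀
    weighted : 2 ^ e * B ≤ 2 ^ t * U x e k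
    weighted = begin
      2 ^ e * B                                             ≡⟨ sym (∑-*ˡ (subsets n) (2 ^ e) _) ⟩
      ∑ (subsets n) (λ A → 2 ^ e * 𝟙 (barely k X T t A))    ≤⟨ ∑-mono (subsets n) point ⟩
      ∑ (subsets n) (λ A → 2 ^ t * missing T A X k)         ≡⟨ ∑-*ˡ (subsets n) (2 ^ t) _ ⟩
      2 ^ t * ∑ (subsets n) (λ A → missing T A X k)         ≡⟨ cong (2 ^ t *_) (∑-missing X T k s) ⟩
      2 ^ t * U x e k ∎
      where
        point : ∀ A → 2 ^ e * 𝟙 (barely k X T t A) ≤ 2 ^ t * missing T A X k
        point A with kset k A ∧ sub A X | card (A ∩ T) <ᵇ t in q
        ... | false | _     = ≤-reflexive (trans (*-zeroʳ (2 ^ e)) (sym (*-zeroʳ (2 ^ t))))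
        ... | true  | false = subst (_≤ 2 ^ t * (1 * 2 ^ card (T ∩ ∁ A))) (sym (*-zeroʳ (2 ^ e))) z≤n
        ... | true  | true  = begin
          2 ^ e * 1                            ≡⟨ *-identityʳ _ ⟩
          2 ^ e                                ≤⟨ ^-monoʳ-≤ 2 (subst (_≤ t + card (T ∩ ∁ A)) (card-split A T) (+-monoˡ-≤ _ (<⇒≤ (<ᵇ⇒< (card (A ∩ T)) t (subst IsTrue (sym q) _))))) ⟩
          2 ^ (t + card (T ∩ ∁ A))             ≡⟨ ^-distribˡ-+-* 2 t _ ⟩
          2 ^ t * 2 ^ card (T ∩ ∁ A)           ≡⟨ cong (2 ^ t *_) (sym (*-identityˡ _)) ⟩
          2 ^ t * (1 * 2 ^ card (T ∩ ∁ A)) ∎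

sub-lookup : ∀ {n} (A X : Vec Bool n) → sub A X ≡ true → ∀ x → lookup A x ≡ true → lookup X x ≡ true
sub-lookup (true ∷ A)  (true ∷ X) s fz     e = refl
sub-lookup (true ∷ A)  (true ∷ X) s (fs x) e = sub-lookup A X s x e
sub-lookup (false ∷ A) (_ ∷ X)    s (fs x) e = sub-lookup A X s x e

sub-intro : ∀ {n} (A X : Vec Bool n) → (∀ x → lookup A x ≡ true → lookup X x ≡ true) → sub A X ≡ true
sub-intro []          []          h = refl
sub-intro (true ∷ A)  (true ∷ X)  h = sub-intro A X (h ∘ fs)
sub-intro (true ∷ A)  (false ∷ X) h with h fz refl
... | ()
sub-intro (false ∷ A) (_ ∷ X)     h = sub-intro A X (h ∘ fs)

card-∃ : ∀ {n} (A : Vec Bool n) → 0 < card A → ∃ λ x → lookup A x ≡ true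
card-∃ (true ∷ A)  l = fz , refl
card-∃ (false ∷ A) l = fs (proj₁ (card-∃ A l)) , proj₂ (card-∃ A l)

sub-∩ʳ : ∀ {n} (A X : Vec Bool n) → sub (A ∩ X) X ≡ true
sub-∩ʳ A X = sub-intro (A ∩ X) X λ x e → ∧-trueʳ {lookup A x} (trans (sym (lookup-zipWith _∧_ x A X)) e)

sub-trans : ∀ {n} (A X Y : Vec Bool n) → sub A X ≡ true → sub X Y ≡ true → sub A Y ≡ true
sub-trans A X Y s t = sub-intro A Y λ x e → sub-lookup X Y t x (sub-lookup A X s x e)

cls-disjoint : ∀ {n} i j → i ≢ j → (c : Vec ℕ n) → sub (cls i c) (∁ (cls j c)) ≡ true
cls-disjoint i j ne c = sub-intro (cls i c) (∁ (cls j c)) λ x e →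
  trans (lookup-map x not (cls j c)) (cong not (trans (lookup-map x (_≡ᵇ j) c)
    (≡ᵇ-≢ {lookup c x} {j} λ e′ → ne (trans (sym (≡ᵇ-true (trans (sym (lookup-map x (_≡ᵇ i) c)) e))) e′))))

<ᵇ-false : ∀ {i j} → (i <ᵇ j) ≡ false → j ≤ i
<ᵇ-false {i} {j} e = ≮⇒≥ λ l → subst IsTrue e (<⇒<ᵇ l)

upd : {A : Set} → ℕ → A → (ℕ → A) → ℕ → A
upd j a f i = if i ≡ᵇ j then a else f i

upd-at : ∀ {A : Set} j (a : A) f → upd j a f j ≡ a
upd-at j a f rewrite ≡ᵇ-refl j = refl

upd-off : ∀ {A : Set} {i j} (a : A) f → i ≢ j → upd j a f i ≡ f i
upd-off a f ne rewrite ≡ᵇ-≢ ne = refl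

-- Distinctness follows from the two intersection conditions: the point common to all sets except
-- the i-th is missed by some set, necessarily the i-th, but it lies in the j-th.
simplex-of : ∀ {n} d (A : ℕ → Vec Bool n) →
  (∀ x → ∃ λ j → j < suc d × lookup (A j) x ≡ false) →
  (∀ j → j < suc d → ∃ λ x → ∀ j′ → j′ < suc d → j′ ≢ j → lookup (A j′) x ≡ true) →
  IsSimplex d (λ (j : Fin (suc d)) → A (toℕ j))
simplex-of d A none some = inj , empty , meet
  where
    meet : ∀ j → Σ _ λ x → ∀ j′ → j′ ≢ j → _
    meet j with some (toℕ j) (toℕ<n j)
    ... | x , h = x , λ j′ ne → lookup⇒[]= x (A (toℕ j′)) (h (toℕ j′) (toℕ<n j′) (ne ∘ toℕ-injective))
    missed : ∀ x → Σ (Fin (suc d)) λ j → lookup (A (toℕ j)) x ≡ false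
    missed x with none x
    ... | j , l , e = fromℕ< l , trans (cong (λ i → lookup (A i) x) (toℕ-fromℕ< l)) e
    empty : ¬ (Σ _ λ x → ∀ j → _)
    empty (x , h) = false≢true (proj₂ (missed x)) ([]=⇒lookup (h (proj₁ (missed x))))
    inj : ∀ {i j : Fin (suc d)} → A (toℕ i) ≡ A (toℕ j) → i ≡ j
    inj {i} {j} e with toℕ i ≟ toℕ j
    ... | yes q = toℕ-injective q
    ... | no ne with some (toℕ i) (toℕ<n i)
    ...   | x , h with missed x
    ...     | j′ , f with toℕ j′ ≟ toℕ i
    ...       | no q  = ⊥-elim (false≢true f (h (toℕ j′) (toℕ<n j′) q))
    ...       | yes q = ⊥-elim (false≢true (trans (cong (λ t → lookup t x) (trans (sym e) (cong A (sym q)))) f) (h (toℕ j) (toℕ<n j) (ne ∘ sym)))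

-- What each class must retain while `u` members remain to be chosen. One choice should leave
-- `class-size` at `u` elements, and `few-barely`, with room for `r` bad events, requires
-- exponentially many before it; at the end one element suffices.
class-size : ℕ → ℕ → ℕ → ℕ → ℕ
class-size r K y zero    = 1
class-size r K y (suc u) = K * suc r * 2 ^ class-size r K y u * suc (y + y)

x≤2^x : ∀ x → x ≤ 2 ^ x
x≤2^x zero    = z≤n
x≤2^x (suc x) = ≤-trans (s≤s (x≤2^x x)) (≤-trans (+-monoˡ-≤ (2 ^ x) (m^n>0 2 x)) (≤-reflexive (cong (2 ^ x +_) (sym (+-identityʳ _)))))

class-size-mono : ∀ r K y u → 1 ≤ K → class-size r K y u ≤ class-size r K y (suc u)
class-size-mono r (suc K) y u l = ≤-trans (x≤2^x s) (≤-trans (m≤n*m (2 ^ s) (suc K * suc r)) (m≤m*n _ (suc (y + y))))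
  where s = class-size r (suc K) y u

module _ {n k : ℕ} (m : Vec Bool n → Bool) (u : ∀ A → m A ≡ true → card A ≡ k)
  (r K y : ℕ) (1≤K : 1 ≤ K) (n≤yk : n ≤ suc y * k) (c : Vec ℕ n)
  (lights : ∀ j → j < r → choose (card (∁ (cls j c))) k ≤ K * m ⟨ ∁ (cls j c) ⟩)
  (big : ∀ j → j < r → k ≤ card (∁ (cls j c))) where

  private
    X : ℕ → Vec Bool n
    X j = ∁ (cls j c)
    s : ℕ → ℕ
    s = class-size r K y

  -- For each of at most `r` classes, the k-sets that meet `V i` too little form at most the
  -- proportion 1 / (K (r + 1)), in total less than the proportion 1 / `K` of members.
  pick : ∀ t j → j < r → (V : ℕ → Vec Bool n) → (∀ i → i < r → sub (V i) (cls i c) ≡ true) →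
    (∀ i → i < r → K * suc r * 2 ^ t * suc (y + y) ≤ card (V i)) →
    ∃ λ A → m A ≡ true × sub A (X j) ≡ true × (∀ i → i < r → i ≢ j → t ≤ card (A ∩ V i))
  pick t j lj V sV lV = conclude (∑-<⇒∃ (subsets n) few-bad)
    where
      b : ℕ → Vec Bool n → Bool
      b i A = not (i ≡ᵇ j) ∧ barely k (X j) (V i) t A
      C₀ = choose (card (X j)) k
      few-b : ∀ i → i < r → K * suc r * # (subsets n) (b i) ≤ C₀
      few-b i li with i ≟ j
      ... | yes refl rewrite ≡ᵇ-refl i = ≤-trans (≤-reflexive (trans (cong (K * suc r *_) (∑-zero (subsets n))) (*-zeroʳ (K * suc r)))) z≤n
      ... | no ne rewrite ≡ᵇ-≢ ne = few-barely y k (K * suc r) t (X j) (V i) (≤-trans (card≤ (X j)) n≤yk)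
              (sub-trans (V i) (cls i c) (X j) (sV i li) (cls-disjoint i j ne c)) (lV i li)
      total : K * suc r * ∑ (subsets n) (λ A → ∑< r (λ i → 𝟙 (b i A))) ≤ r * C₀
      total = begin
        K * suc r * ∑ (subsets n) (λ A → ∑< r (λ i → 𝟙 (b i A))) ≡⟨ cong (K * suc r *_) (∑-swap (subsets n) (upTo r) _) ⟩
        K * suc r * ∑< r (λ i → # (subsets n) (b i))             ≡⟨ sym (∑-*ˡ (upTo r) (K * suc r) _) ⟩
        ∑< r (λ i → K * suc r * # (subsets n) (b i))             ≤⟨ ∑<-mono r few-b ⟩
        ∑< r (λ i → C₀)                                          ≡⟨ ∑<-const r C₀ ⟩
        r * C₀ ∎
        where open ≤-Reasoning
      few-bad : ∑ (subsets n) (λ A → ∑< r (λ i → 𝟙 (b i A))) < # (subsets n) (λ A → m A ∧ sub A (X j))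
      few-bad = *-cancelˡ-< (K * suc r) _ _ (≤-<-trans total (<-≤-trans (+-monoˡ-< (r * C₀) (choose-pos (card (X j)) k (big j lj)))
        (≤-trans (*-monoʳ-≤ (suc r) (lights j lj)) (≤-reflexive (l K (suc r) (m ⟨ X j ⟩))))))
        where l : ∀ K r x → r * (K * x) ≡ K * r * x
              l = solve-∀
      conclude : ∃ (λ A → ∑< r (λ i → 𝟙 (b i A)) < 𝟙 (m A ∧ sub A (X j))) → _
      conclude (A , lt) = A , ∧-trueˡ mA , ∧-trueʳ {m A} mA , far
        where
          one : ∀ x e → x < 𝟙 e → e ≡ true × x ≡ 0
          one x true lt = refl , n<1⇒n≡0 lt
          mA : m A ∧ sub A (X j) ≡ true
          mA = proj₁ (one _ _ lt)
          zero-b : ∀ i → i < r → b i A ≡ false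
          zero-b i li = z (b i A) (≤-trans (∑<-term r (λ i → 𝟙 (b i A)) i li) (≤-reflexive (proj₂ (one _ _ lt))))
            where z : ∀ e → 𝟙 e ≤ 0 → e ≡ false
                  z false _ = refl
          far : ∀ i → i < r → i ≢ j → t ≤ card (A ∩ V i)
          far i li ne = <ᵇ-false (trans (sym unfold) (zero-b i li))
            where unfold : b i A ≡ (card (A ∩ V i) <ᵇ t)
                  unfold rewrite ≡ᵇ-≢ ne | u A (∧-trueˡ mA) | ≡ᵇ-refl k | ∧-trueʳ {m A} mA = refl

  Choice : ℕ → (ℕ → Vec Bool n) → Set
  Choice j V = ∃ λ (A : ℕ → Vec Bool n) →
    (∀ i → j ≤ i → i < r → m (A i) ≡ true × sub (A i) (X i) ≡ true) ×
    (∀ i → i < r → ∃ λ x → lookup (V i) x ≡ true × (∀ i′ → j ≤ i′ → i′ < r → i′ ≢ i → lookup (A i′) x ≡ true))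

  -- `V i` consists of points of class `i` that lie in every set chosen so far, the i-th excepted.
  -- The j-th choice therefore shrinks all `V i` but `V j`, and a final element of `V i` is the
  -- point common to all sets except the i-th.
  choose-all : ∀ t j → j + t ≡ r → (V : ℕ → Vec Bool n) → (∀ i → i < r → sub (V i) (cls i c) ≡ true) →
    (∀ i → i < r → s t ≤ card (V i)) → Choice j V
  choose-all zero j e V sV lV = (λ _ → cls 0 c) , (λ i l l′ → ⊥-elim (<⇒≱ l′ (subst (_≤ i) (trans (sym (+-identityʳ j)) e) l))) ,
    λ i li → proj₁ (card-∃ (V i) (lV i li)) , proj₂ (card-∃ (V i) (lV i li)) ,
      λ i′ l l′ → ⊥-elim (<⇒≱ l′ (subst (_≤ i′) (trans (sym (+-identityʳ j)) e) l))
  choose-all (suc t) j e V sV lV = extend (pick (s t) j lj V sV lV)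
    where
      e′ = trans (sym (+-suc j t)) e
      lj : j < r
      lj = subst (suc j ≤_) e′ (m≤m+n (suc j) t)
      extend : ∃ (λ A → m A ≡ true × sub A (X j) ≡ true × (∀ i → i < r → i ≢ j → s t ≤ card (A ∩ V i))) → Choice j V
      extend (A , mA , sA , lA) = finish (choose-all t (suc j) e′ V′ sV′ lV′)
        where
          V′ : ℕ → Vec Bool n
          V′ = upd j (V j) (λ i → A ∩ V i)
          V′-at : V′ j ≡ V j
          V′-at = upd-at j (V j) (λ i → A ∩ V i)
          V′-off : ∀ i → i ≢ j → V′ i ≡ A ∩ V i
          V′-off i = upd-off (V j) (λ i → A ∩ V i)
          sV′ : ∀ i → i < r → sub (V′ i) (cls i c) ≡ true
          sV′ i li = go (i ≟ j)
            where go : Dec (i ≡ j) → sub (V′ i) (cls i c) ≡ true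
                  go (yes refl) = subst (λ W → sub W (cls i c) ≡ true) (sym V′-at) (sV i li)
                  go (no ne)    = subst (λ W → sub W (cls i c) ≡ true) (sym (V′-off i ne))
                                    (sub-trans (A ∩ V i) (V i) (cls i c) (sub-∩ʳ A (V i)) (sV i li))
          lV′ : ∀ i → i < r → s t ≤ card (V′ i)
          lV′ i li = go (i ≟ j)
            where go : Dec (i ≡ j) → s t ≤ card (V′ i)
                  go (yes refl) = subst (λ W → s t ≤ card W) (sym V′-at) (≤-trans (class-size-mono r K y t 1≤K) (lV i li))
                  go (no ne)    = subst (λ W → s t ≤ card W) (sym (V′-off i ne)) (lA i li ne)
          V′⊆V : ∀ i x → lookup (V′ i) x ≡ true → lookup (V i) x ≡ true × (i ≢ j → lookup A x ≡ true)
          V′⊆V i x q = go (i ≟ j)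
            where go : Dec (i ≡ j) → lookup (V i) x ≡ true × (i ≢ j → lookup A x ≡ true)
                  go (yes refl) = subst (λ W → lookup W x ≡ true) V′-at q , λ ne → ⊥-elim (ne refl)
                  go (no ne)    = ∧-trueʳ {lookup A x} q′ , λ _ → ∧-trueˡ q′
                    where q′ : lookup A x ∧ lookup (V i) x ≡ true
                          q′ = trans (sym (lookup-zipWith _∧_ x A (V i))) (subst (λ W → lookup W x ≡ true) (V′-off i ne) q)
          finish : Choice (suc j) V′ → Choice j V
          finish (B , hB , hx) = B′ , first , λ i li → second i (hx i li)
            where
              B′ : ℕ → Vec Bool n
              B′ = upd j A B
              first : ∀ i → j ≤ i → i < r → m (B′ i) ≡ true × sub (B′ i) (X i) ≡ true
              first i l l′ = go (i ≟ j)
                where go : Dec (i ≡ j) → m (B′ i) ≡ true × sub (B′ i) (X i) ≡ true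
                      go (yes refl) = subst (λ W → m W ≡ true × sub W (X i) ≡ true) (sym (upd-at j A B)) (mA , sA)
                      go (no ne)    = subst (λ W → m W ≡ true × sub W (X i) ≡ true) (sym (upd-off A B ne)) (hB i (≤∧≢⇒< l (ne ∘ sym)) l′)
              second : ∀ i → (∃ λ x → lookup (V′ i) x ≡ true × (∀ i′ → suc j ≤ i′ → i′ < r → i′ ≢ i → lookup (B i′) x ≡ true)) →
                ∃ λ x → lookup (V i) x ≡ true × (∀ i′ → j ≤ i′ → i′ < r → i′ ≢ i → lookup (B′ i′) x ≡ true)
              second i (x , q , h) = x , proj₁ (V′⊆V i x q) , λ i′ l l′ ne′ → go i′ l l′ ne′ (i′ ≟ j)
                where
                  go : ∀ i′ → j ≤ i′ → i′ < r → i′ ≢ i → Dec (i′ ≡ j) → lookup (B′ i′) x ≡ true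
                  go i′ l l′ ne′ (yes refl) = subst (λ W → lookup W x ≡ true) (sym (upd-at j A B)) (proj₂ (V′⊆V i x q) (ne′ ∘ sym))
                  go i′ l l′ ne′ (no ne)    = subst (λ W → lookup W x ≡ true) (sym (upd-off A B ne)) (h i′ (≤∧≢⇒< l (ne ∘ sym)) l′ ne′)

lookup-All< : ∀ {r n} {c : Vec ℕ n} → All< r c → ∀ x → lookup c x < r
lookup-All< (l ∷ A) fz     = l
lookup-All< (l ∷ A) (fs x) = lookup-All< A x

extract : ∀ {n k} (m : Vec Bool n → Bool) (u : ∀ A → m A ≡ true → card A ≡ k) d K y → 1 ≤ K → n ≤ suc y * k →
  (c : Vec ℕ n) → All< (suc d) c →
  (∀ j → j < suc d → choose (card (∁ (cls j c))) k ≤ K * m ⟨ ∁ (cls j c) ⟩) →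
  (∀ j → j < suc d → k ≤ card (∁ (cls j c))) →
  (∀ j → j < suc d → class-size (suc d) K y (suc d) ≤ card (cls j c)) →
  ∃ λ (A : ℕ → Vec Bool n) → IsSimplex d (λ (j : Fin (suc d)) → A (toℕ j)) × (∀ j → j < suc d → m (A j) ≡ true)
extract {n} m u d K y 1≤K n≤yk c A< lights big sizes =
  finish (choose-all m u (suc d) K y 1≤K n≤yk c lights big (suc d) 0 refl (λ j → cls j c)
    (λ i _ → sub-intro (cls i c) (cls i c) (λ _ e → e)) sizes)
  where
  finish : Choice m u (suc d) K y 1≤K n≤yk c lights big 0 (λ j → cls j c) → _
  finish (A , hA , hx) = A , simplex-of d A none some , λ j l → proj₁ (hA j z≤n l)
    where
    none : ∀ x → ∃ λ j → j < suc d × lookup (A j) x ≡ false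
    none x = lookup c x , lookup-All< A< x , ¬true⇒false λ e →
      false≢true (trans (lookup-map x not (cls j c)) (cong not (trans (lookup-map x (_≡ᵇ j) c) (≡ᵇ-refl j))))
        (sub-lookup (A j) (∁ (cls j c)) (proj₂ (hA j z≤n (lookup-All< A< x))) x e)
      where j = lookup c x
    some : ∀ j → j < suc d → ∃ λ x → ∀ j′ → j′ < suc d → j′ ≢ j → lookup (A j′) x ≡ true
    some j l = proj₁ (hx j l) , λ j′ l′ ne → proj₂ (proj₂ (hx j l)) j′ z≤n l′ ne

-- The cycle argument

𝟙-∨-shift : ∀ a b → 𝟙 (a ∨ b) ≡ 𝟙 b + 𝟙 (a ∧ not b)
𝟙-∨-shift true  true  = refl
𝟙-∨-shift true  false = refl
𝟙-∨-shift false true  = refl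
𝟙-∨-shift false false = refl

𝟙-true : ∀ {b} → 1 ≤ 𝟙 b → b ≡ true
𝟙-true {true} l = refl

𝟙-of : ∀ {b} → b ≡ true → 𝟙 b ≡ 1
𝟙-of refl = refl

∑<-pos : ∀ N f → 0 < ∑< N f → ∃ λ x → x < N × 0 < f x
∑<-pos (suc N) f l with f N in e
... | suc y = N , ≤-refl , subst (0 <_) (sym e) z<s
... | zero with ∑<-pos N f (subst (0 <_) (trans (∑<-last N f) (trans (cong (∑< N f +_) e) (+-identityʳ _))) l)
...   | x , lx , p = x , m<n⇒m<1+n lx , p

∑<-full : ∀ N (R : ℕ → Bool) → (∀ x → x < N → R x ≡ true) → ∑< N (𝟙 ∘ R) ≡ N
∑<-full N R h = trans (∑<-cong N λ j l → 𝟙-of (h j l)) (trans (∑<-const N 1) (*-identityʳ N))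

module _ (N : ℕ) where

  -- The union of `R` with its backward shift exceeds the shift by the elements of `R` whose
  -- successor is not in `R`. If there were none, going once around the cycle would put everything
  -- into `R`.
  grow : (R : ℕ → Bool) → R N ≡ R 0 → 0 < ∑< N (𝟙 ∘ R) → ∑< N (𝟙 ∘ R) < N →
    suc (∑< N (𝟙 ∘ R)) ≤ ∑< N (λ x → 𝟙 (R x ∨ R (suc x)))
  grow R per pos notfull = begin
    suc (∑< N (𝟙 ∘ R))                                       ≡⟨ +-comm 1 _ ⟩
    ∑< N (𝟙 ∘ R) + 1                                         ≤⟨ +-mono-≤ (≤-reflexive (sym (∑<-shift N (𝟙 ∘ R) (cong 𝟙 per)))) boundary ⟩
    ∑< N (λ x → 𝟙 (R (suc x))) + ∑< N (λ x → 𝟙 (R x ∧ not (R (suc x)))) ≡⟨ sym (∑-+ (upTo N) _ _) ⟩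
    ∑< N (λ x → 𝟙 (R (suc x)) + 𝟙 (R x ∧ not (R (suc x))))   ≡⟨ ∑-cong (upTo N) (λ x → sym (𝟙-∨-shift (R x) (R (suc x)))) ⟩
    ∑< N (λ x → 𝟙 (R x ∨ R (suc x))) ∎
    where
      open ≤-Reasoning
      boundary : 1 ≤ ∑< N (λ x → 𝟙 (R x ∧ not (R (suc x))))
      boundary = n≢0⇒n>0 λ z → <⇒≢ notfull (∑<-full N R (all z))
        where
          Z = ∑< N (λ x → 𝟙 (R x ∧ not (R (suc x)))) ≡ 0
          up : Z → ∀ x → x < N → R x ≡ true → R (suc x) ≡ true
          up z x l e = lem (R x) (R (suc x)) e (≤-trans (∑<-term N (λ x → 𝟙 (R x ∧ not (R (suc x)))) x l) (≤-reflexive z))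
            where lem : ∀ a b → a ≡ true → 𝟙 (a ∧ not b) ≤ 0 → b ≡ true
                  lem true true _ _ = refl
          climb : Z → ∀ x t → x + t ≤ N → R x ≡ true → R (x + t) ≡ true
          climb z x zero    l e = subst (λ y → R y ≡ true) (sym (+-identityʳ x)) e
          climb z x (suc t) l e = subst (λ y → R y ≡ true) (sym (+-suc x t))
            (up z (x + t) (subst (_≤ N) (+-suc x t) l) (climb z x t (≤-trans (+-monoʳ-≤ x (n≤1+n t)) l) e))
          origin = ∑<-pos N (𝟙 ∘ R) pos
          x₀ = proj₁ origin
          R-N : Z → R N ≡ true
          R-N z = subst (λ y → R y ≡ true) (m+[n∸m]≡n (<⇒≤ (proj₁ (proj₂ origin))))
            (climb z x₀ (N ∸ x₀) (≤-reflexive (m+[n∸m]≡n (<⇒≤ (proj₁ (proj₂ origin))))) (𝟙-true (proj₂ (proj₂ origin))))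
          all : Z → ∀ x → x < N → R x ≡ true
          all z x l = climb z 0 x (<⇒≤ l) (trans (sym per) (R-N z))

  window : (ℕ → Bool) → ℕ → ℕ → Bool
  window P zero    x = P x
  window P (suc i) x = window P i x ∨ P (x + suc i)

  window-shift : ∀ (P : ℕ → Bool) i x → window P i (suc x) ≡ true → window P (suc i) x ≡ true
  window-shift P zero    x e = lem (P x) (trans (cong P (+-comm x 1)) e)
    where lem : ∀ a {b} → b ≡ true → a ∨ b ≡ true
          lem true _ = refl
          lem false e = e
  window-shift P (suc i) x e = lem _ _ _ _ (window-shift P i x) (trans (cong P (+-suc x (suc i))) refl) e
    where lem : ∀ a b c f → (a ≡ true → c ≡ true) → b ≡ f → a ∨ f ≡ true → c ∨ b ≡ true
          lem true b c f h q e rewrite h refl = refl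
          lem false b true f h q e = refl
          lem false b false f h q e = trans q e

  window-per : ∀ P → (∀ x → P (x + N) ≡ P x) → ∀ i x → window P i (x + N) ≡ window P i x
  window-per P per zero    x = per x
  window-per P per (suc i) x = cong₂ _∨_ (window-per P per i x) (trans (cong P (l x N (suc i))) (per (x + suc i)))
    where l : ∀ x N i → x + N + i ≡ x + i + N
          l = solve-∀

  window-mono : ∀ P i x → window P i x ≡ true → window P (suc i) x ≡ true
  window-mono P i x e rewrite e = refl

  window-grow : ∀ P → (∀ x → P (x + N) ≡ P x) → 0 < ∑< N (𝟙 ∘ P) → ∀ i → ∑< N (𝟙 ∘ window P i) < N →
    ∑< N (𝟙 ∘ P) + i ≤ ∑< N (𝟙 ∘ window P i)
  window-grow P per pos zero    lt = ≤-reflexive (+-identityʳ _)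
  window-grow P per pos (suc i) lt = begin
    ∑< N (𝟙 ∘ P) + suc i                       ≡⟨ +-suc _ i ⟩
    suc (∑< N (𝟙 ∘ P) + i)                     ≤⟨ s≤s ih ⟩
    suc (∑< N (𝟙 ∘ W))                         ≤⟨ grow W (window-per P per i 0) (≤-trans pos (≤-trans (m≤m+n _ i) ih)) lt′ ⟩
    ∑< N (λ x → 𝟙 (W x ∨ W (suc x)))           ≤⟨ #-mono (upTo N) both ⟩
    ∑< N (𝟙 ∘ window P (suc i)) ∎
    where
      open ≤-Reasoning
      W = window P i
      lt′ : ∑< N (𝟙 ∘ W) < N
      lt′ = ≤-<-trans (#-mono (upTo N) (window-mono P i)) lt
      ih = window-grow P per pos i lt′
      both : ∀ x → W x ∨ W (suc x) ≡ true → window P (suc i) x ≡ true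
      both x = orElim (W x) (W (suc x)) (window-mono P i x) (window-shift P i x)
        where orElim : ∀ a b {c} → (a ≡ true → c ≡ true) → (b ≡ true → c ≡ true) → a ∨ b ≡ true → c ≡ true
              orElim true  b f g e = f e
              orElim false b f g e = g e

  -- Splitting `l` as t + (l - t): whichever of the arcs at x + t belongs to `P`, the lengthened arc
  -- at `x + l` contains it.
  window-in : ∀ (P Q : ℕ → Bool) l → (∀ x i → i ≤ l → P x ≡ true → Q (x + i) ≡ true) →
    ∀ i → i ≤ l → ∀ x → window P i x ≡ true → Q (x + l) ≡ true
  window-in P Q l h zero    le x e = h x l ≤-refl e
  window-in P Q l h (suc i) le x e with window P i x in q
  ... | true  = window-in P Q l h i (≤-trans (n≤1+n i) le) x q
  ... | false = subst (λ y → Q y ≡ true) (trans (+-assoc x (suc i) (l ∸ suc i)) (cong (x +_) (m+[n∸m]≡n le)))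
                  (h (x + suc i) (l ∸ suc i) (m∸n≤m l (suc i)) e)

  ∑<-translate : ∀ f → (∀ x → f (x + N) ≡ f x) → ∀ l → ∑< N (λ x → f (x + l)) ≡ ∑< N f
  ∑<-translate f per zero    = ∑-cong (upTo N) λ x → cong f (+-identityʳ x)
  ∑<-translate f per (suc l) = trans (∑-cong (upTo N) λ x → cong f (+-suc x l))
    (trans (∑<-shift N (λ x → f (x + l)) (trans (cong f (+-comm N l)) (per l))) (∑<-translate f per l))

  -- Katona's cycle argument: a nonempty proper set of arcs grows by at least one whenever the arcs are lengthened by one.
  cycle-growth : ∀ (P Q : ℕ → Bool) a l → (∀ x → P (x + N) ≡ P x) → (∀ x → Q (x + N) ≡ Q x) →
    (∀ x i → i ≤ l → P x ≡ true → Q (x + i) ≡ true) → a + l < N → ∑< N (𝟙 ∘ Q) ≤ a + l →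
    (a + l) * ∑< N (𝟙 ∘ P) ≤ a * ∑< N (𝟙 ∘ Q)
  cycle-growth P Q a l perP perQ h lt q = byCount (∑< N (𝟙 ∘ P)) refl
    where
      p = ∑< N (𝟙 ∘ P)
      w≤q : ∑< N (𝟙 ∘ window P l) ≤ ∑< N (𝟙 ∘ Q)
      w≤q = ≤-trans (#-mono (upTo N) (window-in P Q l h l ≤-refl)) (≤-reflexive (∑<-translate (𝟙 ∘ Q) (cong 𝟙 ∘ perQ) l))
      byCount : ∀ y → y ≡ p → (a + l) * p ≤ a * ∑< N (𝟙 ∘ Q)
      byCount zero    e = subst (λ t → (a + l) * t ≤ a * ∑< N (𝟙 ∘ Q)) e (subst (_≤ a * ∑< N (𝟙 ∘ Q)) (sym (*-zeroʳ (a + l))) z≤n)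
      byCount (suc y) e = begin
        (a + l) * p              ≡⟨ *-distribʳ-+ p a l ⟩
        a * p + l * p            ≤⟨ +-monoʳ-≤ (a * p) (*-monoʳ-≤ l p≤a) ⟩
        a * p + l * a            ≡⟨ lem a p l ⟩
        a * (p + l)              ≤⟨ *-monoʳ-≤ a p+l≤q ⟩
        a * ∑< N (𝟙 ∘ Q) ∎
        where
          open ≤-Reasoning
          lem : ∀ a p l → a * p + l * a ≡ a * (p + l)
          lem = solve-∀
          p+l≤q : p + l ≤ ∑< N (𝟙 ∘ Q)
          p+l≤q = ≤-trans (window-grow P perP (subst (0 <_) e z<s) l (≤-<-trans (≤-trans w≤q q) lt)) w≤q
          p≤a : p ≤ a
          p≤a = +-cancelʳ-≤ l p a (≤-trans p+l≤q q)

-- A coupling, letter by letter: jointly with the image of `u` under `p`, the word obtained from `u`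
-- and fresh randomness `v` is distributed like `mapᵛ w u`.
∑-push₂ : {A B S T : Set} (xs : List A) (ys : List B) (p : A → S) (q : A → B → T) (w : A → T) (c : ℕ) →
  (∀ (f : S → T → ℕ) → ∑ xs (λ a → ∑ ys (λ b → f (p a) (q a b))) ≡ c * ∑ xs (λ a → f (p a) (w a))) →
  ∀ n (f : Vec S n → Vec T n → ℕ) →
  ∑ (vecs xs n) (λ u → ∑ (vecs ys n) (λ v → f (mapᵛ p u) (zipWith q u v))) ≡ c ^ n * ∑ (vecs xs n) (λ u → f (mapᵛ p u) (mapᵛ w u))
∑-push₂ xs ys p q w c h zero f = l (f [] [])
  where l : ∀ x → x + 0 + 0 ≡ 1 * (x + 0)
        l = solve-∀
∑-push₂ xs ys p q w c h (suc n) f = begin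
  ∑ (vecs xs (suc n)) (λ u → ∑ (vecs ys (suc n)) (λ v → f (mapᵛ p u) (zipWith q u v)))
    ≡⟨ ∑-vecs xs n _ ⟩
  ∑ xs (λ a → ∑ (vecs xs n) (λ u → ∑ (vecs ys (suc n)) (λ v → f (p a ∷ mapᵛ p u) (zipWith q (a ∷ u) v))))
    ≡⟨ ∑-cong xs (λ a → trans (∑-cong (vecs xs n) (λ u → ∑-vecs ys n _)) (∑-swap (vecs xs n) ys _)) ⟩
  ∑ xs (λ a → ∑ ys (λ b → ∑ (vecs xs n) (λ u → ∑ (vecs ys n) (λ v → f (p a ∷ mapᵛ p u) (q a b ∷ zipWith q u v)))))
    ≡⟨ ∑-cong xs (λ a → ∑-cong ys (λ b → ∑-push₂ xs ys p q w c h n (λ u v → f (p a ∷ u) (q a b ∷ v)))) ⟩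
  ∑ xs (λ a → ∑ ys (λ b → c ^ n * ∑ (vecs xs n) (λ u → f (p a ∷ mapᵛ p u) (q a b ∷ mapᵛ w u))))
    ≡⟨ h (λ s t → c ^ n * ∑ (vecs xs n) (λ u → f (s ∷ mapᵛ p u) (t ∷ mapᵛ w u))) ⟩
  c * ∑ xs (λ a → c ^ n * ∑ (vecs xs n) (λ u → f (p a ∷ mapᵛ p u) (w a ∷ mapᵛ w u)))
    ≡⟨ cong (c *_) (trans (∑-*ˡ xs (c ^ n) _) (cong (c ^ n *_) (sym (∑-vecs xs n (λ u → f (mapᵛ p u) (mapᵛ w u)))))) ⟩
  c * (c ^ n * ∑ (vecs xs (suc n)) (λ u → f (mapᵛ p u) (mapᵛ w u)))
    ≡⟨ sym (*-assoc c (c ^ n) _) ⟩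
  c ^ suc n * ∑ (vecs xs (suc n)) (λ u → f (mapᵛ p u) (mapᵛ w u)) ∎
  where open ≡-Reasoning

<ᵇ-yes : ∀ {i j} → i < j → (i <ᵇ j) ≡ true
<ᵇ-yes {i} {j} l with i <ᵇ j | <⇒<ᵇ l
... | true | _ = refl

<ᵇ-no : ∀ {i j} → j ≤ i → (i <ᵇ j) ≡ false
<ᵇ-no {i} {j} l = ¬true⇒false λ e → <⇒≱ (<ᵇ⇒< i j (subst IsTrue (sym e) _)) l

∑<-below : ∀ a b (g : Bool → ℕ) → ∑< (a + b) (λ p → g (p <ᵇ a)) ≡ a * g true + b * g false
∑<-below a b g = trans (∑<-+ a b _) (cong₂ _+_
  (trans (∑<-cong a λ j l → cong g (<ᵇ-yes l)) (∑<-const a _))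
  (trans (∑-cong (upTo b) λ j → cong g (<ᵇ-no (m≤m+n a j))) (∑<-const b _)))

mod-add : ∀ N .{{_ : NonZero N}} m i → (m + i) % N ≡ (m % N + i) % N
mod-add N m i = trans (cong (λ t → (t + i) % N) (m≡m%n+[m/n]*n m N))
    (trans (cong (_% N) (r′ (m % N) (m div N * N) i)) (drop (m % N + i) (m div N)))
  where r′ : ∀ a b i → a + b + i ≡ a + i + b
        r′ = solve-∀
        drop : ∀ y t → (y + t * N) % N ≡ y % N
        drop y zero    = cong (_% N) (+-identityʳ y)
        drop y (suc t) = trans (cong (_% N) (r″ y N (t * N))) (trans ([m+n]%n≡m%n (y + t * N) N) (drop y t))
          where r″ : ∀ y N t → y + (N + t) ≡ y + t + N
                r″ = solve-∀

-- The arc of length `a` starting at -x modulo `N`. With this sign, an arc at `x` lies in the arcs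
-- of length a + l at `x + i` for i ≤ l.
arc : (N : ℕ) .{{_ : NonZero N}} → ℕ → ℕ → ℕ → Bool
arc N a x j = (j + x) % N <ᵇ a

module _ (N : ℕ) .{{_ : NonZero N}} where

  arc-per : ∀ a x j → arc N a (x + N) j ≡ arc N a x j
  arc-per a x j = cong (_<ᵇ a) (trans (cong (_% N) (sym (+-assoc j x N))) ([m+n]%n≡m%n (j + x) N))

  ∑<-arc : ∀ a b x (g : Bool → ℕ) → a + b ≡ N → ∑< N (g ∘ arc N a x) ≡ a * g true + b * g false
  ∑<-arc a b x g e = trans (∑<-rotate N x (λ p → g (p <ᵇ a))) (trans (cong (λ t → ∑< t (λ p → g (p <ᵇ a))) (sym e)) (∑<-below a b g))

  -- An arc of length a inside one of length a + l is distributed like a random subset of the latter of relative density a / (a + l).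
  nested-arcs : ∀ a l b x i → a + l + b ≡ N → i ≤ l → ∀ (f : Bool → Bool → ℕ) →
    ∑< N (λ j → ∑< (a + l) (λ s → f (arc N (a + l) (x + i) j) (arc N (a + l) (x + i) j ∧ (s <ᵇ a))))
      ≡ (a + l) * ∑< N (λ j → f (arc N (a + l) (x + i) j) (arc N a x j))
  nested-arcs a l b x i e i≤l f = begin
    ∑< N (λ j → ∑< (a + l) (λ s → f (arc N (a + l) (x + i) j) (arc N (a + l) (x + i) j ∧ (s <ᵇ a))))
      ≡⟨ ∑<-arc (a + l) b (x + i) (λ y → ∑< (a + l) (λ s → f y (y ∧ (s <ᵇ a)))) e ⟩
    (a + l) * ∑< (a + l) (λ s → f true (s <ᵇ a)) + b * ∑< (a + l) (λ s → f false false)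
      ≡⟨ cong₂ (λ s t → (a + l) * s + b * t) (∑<-below a l (f true)) (∑<-const (a + l) (f false false)) ⟩
    (a + l) * (a * f true true + l * f true false) + b * ((a + l) * f false false)
      ≡⟨ lem (a + l) a l b (f true true) (f true false) (f false false) ⟩
    (a + l) * (a * f true true + (l * f true false + b * f false false))
      ≡⟨ cong ((a + l) *_) (sym rhs) ⟩
    (a + l) * ∑< N (λ j → f (arc N (a + l) (x + i) j) (arc N a x j)) ∎
    where
      open ≡-Reasoning
      lem : ∀ A a l b p q r → A * (a * p + l * q) + b * (A * r) ≡ A * (a * p + (l * q + b * r))
      lem = solve-∀
      l′ = l ∸ i
      l≡ : l′ + i ≡ l
      l≡ = m∸n+n≡m i≤l
      -- With the inner arc rotated to the origin, the cycle consists of the inner arc, the part of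
      -- the outer arc after it, the outside, and the `i` positions of the outer arc before it,
      -- which wrap around.
      N≡ : N ≡ a + (l′ + (b + i))
      N≡ = trans (sym e) (trans (cong (λ t → a + t + b) (sym l≡)) (r a l′ i b))
        where r : ∀ a l i b → a + (l + i) + b ≡ a + (l + (b + i))
              r = solve-∀
      g : ℕ → ℕ
      g p = f ((p + i) % N <ᵇ a + l) (p <ᵇ a)
      small : ∀ p → p + i < N → (p + i) % N ≡ p + i
      small p = m<n⇒m%n≡m
      part₁ : ∀ p → p < a → g p ≡ f true true
      part₁ p lp = cong₂ f (<ᵇ-yes (subst (_< a + l) (sym (small p (<-≤-trans q (subst (a + l ≤_) e (m≤m+n _ b))))) q)) (<ᵇ-yes lp)
        where q : p + i < a + l
              q = +-mono-<-≤ lp i≤l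
      part₂ : ∀ p → p < l′ → g (a + p) ≡ f true false
      part₂ p lp = cong₂ f (<ᵇ-yes (subst (_< a + l) (sym (small (a + p) (<-≤-trans q (subst (a + l ≤_) e (m≤m+n _ b))))) q)) (<ᵇ-no (m≤m+n a p))
        where q : a + p + i < a + l
              q = subst₂ _<_ (sym (+-assoc a p i)) refl (+-monoʳ-< a (subst (p + i <_) l≡ (+-monoˡ-< i lp)))
      part₃ : ∀ p → p < b → g (a + (l′ + p)) ≡ f false false
      part₃ p lp = cong₂ f (<ᵇ-no (subst (a + l ≤_) (sym (small _ (subst (_< N) (sym q) (subst (a + l + p <_) e (+-monoʳ-< (a + l) lp))))) (subst (a + l ≤_) (sym q) (m≤m+n _ p))))
                    (<ᵇ-no (m≤m+n a (l′ + p)))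
        where q : a + (l′ + p) + i ≡ a + l + p
              q = trans (r a l′ p i) (cong (λ t → a + t + p) l≡)
                where r : ∀ a l p i → a + (l + p) + i ≡ a + (l + i) + p
                      r = solve-∀
      part₄ : ∀ p → p < i → g (a + (l′ + (b + p))) ≡ f true false
      part₄ p lp = cong₂ f (<ᵇ-yes (subst (_< a + l) (sym wrap) (<-≤-trans lp (≤-trans i≤l (m≤n+m l a))))) (<ᵇ-no (m≤m+n a _))
        where
          q : a + (l′ + (b + p)) + i ≡ p + N
          q = trans (r a l′ b p i) (cong (p +_) (trans (cong (λ t → a + t + b) l≡) e))
            where r : ∀ a l b p i → a + (l + (b + p)) + i ≡ p + (a + (l + i) + b)
                  r = solve-∀
          wrap : (a + (l′ + (b + p)) + i) % N ≡ p
          wrap = trans (cong (_% N) q) (trans ([m+n]%n≡m%n p N) (m<n⇒m%n≡m (<-≤-trans lp (≤-trans i≤l (≤-trans (m≤n+m l a) (subst (a + l ≤_) e (m≤m+n _ b)))))))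
      const< : ∀ m {h : ℕ → ℕ} {v} → (∀ p → p < m → h p ≡ v) → ∑< m h ≡ m * v
      const< m {v = v} h = trans (∑<-cong m h) (∑<-const m v)
      rhs : ∑< N (λ j → f (arc N (a + l) (x + i) j) (arc N a x j)) ≡ a * f true true + (l * f true false + b * f false false)
      rhs = begin
        ∑< N (λ j → f (arc N (a + l) (x + i) j) (arc N a x j))
          ≡⟨ ∑-cong (upTo N) (λ j → cong (λ t → f (t <ᵇ a + l) (arc N a x j)) (trans (cong (_% N) (sym (+-assoc j x i))) (mod-add N (j + x) i))) ⟩
        ∑< N (λ j → g ((j + x) % N))     ≡⟨ ∑<-rotate N x g ⟩
        ∑< N g                           ≡⟨ cong (λ t → ∑< t g) N≡ ⟩
        ∑< (a + (l′ + (b + i))) g        ≡⟨ trans (∑<-+ a _ g) (cong (∑< a g +_) (trans (∑<-+ l′ _ _) (cong (∑< l′ (λ p → g (a + p)) +_) (∑<-+ b i _)))) ⟩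
        ∑< a g + (∑< l′ (λ p → g (a + p)) + (∑< b (λ p → g (a + (l′ + p))) + ∑< i (λ p → g (a + (l′ + (b + p))))))
          ≡⟨ cong₂ _+_ (const< a part₁) (cong₂ _+_ (const< l′ part₂) (cong₂ _+_ (const< b part₃) (const< i part₄))) ⟩
        a * f true true + (l′ * f true false + (b * f false false + i * f true false))
          ≡⟨ cong (a * f true true +_) (trans (r l′ b i (f true false) (f false false)) (cong (λ t → t * f true false + b * f false false) l≡)) ⟩
        a * f true true + (l * f true false + b * f false false) ∎
        where
          r : ∀ l b i y z → l * y + (b * z + i * y) ≡ (l + i) * y + b * z
          r = solve-∀

∑<-reverse : ∀ d f → ∑< (suc d) (λ i → f (d ∸ i)) ≡ ∑< (suc d) f
∑<-reverse zero    f = refl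
∑<-reverse (suc d) f = trans (∑<-suc (suc d) (λ i → f (suc d ∸ i))) (trans (cong (f (suc d) +_) (∑<-reverse d f))
  (trans (+-comm (f (suc d)) _) (sym (∑<-last (suc d) f))))

div-block : ∀ b .{{_ : NonZero b}} i s → s < b → (i * b + s) div b ≡ i
div-block b i s l = trans (+-distrib-/-∣ˡ {i * b} s (n∣m*n i)) (trans (cong₂ _+_ (m*n/n≡m i b) (m<n⇒m/n≡0 l)) (+-identityʳ i))

module Blocks (d b : ℕ) .{{_ : NonZero b}} where

  r = suc d
  N = r * b

  instance
    N≢0 : NonZero N
    N≢0 = m*n≢0 (suc d) b

  -- Rotating the cycle by `j` and cutting it into `r` blocks of length `b` merges an N-colouring
  -- into an r-colouring, again uniformly distributed.
  block : ℕ → ℕ → ℕ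
  block j c = ((c + j) % N) div b

  block< : ∀ j c → block j c < r
  block< j c = m<n*o⇒m/o<n (m%n<n (c + j) N)

  ∑<-block : ∀ j f → ∑< N (f ∘ block j) ≡ b * ∑< r f
  ∑<-block j f = begin
    ∑< N (λ c → f (((c + j) % N) div b))        ≡⟨ ∑<-rotate N j (λ p → f (p div b)) ⟩
    ∑< N (λ p → f (p div b))                    ≡⟨ ∑<-* r b (λ p → f (p div b)) ⟩
    ∑< r (λ i → ∑< b (λ s → f ((i * b + s) div b)))
      ≡⟨ ∑-cong (upTo r) (λ i → trans (∑<-cong b λ s l → cong f (div-block b i s l)) (∑<-const b (f i))) ⟩
    ∑< r (λ i → b * f i)                        ≡⟨ ∑-*ˡ (upTo r) b f ⟩
    b * ∑< r f ∎
    where open ≡-Reasoning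

  ∑-block : ∀ j n (f : Vec ℕ n → ℕ) → ∑ (letters N n) (f ∘ mapᵛ (block j)) ≡ b ^ n * ∑ (letters r n) f
  ∑-block j n f = trans (∑-push (upTo N) (upTo r) (block j) id b (∑<-block j) n f)
    (cong (b ^ n *_) (∑-cong (letters r n) λ v → cong f (map-id v)))
    where map-id : ∀ {n} (v : Vec ℕ n) → mapᵛ id v ≡ v
          map-id []      = refl
          map-id (x ∷ v) = cong (x ∷_) (map-id v)

  -- A shift by `d ∸ i` blocks moves block `i` to the last place, which is what an arc of length
  -- `d * b` leaves out. Later blocks wrap around; earlier ones do not reach the last place.
  arc-block : ∀ j i c → i ≤ d → arc N (d * b) ((d ∸ i) * b + j) c ≡ not (block j c ≡ᵇ i)
  arc-block j i c i≤d = trans (cong (_<ᵇ d * b) position) (cases (<-cmp i′ i))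
    where
      t = d ∸ i
      p = (c + j) % N
      i′ = p div b
      s = p % b
      s<b : s < b
      s<b = m%n<n p b
      p≡ : p ≡ s + i′ * b
      p≡ = m≡m%n+[m/n]*n p b
      t+i : t + i ≡ d
      t+i = m∸n+n≡m i≤d
      position : (c + (t * b + j)) % N ≡ (s + (i′ + t) * b) % N
      position = trans (cong (_% N) (l c (t * b) j)) (trans (mod-add N (c + j) (t * b)) (cong (_% N) (trans (cong (_+ t * b) p≡) (l′ s i′ t b))))
        where l : ∀ c x j → c + (x + j) ≡ c + j + x
              l = solve-∀
              l′ : ∀ s i t b → s + i * b + t * b ≡ s + (i + t) * b
              l′ = solve-∀
      below : ∀ q q′ → q < q′ → s + q * b < q′ * b
      below q q′ l = ≤-trans (+-monoˡ-< (q * b) s<b) (*-monoˡ-≤ b l)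
      cases : _ → ((s + (i′ + t) * b) % N <ᵇ d * b) ≡ not (i′ ≡ᵇ i)
      cases (tri< i′<i ne _) = trans (<ᵇ-yes (subst (_< d * b) (sym (m<n⇒m%n≡m (<-≤-trans lt (m≤n+m (d * b) b)))) lt)) (sym (cong not (≡ᵇ-≢ ne)))
        where lt : s + (i′ + t) * b < d * b
              lt = below (i′ + t) d (subst (i′ + t <_) (trans (+-comm i t) t+i) (+-monoˡ-< t i′<i))
      cases (tri≈ _ i′≡i _) = trans (<ᵇ-no (subst (d * b ≤_) (sym (trans (m<n⇒m%n≡m lt) eq)) (m≤n+m (d * b) s))) (sym (cong not (≡ᵇ-of i′≡i)))
        where eq : s + (i′ + t) * b ≡ s + d * b
              eq = cong (λ q → s + q * b) (trans (+-comm i′ t) (trans (cong (t +_) i′≡i) t+i))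
              lt : s + (i′ + t) * b < N
              lt = subst (_< N) (sym eq) (below d r ≤-refl)
      cases (tri> _ ne i<i′) = trans (<ᵇ-yes (subst (_< d * b) (sym wrap) lt)) (sym (cong not (≡ᵇ-≢ ne)))
        where v = i′ ∸ suc i
              v+ : v + suc i ≡ i′
              v+ = m∸n+n≡m i<i′
              v<d : v < d
              v<d = +-cancelʳ-< (suc i) v d (subst₂ _<_ (sym v+) (sym (+-suc d i)) (s≤s (≤-trans (s≤s⁻¹ (block< j c)) (m≤m+n d i))))
              lt : s + v * b < d * b
              lt = below v d v<d
              wrap : (s + (i′ + t) * b) % N ≡ s + v * b
              wrap = trans (cong (_% N) (trans (cong (λ q → s + (q + t) * b) (sym v+)) (trans (l s v i t b) (cong (λ q → s + v * b + suc q * b) t+i))))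
                (trans ([m+n]%n≡m%n (s + v * b) N) (m<n⇒m%n≡m (<-≤-trans lt (m≤n+m (d * b) b))))
                where l : ∀ s v i t b → s + (v + suc i + t) * b ≡ s + v * b + suc (t + i) * b
                      l = solve-∀

  arcs : ∀ {n} → ℕ → ℕ → Vec ℕ n → Vec Bool n
  arcs a x = mapᵛ (arc N a x)

  arcs-block : ∀ {n} j i (c : Vec ℕ n) → i ≤ d → arcs (d * b) ((d ∸ i) * b + j) c ≡ ∁ (cls i (mapᵛ (block j) c))
  arcs-block j i []      l = refl
  arcs-block j i (x ∷ c) l = cong₂ _∷_ (arc-block j i x l) (arcs-block j i c l)

  -- The `N` arcs of length `d * b` are sorted by offset into the complements of the classes of `b`
  -- merged colourings; the reversal `d ∸ i` matches `arc-block`.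
  regroup : ∀ (f : ℕ → ℕ) → ∑< N f ≡ ∑< b (λ j → ∑< r (λ i → f ((d ∸ i) * b + j)))
  regroup f = trans (∑<-* r b f) (trans (∑-swap (upTo r) (upTo b) (λ i j → f (i * b + j)))
    (∑-cong (upTo b) λ j → sym (∑<-reverse d (λ i → f (i * b + j)))))

  arcs-per : ∀ {n} a x (c : Vec ℕ n) → arcs a (x + N) c ≡ arcs a x c
  arcs-per a x []      = refl
  arcs-per a x (j ∷ c) = cong₂ _∷_ (arc-per N a x j) (arcs-per a x c)

  most-block : ∀ j K n {P : Vec ℕ n → Set} → Most K (letters r n) P → Most K (letters N n) (P ∘ mapᵛ (block j))
  most-block j K n (most bd l h) = most (bd ∘ mapᵛ (block j)) (begin
      K * # (letters N n) (bd ∘ mapᵛ (block j))   ≡⟨ cong (K *_) (∑-block j n (𝟙 ∘ bd)) ⟩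
      K * (b ^ n * # (letters r n) bd)            ≡⟨ lem K (b ^ n) _ ⟩
      b ^ n * (K * # (letters r n) bd)            ≤⟨ *-monoʳ-≤ (b ^ n) l ⟩
      b ^ n * length (letters r n)                ≡⟨ cong (b ^ n *_) (sym (∑-one (letters r n))) ⟩
      b ^ n * ∑ (letters r n) (λ _ → 1)           ≡⟨ sym (∑-block j n (λ _ → 1)) ⟩
      ∑ (letters N n) (λ _ → 1)                   ≡⟨ ∑-one (letters N n) ⟩
      length (letters N n) ∎) λ c e → h (mapᵛ (block j) c) e
    where open ≤-Reasoning
          lem : ∀ K p x → K * (p * x) ≡ p * (K * x)
          lem = solve-∀

full : ∀ n → Vec Bool n
full zero    = []
full (suc n) = true ∷ full n

card-full : ∀ n → card (full n) ≡ n
card-full zero    = refl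
card-full (suc n) = cong suc (card-full n)

full-∩ : ∀ {n} (W : Vec Bool n) → full n ∩ W ≡ W
full-∩ []      = refl
full-∩ (w ∷ W) = cong (w ∷_) (full-∩ W)

zipWith-∧ : ∀ {n} (p q : ℕ → Bool) (u v : Vec ℕ n) → zipWith (λ a s → p a ∧ q s) u v ≡ mapᵛ p u ∩ mapᵛ q v
zipWith-∧ p q []      []      = refl
zipWith-∧ p q (a ∷ u) (s ∷ v) = cong (_ ∷_) (zipWith-∧ p q u v)

module Random {n k : ℕ} (S : Scale n k) (m : Vec Bool n → Bool) (u : ∀ A → m A ≡ true → card A ≡ k) where
  open Density S

  -- Markov's inequality applied to `heavy-average`.
  few-light : ∀ K₀ K X (xs : List ℕ) (p : ℕ → Bool) → light K m X ≡ false →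
    K * # (vecs xs n) (λ v → light K₀ m (X ∩ mapᵛ p v)) ≤ K₀ * length (vecs xs n)
  few-light K₀ K X xs p e = *-cancelˡ-≤ D {{>-nonZero D>0}} (begin
    D * (K * # (vecs xs n) (λ v → light K₀ m (X ∩ mapᵛ p v)))      ≡⟨ l₁ D K _ ⟩
    K * (D * # (vecs xs n) (λ v → light K₀ m (X ∩ mapᵛ p v)))      ≡⟨ cong (K *_) (sym (∑-*ˡ (vecs xs n) D _)) ⟩
    K * ∑ (vecs xs n) (λ v → D * 𝟙 (light K₀ m (X ∩ mapᵛ p v)))    ≤⟨ *-monoʳ-≤ K (∑-mono (vecs xs n) λ v → point (X ∩ mapᵛ p v) _ refl) ⟩
    K * ∑ (vecs xs n) (λ v → K₀ * density m (X ∩ mapᵛ p v))        ≡⟨ cong (K *_) (∑-*ˡ (vecs xs n) K₀ _) ⟩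
    K * (K₀ * ∑ (vecs xs n) (λ v → density m (X ∩ mapᵛ p v)))      ≡⟨ l₁ K K₀ _ ⟩
    K₀ * (K * ∑ (vecs xs n) (λ v → density m (X ∩ mapᵛ p v)))      ≤⟨ *-monoʳ-≤ K₀ (heavy-average xs p K u X e) ⟩
    K₀ * (D * length (vecs xs n))                                  ≡⟨ l₁ K₀ D _ ⟩
    D * (K₀ * length (vecs xs n)) ∎)
    where
      open ≤-Reasoning
      l₁ : ∀ x y z → x * (y * z) ≡ y * (x * z)
      l₁ = solve-∀
      point : ∀ W b → light K₀ m W ≡ b → D * 𝟙 (light K₀ m W) ≤ K₀ * density m W
      point W true  q = ≤-trans (≤-reflexive (trans (cong (λ t → D * 𝟙 t) q) (*-identityʳ D))) (light-true K₀ m W q)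
      point W false q = ≤-trans (≤-reflexive (trans (cong (λ t → D * 𝟙 t) q) (*-zeroʳ D))) z≤n

  -- Given the longer arc, the shorter one is a random part of it by `nested-arcs`, so that
  -- `few-light` applies to each value of the longer arc. This is the substitute for monotonicity in
  -- the cycle argument.
  transition : ∀ N .{{_ : NonZero N}} a l b → a + l + b ≡ N → 0 < a + l → ∀ K₀ K x i → i ≤ l →
    K * # (letters N n) (λ c → light K₀ m (mapᵛ (arc N a x) c) ∧ not (light K m (mapᵛ (arc N (a + l) (x + i)) c)))
      ≤ K₀ * length (letters N n)
  transition N a l b e pos K₀ K x i i≤l = *-cancelˡ-≤ (A ^ n) {{m^n≢0 A n {{>-nonZero pos}}}} (begin
    A ^ n * (K * ∑ L (λ c → Φ (mapᵛ p c) (mapᵛ w c)))                       ≡⟨ l₁ (A ^ n) K _ ⟩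
    K * (A ^ n * ∑ L (λ c → Φ (mapᵛ p c) (mapᵛ w c)))
      ≡⟨ cong (K *_) (sym (∑-push₂ (upTo N) (upTo A) p (λ j s → p j ∧ (s <ᵇ a)) w A (nested-arcs N a l b x i e i≤l) n Φ)) ⟩
    K * ∑ L (λ c → ∑ V (λ v → Φ (mapᵛ p c) (zipWith (λ j s → p j ∧ (s <ᵇ a)) c v)))
      ≡⟨ sym (∑-*ˡ L K _) ⟩
    ∑ L (λ c → K * ∑ V (λ v → Φ (mapᵛ p c) (zipWith (λ j s → p j ∧ (s <ᵇ a)) c v)))
      ≤⟨ ∑-mono L (λ c → ≤-trans (≤-reflexive (cong (K *_) (∑-cong V λ v → cong (Φ (mapᵛ p c)) (zipWith-∧ p (_<ᵇ a) c v)))) (inner (mapᵛ p c) _ refl)) ⟩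
    ∑ L (λ c → K₀ * length V)                                              ≡⟨ ∑-const L _ ⟩
    length L * (K₀ * length V)                                             ≡⟨ cong (λ t → length L * (K₀ * t)) (length-letters A n) ⟩
    length L * (K₀ * A ^ n)                                                ≡⟨ l₂ (length L) K₀ (A ^ n) ⟩
    A ^ n * (K₀ * length L) ∎)
    where
      open ≤-Reasoning
      A = a + l
      L = letters N n
      V = letters A n
      p w : ℕ → Bool
      p = arc N A (x + i)
      w = arc N a x
      Φ : Vec Bool n → Vec Bool n → ℕ
      Φ X W = 𝟙 (light K₀ m W ∧ not (light K m X))
      l₁ : ∀ x y z → x * (y * z) ≡ y * (x * z)
      l₁ = solve-∀
      l₂ : ∀ x y z → x * (y * z) ≡ z * (y * x)
      l₂ = solve-∀
      inner : ∀ X b → light K m X ≡ b → K * ∑ V (λ v → Φ X (X ∩ mapᵛ (_<ᵇ a) v)) ≤ K₀ * length V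
      inner X true  q = ≤-trans (≤-reflexive (trans (cong (K *_) (trans (∑-cong V λ v → trans (cong (λ t → 𝟙 (light K₀ m (X ∩ mapᵛ (_<ᵇ a) v) ∧ not t)) q)
                          (cong 𝟙 (∧-false (light K₀ m (X ∩ mapᵛ (_<ᵇ a) v))))) (∑-zero V))) (*-zeroʳ K))) z≤n
      inner X false q = ≤-trans (*-monoʳ-≤ K (∑-mono V λ v → ≤-reflexive (cong 𝟙 (trans (cong (λ t → light K₀ m (X ∩ mapᵛ (_<ᵇ a) v) ∧ not t) q) (∧-true _)))))
                          (few-light K₀ K X (upTo A) (_<ᵇ a) q)
        where ∧-true : ∀ b → b ∧ true ≡ b
              ∧-true true = refl
              ∧-true false = refl

  -- The random set has on average nearly the density of the whole family, about k / n, and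
  -- densities are at most 1; hence it is light with probability at least k / n - 3 / e. The three
  -- losses are the deficit of the family, the sets with fewer than `k` elements, and the densities
  -- below 1 / e.
  light-count-lower : ∀ (xs : List ℕ) (p : ℕ → Bool) e → 0 < k → k ≤ n →
    n * (e * m ⟨ full n ⟩) + k * choose n k ≥ e * (k * choose n k) →
    e * # (vecs xs n) (λ v → card (mapᵛ p v) <ᵇ k) ≤ length (vecs xs n) →
    e * (k * length (vecs xs n)) ≤ n * (e * # (vecs xs n) (λ v → light e m (mapᵛ p v))) + 3 * (n * length (vecs xs n))
  light-count-lower xs p zero    k>0 k≤n dense small = z≤n
  light-count-lower xs p e@(suc _) k>0 k≤n dense small = *-cancelˡ-≤ D {{>-nonZero D>0}} (begin
      D * (e * (k * Λ))                               ≡⟨ l₀ D e k Λ ⟩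
      e * k * Λ * D                                   ≤⟨ expectation ⟩
      n * (e * Σd) + 2 * (k * Λ * D)                  ≤⟨ +-mono-≤ (*-monoʳ-≤ n markov) (*-monoʳ-≤ 2 (*-monoˡ-≤ D (*-monoˡ-≤ Λ k≤n))) ⟩
      n * (e * (D * g) + D * Λ) + 2 * (n * Λ * D)     ≡⟨ l₁ n e D g Λ ⟩
      D * (n * (e * g) + 3 * (n * Λ)) ∎)
    where
      open ≤-Reasoning
      L = vecs xs n
      Λ = length L
      g = # L (λ v → light e m (mapᵛ p v))
      G = # L (λ v → k ≤ᵇ card (mapᵛ p v))
      B = # L (λ v → card (mapᵛ p v) <ᵇ k)
      Σd = ∑ L (λ v → density m (mapᵛ p v))
      f = m ⟨ full n ⟩
      c = choose n k
      l₀ : ∀ D e k Λ → D * (e * (k * Λ)) ≡ e * k * Λ * D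
      l₀ = solve-∀
      l₁ : ∀ n e D g Λ → n * (e * (D * g) + D * Λ) + 2 * (n * Λ * D) ≡ D * (n * (e * g) + 3 * (n * Λ))
      l₁ = solve-∀
      G+B : Λ ≤ G + B
      G+B = subst₂ _≤_ (∑-one L) (∑-+ L _ _) (∑-mono L λ v → either (card (mapᵛ p v)))
        where either : ∀ w → 1 ≤ 𝟙 (k ≤ᵇ w) + 𝟙 (w <ᵇ k)
              either w with k ≤ᵇ w in q
              ... | true  = s≤s z≤n
              ... | false = ≤-reflexive (sym (𝟙-of (<ᵇ-yes {w} {k} (≰⇒> λ le → subst IsTrue q (≤⇒≤ᵇ {k} {w} le)))))
      average : c * Σd ≡ f * (D * G)
      average = trans (cong₂ (λ s t → choose s k * t) (sym (card-full n)) (∑-cong L λ v → cong (density m) (sym (full-∩ (mapᵛ p v)))))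
        (trans (average-density xs p (full n) u) (cong (λ t → f * (D * t)) (∑-cong L λ v → cong (λ W → 𝟙 (k ≤ᵇ card W)) (full-∩ (mapᵛ p v)))))
      large : e * Λ ≤ e * G + Λ
      large = ≤-trans (*-monoʳ-≤ e G+B) (≤-trans (≤-reflexive (*-distribˡ-+ e G B)) (+-monoʳ-≤ (e * G) small))
      product : e * e * (k * c) * Λ ≤ n * (e * f) * (e * G) + 2 * (e * (k * c) * Λ)
      product = begin
        e * e * (k * c) * Λ                               ≡⟨ q₁ e (k * c) Λ ⟩
        e * (k * c) * (e * Λ)                             ≤⟨ *-monoʳ-≤ (e * (k * c)) large ⟩
        e * (k * c) * (e * G + Λ)                         ≡⟨ *-distribˡ-+ (e * (k * c)) (e * G) Λ ⟩
        e * (k * c) * (e * G) + e * (k * c) * Λ           ≤⟨ +-monoˡ-≤ (e * (k * c) * Λ) (*-monoˡ-≤ (e * G) dense) ⟩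
        (n * (e * f) + k * c) * (e * G) + e * (k * c) * Λ ≡⟨ cong (_+ e * (k * c) * Λ) (*-distribʳ-+ (e * G) (n * (e * f)) (k * c)) ⟩
        n * (e * f) * (e * G) + k * c * (e * G) + e * (k * c) * Λ
          ≤⟨ +-monoˡ-≤ (e * (k * c) * Λ) (+-monoʳ-≤ (n * (e * f) * (e * G)) (*-monoʳ-≤ (k * c) (*-monoʳ-≤ e (#≤length {xs = L} (λ v → k ≤ᵇ card (mapᵛ p v)))))) ⟩
        n * (e * f) * (e * G) + k * c * (e * Λ) + e * (k * c) * Λ ≡⟨ q₂ (n * (e * f) * (e * G)) (k * c) e Λ ⟩
        n * (e * f) * (e * G) + 2 * (e * (k * c) * Λ) ∎
        where q₁ : ∀ e x Λ → e * e * x * Λ ≡ e * x * (e * Λ)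
              q₁ = solve-∀
              q₂ : ∀ y x e Λ → y + x * (e * Λ) + e * x * Λ ≡ y + 2 * (e * x * Λ)
              q₂ = solve-∀
      expectation : e * k * Λ * D ≤ n * (e * Σd) + 2 * (k * Λ * D)
      expectation = *-cancelˡ-≤ (e * c) {{m*n≢0 e c {{_}} {{>-nonZero (choose-pos n k k≤n)}}}} (begin
        e * c * (e * k * Λ * D)                              ≡⟨ q₁ e c k Λ D ⟩
        e * e * (k * c) * Λ * D                              ≤⟨ *-monoˡ-≤ D product ⟩
        (n * (e * f) * (e * G) + 2 * (e * (k * c) * Λ)) * D  ≡⟨ q₂ n e f G k c Λ D ⟩
        e * (n * e * (f * (D * G)) + c * (2 * (k * Λ * D)))  ≡⟨ cong (λ t → e * (n * e * t + c * (2 * (k * Λ * D)))) (sym average) ⟩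
        e * (n * e * (c * Σd) + c * (2 * (k * Λ * D)))       ≡⟨ q₃ n e c Σd (2 * (k * Λ * D)) ⟩
        e * c * (n * (e * Σd) + 2 * (k * Λ * D)) ∎)
        where q₁ : ∀ e c k Λ D → e * c * (e * k * Λ * D) ≡ e * e * (k * c) * Λ * D
              q₁ = solve-∀
              q₂ : ∀ n e f G k c Λ D → (n * (e * f) * (e * G) + 2 * (e * (k * c) * Λ)) * D ≡ e * (n * e * (f * (D * G)) + c * (2 * (k * Λ * D)))
              q₂ = solve-∀
              q₃ : ∀ n e c s x → e * (n * e * (c * s) + c * x) ≡ e * c * (n * (e * s) + x)
              q₃ = solve-∀
      markov : e * Σd ≤ e * (D * g) + D * Λ
      markov = begin
        e * Σd                                                             ≡⟨ sym (∑-*ˡ L e _) ⟩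
        ∑ L (λ v → e * density m (mapᵛ p v))                               ≤⟨ ∑-mono L (λ v → point (mapᵛ p v) _ refl) ⟩
        ∑ L (λ v → e * D * 𝟙 (light e m (mapᵛ p v)) + D)                   ≡⟨ ∑-+ L (λ v → e * D * 𝟙 (light e m (mapᵛ p v))) (λ _ → D) ⟩
        ∑ L (λ v → e * D * 𝟙 (light e m (mapᵛ p v))) + ∑ L (λ _ → D)       ≡⟨ cong₂ _+_ (trans (∑-*ˡ L (e * D) _) (*-assoc e D g)) (trans (∑-const L D) (*-comm Λ D)) ⟩
        e * (D * g) + D * Λ ∎
        where
          point : ∀ W b → light e m W ≡ b → e * density m W ≤ e * D * 𝟙 (light e m W) + D
          point W true  q = ≤-trans (*-monoʳ-≤ e (density≤D u W)) (≤-trans (≤-reflexive (sym (*-identityʳ (e * D))))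
            (≤-trans (≤-reflexive (cong (λ t → e * D * 𝟙 t) (sym q))) (m≤m+n _ D)))
          point W false q = ≤-trans (<⇒≤ (light-false e m W q)) (m≤n+m D _)

one-of-sum : ∀ r (P : ℕ → Bool) → ∑< r (𝟙 ∘ P) ≡ 1 → One r P
one-of-sum (suc r) P e = go (P r) refl
  where
    step : ∑< r (𝟙 ∘ P) + 𝟙 (P r) ≡ 1
    step = trans (sym (∑<-last r (𝟙 ∘ P))) e
    go : ∀ b → P r ≡ b → One (suc r) P
    go true q = (r , ≤-refl , q) , λ a a′ l l′ p p′ → trans (only a l p) (sym (only a′ l′ p′))
      where
        zero-below : ∑< r (𝟙 ∘ P) ≡ 0
        zero-below = suc-injective (trans (trans (+-comm 1 _) (cong (∑< r (𝟙 ∘ P) +_) (sym (𝟙-of q)))) step)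
        only : ∀ a → a < suc r → P a ≡ true → a ≡ r
        only a l p with m≤n⇒m<n∨m≡n (s≤s⁻¹ l)
        ... | inj₂ refl = refl
        ... | inj₁ l′ = ⊥-elim (<⇒≱ z<s (≤-trans (≤-reflexive (sym (𝟙-of p))) (≤-trans (∑<-term r (𝟙 ∘ P) a l′) (≤-reflexive zero-below))))
    go false q with one-of-sum r P (trans (sym (+-identityʳ _)) (trans (cong (λ b → ∑< r (𝟙 ∘ P) + 𝟙 b) (sym q)) step))
    ... | (a , l , p) , un = (a , m<n⇒m<1+n l , p) , λ a₁ a₂ l₁ l₂ p₁ p₂ → un a₁ a₂ (below a₁ l₁ p₁) (below a₂ l₂ p₂) p₁ p₂
      where
        below : ∀ a → a < suc r → P a ≡ true → a < r
        below a l p with m≤n⇒m<n∨m≡n (s≤s⁻¹ l)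
        ... | inj₁ l′ = l′
        ... | inj₂ refl = ⊥-elim (false≢true q p)

#-letter : ∀ r i → i < r → # (upTo r) (_≡ᵇ i) ≡ 1
#-letter (suc r) zero    l = trans (∑<-suc r (λ j → 𝟙 (j ≡ᵇ 0))) (cong suc (∑-zero (upTo r)))
#-letter (suc r) (suc i) l = trans (∑<-suc r (λ j → 𝟙 (j ≡ᵇ suc i))) (#-letter r i (s≤s⁻¹ l))

-- Chebyshev's inequality for each colour, with scaled deviation `n ∸ r * s`, at least n / 2, and a
-- union bound over the colours.
most-large-classes : ∀ r s J n → 0 < r → 0 < n → 2 * (r * s) ≤ n → 4 * r * (r * J) ≤ n →
  Most J (letters r n) (λ c → ∀ i → i < r → s ≤ card (cls i c))
most-large-classes r s J n r>0 n>0 l₁ l₂ = most-∀ r J _ one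
  where
    L = letters r n
    one : ∀ i → i < r → Most (r * J) L (λ c → s ≤ card (cls i c))
    one i li = most small (*-cancelˡ-≤ (4 * r) {{m*n≢0 4 r {{_}} {{>-nonZero r>0}}}} (begin
        4 * r * (r * J * # L small)      ≡⟨ sym (*-assoc (4 * r) (r * J) _) ⟩
        4 * r * (r * J) * # L small      ≤⟨ *-monoˡ-≤ (# L small) l₂ ⟩
        n * # L small                    ≤⟨ cheb ⟩
        4 * r * length L ∎)) λ c e → <ᵇ-false e
      where
        open ≤-Reasoning
        small : Vec ℕ n → Bool
        small c = card (cls i c) <ᵇ s
        e = n ∸ r * s
        e+ : r * s + e ≡ n
        e+ = m+[n∸m]≡n (≤-trans (m≤m+n (r * s) _) l₁)
        n≤2e : n ≤ 2 * e
        n≤2e = +-cancelˡ-≤ n n (2 * e) (begin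
          n + n                ≡⟨ cong₂ _+_ (sym e+) (sym e+) ⟩
          r * s + e + (r * s + e) ≡⟨ q (r * s) e ⟩
          2 * (r * s) + 2 * e  ≤⟨ +-monoˡ-≤ (2 * e) l₁ ⟩
          n + 2 * e ∎)
          where q : ∀ x e → x + e + (x + e) ≡ 2 * x + 2 * e
                q = solve-∀
        raw : e * e * # L small ≤ n * (1 * r) * r ^ n
        raw = subst₂ (λ a N → e * e * # L small ≤ n * (a * N) * N ^ n) (#-letter r i li) (length-upTo r)
          (chebyshev (upTo r) (_≡ᵇ i) n e small h)
          where h : ∀ v → small v ≡ true → length (upTo r) * card (cls i v) + e ≤ n * # (upTo r) (_≡ᵇ i)
                h v q = subst₂ (λ N a → N * card (cls i v) + e ≤ n * a) (sym (length-upTo r)) (sym (#-letter r i li))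
                  (≤-trans (+-monoˡ-≤ e (*-monoʳ-≤ r (<⇒≤ (<ᵇ⇒< (card (cls i v)) s (subst IsTrue (sym q) _))))) (≤-reflexive (trans e+ (sym (*-identityʳ n)))))
        cheb : n * # L small ≤ 4 * r * length L
        cheb = *-cancelˡ-≤ n {{>-nonZero n>0}} (begin
          n * (n * # L small)               ≡⟨ sym (*-assoc n n _) ⟩
          n * n * # L small                 ≤⟨ *-monoˡ-≤ (# L small) (*-mono-≤ n≤2e n≤2e) ⟩
          2 * e * (2 * e) * # L small       ≡⟨ q₁ e (# L small) ⟩
          4 * (e * e * # L small)           ≤⟨ *-monoʳ-≤ 4 raw ⟩
          4 * (n * (1 * r) * r ^ n)         ≡⟨ q₂ n r (r ^ n) ⟩
          n * (4 * r * r ^ n)               ≡⟨ cong (λ t → n * (4 * r * t)) (sym (length-letters r n)) ⟩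
          n * (4 * r * length L) ∎)
          where q₁ : ∀ e x → 2 * e * (2 * e) * x ≡ 4 * (e * e * x)
                q₁ = solve-∀
                q₂ : ∀ n r x → 4 * (n * (1 * r) * x) ≡ n * (4 * r * x)
                q₂ = solve-∀

NoSimplex : ∀ {n} → ℕ → (Vec Bool n → Bool) → Set
NoSimplex {n} d m = ∀ (A : ℕ → Vec Bool n) → IsSimplex d (λ (j : Fin (suc d)) → A (toℕ j)) → (∀ j → j < suc d → m (A j) ≡ true) → ⊥

module Heavy {n k : ℕ} (S : Scale n k) (m : Vec Bool n → Bool) (u : ∀ A → m A ≡ true → card A ≡ k)
  (d K y : ℕ) (1≤K : 1 ≤ K) (n≤zk : n ≤ suc y * k) (free : NoSimplex d m) where
  open Density S

  heavy : Vec Bool n → Bool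
  heavy Y = not (light K m (∁ Y))

  heavies : Vec ℕ n → ℕ
  heavies c = ∑< (suc d) (λ i → 𝟙 (heavy (cls i c)))

  some-heavy : ∀ c → All< (suc d) c → (∀ i → i < suc d → class-size (suc d) K y (suc d) ≤ card (cls i c)) → 1 ≤ heavies c
  some-heavy c A big = n≢0⇒n>0 λ z → contra z
    where
      lights : heavies c ≡ 0 → ∀ j → j < suc d → light K m (∁ (cls j c)) ≡ true
      lights z j l = lem _ (≤-trans (∑<-term (suc d) (λ i → 𝟙 (heavy (cls i c))) j l) (≤-reflexive z))
        where lem : ∀ b → 𝟙 (not b) ≤ 0 → b ≡ true
              lem true _ = refl
      contra : heavies c ≡ 0 → ⊥
      contra z = finish (extract m u d K y 1≤K n≤zk c A (λ j l → light-count K m (∁ (cls j c)) (lights z j l))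
                   (λ j l → light-card K m (∁ (cls j c)) (lights z j l)) big)
        where finish : _ → ⊥
              finish (B , simp , mem) = free B simp mem

  most-some-heavy : ∀ J → 0 < n → 2 * (suc d * class-size (suc d) K y (suc d)) ≤ n → 4 * suc d * (suc d * (2 * J)) ≤ n →
    Most J (letters (suc d) n) (λ c → 1 ≤ heavies c)
  most-some-heavy J n>0 l₁ l₂ = most-map (λ c (A , big) → some-heavy c A big)
    (most-× J (most-all< (2 * J) (suc d) n) (most-large-classes (suc d) _ (2 * J) n z<s n>0 l₁ l₂))

arcs-mod : ∀ N .{{_ : NonZero N}} a x i {n} (c : Vec ℕ n) → mapᵛ (arc N a (x + i)) c ≡ mapᵛ (arc N a (x % N + i)) c
arcs-mod N a x i []      = refl
arcs-mod N a x i (j ∷ c) = cong₂ _∷_ (cong (_<ᵇ a) (trans (cong (_% N) (l j x i)) (trans (mod-add N x (j + i)) (cong (_% N) (l (x % N) j i ))))) (arcs-mod N a x i c)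
  where l : ∀ j x i → j + (x + i) ≡ x + (j + i)
        l = solve-∀

module Assembly (d b : ℕ) .{{_ : NonZero b}} (y K₁ : ℕ) (2≤d : 2 ≤ d) (2d≤b : d + d ≤ b) (b-big : 8 * (suc y * K₁) ≤ b) (1≤K₁ : 1 ≤ K₁) where
  open Blocks d b

  private
    z = suc y
    -- Makes the losses 3 / e of `light-count-lower`, summed over `N` arcs, amount to one arc.
    e = 3 * N
    1≤N : 1 ≤ N
    1≤N = >-nonZero⁻¹ N
    instance
      e≢0 : NonZero e
      e≢0 = m*n≢0 3 N

  -- `K`: each `transition` fails with probability at most e / K, and `N * N` pairs of positions
  -- share one half of the error 1 / N of `good`. `J`: the other half is shared by `b` offsets.
  -- `n₀`: Chebyshev's inequality for arcs, the two requirements of `most-some-heavy`, and 1 for n >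
  -- 0.
  K s J n₀ : ℕ
  K  = e * (N * (N * (2 * N)))
  s  = class-size r K y r
  J  = b * (2 * N)
  n₀ = e * (N * N) + 2 * (r * s) + 4 * r * (r * (2 * J)) + 1

  1≤K : 1 ≤ K
  1≤K = *-mono-≤ {1} {e} {1} (>-nonZero⁻¹ e) (*-mono-≤ {1} {N} {1} 1≤N (*-mono-≤ {1} {N} {1} 1≤N (*-mono-≤ {1} {2} {1} (s≤s z≤n) 1≤N)))

  module At {n k : ℕ} (S : Scale n k) (m : Vec Bool n → Bool) (u : ∀ A → m A ≡ true → card A ≡ k)
    (n≥n₀ : n₀ ≤ n) (n≤zk : n ≤ z * k) (kd≤ : k * d ≤ (d ∸ 1) * n) (k≤n : k ≤ n) (free : NoSimplex d m)
    (dense : n * (e * m ⟨ full n ⟩) + k * choose n k ≥ e * (k * choose n k)) where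

    open Density S
    open Random S m u
    open Heavy S m u d K y 1≤K n≤zk free public

    private
      L = letters N n
      len = length L
      n>0 : 0 < n
      n>0 = ≤-trans (m≤n+m 1 _) n≥n₀
      k>0 : 0 < k
      k>0 = n≢0⇒n>0 λ { refl → <⇒≱ n>0 (≤-trans n≤zk (≤-reflexive (*-zeroʳ z))) }
      instance
        n≢0 : NonZero n
        n≢0 = >-nonZero n>0
      q = (k * N) div n
      -- Exceeds k N / n by more than 1 and at most 2: the surplus makes an arc contain `k` elements
      -- with high probability, and the excess costs O(1) arcs.
      a = 2 + q
      kN< : k * N < suc q * n
      kN< = subst (_< suc q * n) (sym (m≡m%n+[m/n]*n (k * N) n)) (+-monoˡ-< (q * n) (m%n<n (k * N) n))
      qn≤ : q * n ≤ k * N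
      qn≤ = subst (q * n ≤_) (sym (m≡m%n+[m/n]*n (k * N) n)) (m≤n+m (q * n) ((k * N) % n))
      a-low : N * k + n ≤ n * a
      a-low = ≤-trans (+-monoˡ-≤ n (≤-trans (≤-reflexive (*-comm N k)) (<⇒≤ kN<))) (≤-reflexive (l q n))
        where l : ∀ q n → suc q * n + n ≡ n * (2 + q)
              l = solve-∀
      a-high : a * n ≤ k * N + 2 * n
      a-high = ≤-trans (≤-reflexive (l q n)) (+-monoˡ-≤ (2 * n) qn≤)
        where l : ∀ q n → (2 + q) * n ≡ q * n + 2 * n
              l = solve-∀
      -- The bound on `k` gives d q ≤ (d - 1) (d + 1) b = d² b - b, and the spare `b` absorbs the 2
      -- d that come from the surplus in `a`.
      a≤ : a ≤ d * b
      a≤ = *-cancelˡ-≤ d {{>-nonZero (≤-trans (s≤s z≤n) 2≤d)}} (+-cancelʳ-≤ 0 _ _ (≤-trans (≤-reflexive (l₀ d q)) (≤-trans (+-mono-≤ dq 2d≤b) (≤-reflexive (trans (l₂ (d ∸ 1) b) (trans (cong (λ t → t * (t * b)) d≡) (sym (+-identityʳ _))))))))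
        where
          d≡ : suc (d ∸ 1) ≡ d
          d≡ = m+[n∸m]≡n (≤-trans (s≤s z≤n) 2≤d)
          l₀ : ∀ d q → d * (2 + q) + 0 ≡ d * q + (d + d)
          l₀ = solve-∀
          l₂ : ∀ t b → t * (suc (suc t) * b) + b ≡ suc t * (suc t * b)
          l₂ = solve-∀
          dq : d * q ≤ (d ∸ 1) * (suc (suc (d ∸ 1)) * b)
          dq = *-cancelˡ-≤ n (begin
            n * (d * q)              ≡⟨ q₁ n d q ⟩
            d * (q * n)              ≤⟨ *-monoʳ-≤ d qn≤ ⟩
            d * (k * N)              ≡⟨ q₂ d k N ⟩
            k * d * N                ≤⟨ *-monoˡ-≤ N kd≤ ⟩
            (d ∸ 1) * n * N          ≡⟨ cong (λ t → (d ∸ 1) * n * (suc t * b)) (sym d≡) ⟩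
            (d ∸ 1) * n * (suc (suc (d ∸ 1)) * b) ≡⟨ q₃ (d ∸ 1) n (suc (suc (d ∸ 1)) * b) ⟩
            n * ((d ∸ 1) * (suc (suc (d ∸ 1)) * b)) ∎)
            where open ≤-Reasoning
                  q₁ : ∀ n d q → n * (d * q) ≡ d * (q * n)
                  q₁ = solve-∀
                  q₂ : ∀ d k N → d * (k * N) ≡ k * d * N
                  q₂ = solve-∀
                  q₃ : ∀ t n x → t * n * x ≡ n * (t * x)
                  q₃ = solve-∀
      N≤za : N ≤ z * a
      N≤za = *-cancelˡ-≤ n (begin
        n * N           ≤⟨ *-monoˡ-≤ N n≤zk ⟩
        z * k * N       ≡⟨ q₁ z k N ⟩
        z * (N * k)     ≤⟨ *-monoʳ-≤ z (≤-trans (m≤m+n (N * k) n) a-low) ⟩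
        z * (n * a)     ≡⟨ q₂ z n a ⟩
        n * (z * a) ∎)
        where open ≤-Reasoning
              q₁ : ∀ z k N → z * k * N ≡ z * (N * k)
              q₁ = solve-∀
              q₂ : ∀ z n a → z * (n * a) ≡ n * (z * a)
              q₂ = solve-∀
      l = d * b ∸ a
      a+l : a + l ≡ d * b
      a+l = m+[n∸m]≡n a≤
      a+l+b : a + l + b ≡ N
      a+l+b = trans (cong (_+ b) a+l) (+-comm (d * b) b)

      G₀ G : ℕ → Vec ℕ n → Bool
      G₀ x c = light e m (arcs a x c)
      G x c = light K m (arcs (a + l) x c)

      G₀-per : ∀ c x → G₀ (x + N) c ≡ G₀ x c
      G₀-per c x = cong (light e m) (arcs-per a x c)
      G-per : ∀ c x → G (x + N) c ≡ G x c
      G-per c x = cong (light K m) (arcs-per (a + l) x c)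

      transitions : Most (2 * N) L (λ c → ∀ x → x < N → ∀ i → i < N → i ≤ l → G₀ x c ≡ true → G (x + i) c ≡ true)
      transitions = most-∀ N (2 * N) _ λ x _ → most-∀ N (N * (2 * N)) _ λ i _ → one x i (i ≤? l)
        where
          one : ∀ x i → Dec (i ≤ l) → Most (N * (N * (2 * N))) L (λ c → i ≤ l → G₀ x c ≡ true → G (x + i) c ≡ true)
          one x i (no ¬le) = most-all λ c le → ⊥-elim (¬le le)
          one x i (yes le) = most (λ c → G₀ x c ∧ not (G (x + i) c))
            (*-cancelˡ-≤ e (≤-trans (≤-reflexive (sym (*-assoc e (N * (N * (2 * N))) _)))
              (transition N a l b a+l+b (subst (0 <_) (sym a+l) (≤-trans (s≤s z≤n) a≤)) e K x i le)))
            λ c f _ g → lem (G₀ x c) (G (x + i) c) f g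
            where lem : ∀ p q → p ∧ not q ≡ false → p ≡ true → q ≡ true
                  lem true true _ _ = refl

      someHeavy : Most J (letters r n) (λ c → 1 ≤ heavies c)
      someHeavy = most-some-heavy J n>0
        (≤-trans (≤-trans (m≤n+m (2 * (r * s)) (e * (N * N))) (≤-trans (m≤m+n _ (4 * r * (r * (2 * J)))) (m≤m+n _ 1))) n≥n₀)
        (≤-trans (≤-trans (m≤n+m (4 * r * (r * (2 * J))) (e * (N * N) + 2 * (r * s))) (m≤m+n _ 1)) n≥n₀)

      good : Most N L (λ c → (∀ x → x < N → ∀ i → i < N → i ≤ l → G₀ x c ≡ true → G (x + i) c ≡ true)
        × (∀ j → j < b → 1 ≤ heavies (mapᵛ (block j) c)))
      good = most-× N transitions (most-∀ b (2 * N) _ λ j _ → most-block j J n someHeavy)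

      #G₀ #G H : Vec ℕ n → ℕ
      #G₀ c = ∑< N (λ x → 𝟙 (G₀ x c))
      #G c = ∑< N (λ x → 𝟙 (G x c))
      H c = ∑< N (λ x → 𝟙 (not (G x c)))

      H-blocks : ∀ c → H c ≡ ∑< b (λ j → heavies (mapᵛ (block j) c))
      H-blocks c = trans (regroup (λ x → 𝟙 (not (G x c)))) (∑-cong (upTo b) λ j → ∑<-cong r λ i li →
        cong (λ W → 𝟙 (not (light K m W))) (trans (cong (λ t → arcs t ((d ∸ i) * b + j) c) a+l) (arcs-block j i c (s≤s⁻¹ li))))

      #G+H : ∀ c → #G c + H c ≡ N
      #G+H c = trans (#-total (upTo N) (λ x → G x c)) (length-upTo N)

      growth : ∀ c → (∀ x → x < N → ∀ i → i < N → i ≤ l → G₀ x c ≡ true → G (x + i) c ≡ true)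
        × (∀ j → j < b → 1 ≤ heavies (mapᵛ (block j) c)) → (a + l) * #G₀ c ≤ a * #G c
      growth c (tr , hv) = cycle-growth N (λ x → G₀ x c) (λ x → G x c) a l (G₀-per c) (G-per c) step a+l<N few-G
        where
          a+l<N : a + l < N
          a+l<N = subst (a + l <_) a+l+b (m<m+n (a + l) (>-nonZero⁻¹ b))
          step : ∀ x i → i ≤ l → G₀ x c ≡ true → G (x + i) c ≡ true
          step x i le e₀ = trans (cong (light K m) (arcs-mod N (a + l) x i c))
            (tr (x % N) (m%n<n x N) i (≤-<-trans (≤-trans le (m≤n+m l a)) a+l<N) le
              (trans (cong (light e m) (trans (cong (λ t → arcs a t c) (sym (+-identityʳ (x % N)))) (trans (sym (arcs-mod N a x 0 c)) (cong (λ t → arcs a t c) (+-identityʳ x))))) e₀))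
          -- Each of the `b` merged colourings has a heavy class, which leaves at most N - b light
          -- arcs.
          few-G : #G c ≤ a + l
          few-G = +-cancelʳ-≤ b (#G c) (a + l) (begin
            #G c + b       ≤⟨ +-monoʳ-≤ (#G c) b≤H ⟩
            #G c + H c     ≡⟨ #G+H c ⟩
            N              ≡⟨ sym a+l+b ⟩
            a + l + b ∎)
            where
              open ≤-Reasoning
              b≤H : b ≤ H c
              b≤H = subst₂ _≤_ (trans (∑<-const b 1) (*-identityʳ b)) (sym (H-blocks c)) (∑<-mono b hv)

      S₀ S₁ ΣH : ℕ
      S₀ = ∑ L #G₀
      S₁ = ∑ L #G
      ΣH = ∑ L H

      -- By double counting of the pairs (x, c) with G₀ x c.
      many-light : a * len ≤ S₀ + 3 * len
      many-light = *-cancelˡ-≤ n (begin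
        n * (a * len)                              ≡⟨ q₁ n a len ⟩
        a * n * len                                ≤⟨ *-monoˡ-≤ len a-high ⟩
        (k * N + 2 * n) * len                      ≡⟨ q₂ k N n len ⟩
        N * (k * len) + 2 * (n * len)              ≤⟨ +-monoˡ-≤ (2 * (n * len)) summed ⟩
        n * S₀ + n * len + 2 * (n * len)           ≡⟨ q₃ n S₀ len ⟩
        n * (S₀ + 3 * len) ∎)
        where
          open ≤-Reasoning
          q₁ : ∀ n a x → n * (a * x) ≡ a * n * x
          q₁ = solve-∀
          q₂ : ∀ k N n x → (k * N + 2 * n) * x ≡ N * (k * x) + 2 * (n * x)
          q₂ = solve-∀
          q₃ : ∀ n s x → n * s + n * x + 2 * (n * x) ≡ n * (s + 3 * x)
          q₃ = solve-∀
          q₄ : ∀ N k x → 3 * N * (N * (k * x)) ≡ N * (3 * N * (k * x))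
          q₄ = solve-∀
          q₅ : ∀ n e s N x → n * (e * s) + N * (3 * (n * x)) ≡ n * (e * s) + 3 * N * (n * x)
          q₅ = solve-∀
          q₆ : ∀ n e s x → n * (e * s) + e * x ≡ e * (n * s + x)
          q₆ = solve-∀
          arcs-count : ∀ x → # (upTo N) (arc N a x) ≡ a
          arcs-count x = trans (∑<-arc N a (l + b) x 𝟙 (trans (sym (+-assoc a l b)) a+l+b)) (trans (cong₂ _+_ (*-identityʳ a) (*-zeroʳ (l + b))) (+-identityʳ a))
          small : ∀ x → e * # L (λ c → card (arcs a x c) <ᵇ k) ≤ len
          small x = *-cancelˡ-≤ (N * N) {{m*n≢0 N N}} (*-cancelˡ-≤ n (begin
            n * (N * N * (e * B))         ≡⟨ p₁ n (N * N) e B ⟩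
            n * (e * (N * N) * B)         ≤⟨ *-monoʳ-≤ n (*-monoˡ-≤ B {e * (N * N)} (≤-trans (≤-trans (m≤m+n (e * (N * N)) (2 * (r * s))) (≤-trans (m≤m+n _ (4 * r * (r * (2 * J)))) (m≤m+n _ 1))) n≥n₀)) ⟩
            n * (n * B)                   ≡⟨ sym (*-assoc n n B) ⟩
            n * n * B                     ≤⟨ raw ⟩
            n * (a * N) * N ^ n           ≤⟨ *-monoˡ-≤ (N ^ n) (*-monoʳ-≤ n (*-monoˡ-≤ N a≤N)) ⟩
            n * (N * N) * N ^ n           ≡⟨ trans (*-assoc n (N * N) _) (cong (λ t → n * (N * N * t)) (sym (length-letters N n))) ⟩
            n * (N * N * len) ∎))
            where
              B = # L (λ c → card (arcs a x c) <ᵇ k)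
              a≤N : a ≤ N
              a≤N = ≤-trans a≤ (m≤n+m (d * b) b)
              p₁ : ∀ n w e B → n * (w * (e * B)) ≡ n * (e * w * B)
              p₁ = solve-∀
              raw : n * n * B ≤ n * (a * N) * N ^ n
              raw = subst₂ (λ a N′ → n * n * B ≤ n * (a * N′) * N′ ^ n) (arcs-count x) (length-upTo N)
                (chebyshev (upTo N) (arc N a x) n n (λ c → card (arcs a x c) <ᵇ k) h)
                where h : ∀ v → (card (arcs a x v) <ᵇ k) ≡ true → length (upTo N) * card (arcs a x v) + n ≤ n * # (upTo N) (arc N a x)
                      h v q = subst₂ (λ N′ a → N′ * card (arcs a₀ x v) + n ≤ n * a) (sym (length-upTo N)) (sym (arcs-count x))
                        (≤-trans (+-monoˡ-≤ n (*-monoʳ-≤ N (<⇒≤ (<ᵇ⇒< (card (arcs a x v)) k (subst IsTrue (sym q) _))))) a-low)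
                        where a₀ = a
          summed : N * (k * len) ≤ n * S₀ + n * len
          summed = *-cancelˡ-≤ e (begin
            e * (N * (k * len))                                      ≡⟨ q₄ N k len ⟩
            N * (e * (k * len))                                      ≡⟨ sym (∑<-const N (e * (k * len))) ⟩
            ∑< N (λ x → e * (k * len))                               ≤⟨ ∑-mono (upTo N) (λ x → light-count-lower (upTo N) (arc N a x) e k>0 k≤n dense (small x)) ⟩
            ∑< N (λ x → n * (e * # L (G₀ x)) + 3 * (n * len))        ≡⟨ ∑-+ (upTo N) (λ x → n * (e * # L (G₀ x))) (λ _ → 3 * (n * len)) ⟩
            ∑< N (λ x → n * (e * # L (G₀ x))) + ∑< N (λ _ → 3 * (n * len))
              ≡⟨ cong₂ _+_ (trans (∑-*ˡ (upTo N) n _) (cong (n *_) (trans (∑-*ˡ (upTo N) e _) (cong (e *_) (sym (∑-swap L (upTo N) (λ c x → 𝟙 (G₀ x c)))))))) (∑<-const N (3 * (n * len))) ⟩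
            n * (e * S₀) + N * (3 * (n * len))                       ≡⟨ q₅ n e S₀ N len ⟩
            n * (e * S₀) + e * (n * len)                             ≡⟨ q₆ n e S₀ (n * len) ⟩
            e * (n * S₀ + n * len) ∎)

      -- The exceptional colourings enter with the trivial bound `#G₀ c ≤ N`; their proportion is at
      -- most 1 / N, so they cost one arc on average.
      summed-growth : (a + l) * S₀ ≤ a * S₁ + (a + l) * len
      summed-growth = begin
        (a + l) * S₀                                                     ≡⟨ sym (∑-*ˡ L (a + l) #G₀) ⟩
        ∑ L (λ c → (a + l) * #G₀ c)                                      ≤⟨ ∑-mono L (λ c → point c _ refl) ⟩
        ∑ L (λ c → a * #G c + (a + l) * N * 𝟙 (bad good c))              ≡⟨ ∑-+ L (λ c → a * #G c) (λ c → (a + l) * N * 𝟙 (bad good c)) ⟩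
        ∑ L (λ c → a * #G c) + ∑ L (λ c → (a + l) * N * 𝟙 (bad good c))  ≡⟨ cong₂ _+_ (∑-*ˡ L a #G) (trans (∑-*ˡ L ((a + l) * N) _) (*-assoc (a + l) N _)) ⟩
        a * S₁ + (a + l) * (N * # L (bad good))                          ≤⟨ +-monoʳ-≤ (a * S₁) (*-monoʳ-≤ (a + l) (few good)) ⟩
        a * S₁ + (a + l) * len ∎
        where
          open ≤-Reasoning
          point : ∀ c f → bad good c ≡ f → (a + l) * #G₀ c ≤ a * #G c + (a + l) * N * 𝟙 (bad good c)
          point c false q = ≤-trans (growth c (holds good c q)) (m≤m+n _ _)
          point c true  q = ≤-trans (*-monoʳ-≤ (a + l) (≤-trans (#≤length {xs = upTo N} (λ x → G₀ x c)) (≤-reflexive (length-upTo N))))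
            (≤-trans (≤-reflexive (trans (sym (*-identityʳ _)) (cong (λ t → (a + l) * N * t) (sym (𝟙-of q))))) (m≤n+m _ (a * #G c)))

      -- On average at least (a + l) (1 - 4 / a) of the longer arcs are light: `many-light` loses
      -- three units and `summed-growth` one. Since a + l ≤ z a, at most b + 4 z arcs remain.
      ΣH-bound : ΣH ≤ (b + 4 * z) * len
      ΣH-bound = *-cancelˡ-≤ a (+-cancelʳ-≤ (a * S₁) _ _ (begin
        a * ΣH + a * S₁                                  ≡⟨ trans (+-comm (a * ΣH) _) (sym (*-distribˡ-+ a S₁ ΣH)) ⟩
        a * (S₁ + ΣH)                                    ≡⟨ cong (a *_) (trans (sym (∑-+ L #G H)) (trans (∑-cong L #G+H) (∑-const L N))) ⟩
        a * (len * N)                                    ≡⟨ cong (λ t → a * (len * t)) (sym a+l+b) ⟩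
        a * (len * (a + l + b))                          ≡⟨ q₁ a l b len ⟩
        a * b * len + (a + l) * (a * len)                ≤⟨ +-monoʳ-≤ (a * b * len) (*-monoʳ-≤ (a + l) many-light) ⟩
        a * b * len + (a + l) * (S₀ + 3 * len)           ≡⟨ q₂ (a * b * len) (a + l) S₀ len ⟩
        a * b * len + (a + l) * S₀ + 3 * ((a + l) * len) ≤⟨ +-monoˡ-≤ (3 * ((a + l) * len)) (+-monoʳ-≤ (a * b * len) summed-growth) ⟩
        a * b * len + (a * S₁ + (a + l) * len) + 3 * ((a + l) * len) ≡⟨ q₃ (a * b * len) (a * S₁) ((a + l) * len) ⟩
        a * b * len + 4 * ((a + l) * len) + a * S₁       ≤⟨ +-monoˡ-≤ (a * S₁) (+-monoʳ-≤ (a * b * len) (*-monoʳ-≤ 4 (*-monoˡ-≤ len (≤-trans (≤-trans (m≤m+n (a + l) b) (≤-reflexive a+l+b)) N≤za)))) ⟩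
        a * b * len + 4 * (z * a * len) + a * S₁         ≡⟨ cong (_+ a * S₁) (q₄ a b z len) ⟩
        a * ((b + 4 * z) * len) + a * S₁ ∎))
        where
          open ≤-Reasoning
          q₁ : ∀ a l b x → a * (x * (a + l + b)) ≡ a * b * x + (a + l) * (a * x)
          q₁ = solve-∀
          q₂ : ∀ t A s x → t + A * (s + 3 * x) ≡ t + A * s + 3 * (A * x)
          q₂ = solve-∀
          q₃ : ∀ t s x → t + (s + x) + 3 * x ≡ t + 4 * x + s
          q₃ = solve-∀
          q₄ : ∀ a b z x → a * b * x + 4 * (z * a * x) ≡ a * ((b + 4 * z) * x)
          q₄ = solve-∀

      R = letters r n
      V = ∑ R heavies

      len-split : len ≡ b ^ n * length R
      len-split = trans (sym (∑-one L)) (trans (∑-block 0 n (λ _ → 1)) (cong (b ^ n *_) (∑-one R)))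

      ΣH-blocks : ΣH ≡ b ^ n * (b * V)
      ΣH-blocks = begin
        ∑ L H                                                     ≡⟨ ∑-cong L H-blocks ⟩
        ∑ L (λ c → ∑< b (λ j → heavies (mapᵛ (block j) c)))       ≡⟨ ∑-swap L (upTo b) _ ⟩
        ∑< b (λ j → ∑ L (λ c → heavies (mapᵛ (block j) c)))       ≡⟨ ∑-cong (upTo b) (λ j → ∑-block j n heavies) ⟩
        ∑< b (λ j → b ^ n * V)                                    ≡⟨ ∑<-const b (b ^ n * V) ⟩
        b * (b ^ n * V)                                           ≡⟨ q₁ b (b ^ n) V ⟩
        b ^ n * (b * V) ∎
        where open ≡-Reasoning
              q₁ : ∀ b p v → b * (p * v) ≡ p * (b * v)
              q₁ = solve-∀

      bV≤ : b * V ≤ (b + 4 * z) * length R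
      bV≤ = *-cancelˡ-≤ (b ^ n) {{m^n≢0 b n}} (begin
        b ^ n * (b * V)                    ≡⟨ sym ΣH-blocks ⟩
        ΣH                                 ≤⟨ ΣH-bound ⟩
        (b + 4 * z) * len                  ≡⟨ cong ((b + 4 * z) *_) len-split ⟩
        (b + 4 * z) * (b ^ n * length R)   ≡⟨ q₁ (b + 4 * z) (b ^ n) (length R) ⟩
        b ^ n * ((b + 4 * z) * length R) ∎)
        where open ≤-Reasoning
              q₁ : ∀ x p v → x * (p * v) ≡ p * (x * v)
              q₁ = solve-∀

    -- The mean number of heavy classes is at most 1 + 4 z / b, and the number is almost always at
    -- least 1; hence it rarely differs from 1, as `b` is large against `z * K₁`.
    almost-one-heavy : Most K₁ R (λ c → One r (λ i → heavy (cls i c)))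
    almost-one-heavy = most (λ c → not (heavies c ≡ᵇ 1)) (*-cancelˡ-≤ (2 * b) {{m*n≢0 2 b}} (begin
        2 * b * (K₁ * X)                                 ≡⟨ q₁ b K₁ X ⟩
        2 * K₁ * (b * X)                                 ≤⟨ *-monoʳ-≤ (2 * K₁) bX ⟩
        2 * K₁ * (4 * z * len₁ + 2 * (b * B))            ≡⟨ q₂ K₁ z len₁ b B ⟩
        8 * (z * K₁) * len₁ + b * (4 * K₁ * B)           ≤⟨ +-mono-≤ (*-monoˡ-≤ len₁ b-big) (*-monoʳ-≤ b (≤-trans (*-monoˡ-≤ B 4K₁≤J) (few someHeavy))) ⟩
        b * len₁ + b * len₁                              ≡⟨ q₃ b len₁ ⟩
        2 * b * len₁ ∎))
      λ c e → one-of-sum r (λ i → heavy (cls i c)) (≡ᵇ-true (not-not e))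
      where
        open ≤-Reasoning
        len₁ = length R
        X = # R (λ c → not (heavies c ≡ᵇ 1))
        B = # R (bad someHeavy)
        not-not : ∀ {b} → not b ≡ false → b ≡ true
        not-not {true} e = refl
        q₁ : ∀ b K x → 2 * b * (K * x) ≡ 2 * K * (b * x)
        q₁ = solve-∀
        q₂ : ∀ K z x b B → 2 * K * (4 * z * x + 2 * (b * B)) ≡ 8 * (z * K) * x + b * (4 * K * B)
        q₂ = solve-∀
        q₃ : ∀ b x → b * x + b * x ≡ 2 * b * x
        q₃ = solve-∀
        4K₁≤J : 4 * K₁ ≤ J
        4K₁≤J = ≤-trans (*-mono-≤ {4} {8} (m≤m+n 4 4) (m≤n*m K₁ z)) (≤-trans b-big (m≤m*n b (2 * N) {{m*n≢0 2 N}}))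
        X-bound : len₁ + X ≤ V + 2 * B
        X-bound = subst₂ _≤_ (trans (∑-+ R _ _) (cong (_+ X) (∑-one R))) (trans (∑-+ R heavies (λ c → 2 * 𝟙 (bad someHeavy c))) (cong (V +_) (∑-*ˡ R 2 _)))
          (∑-mono R {λ c → 1 + 𝟙 (not (heavies c ≡ᵇ 1))} {λ c → heavies c + 2 * 𝟙 (bad someHeavy c)} λ c → point (heavies c) (bad someHeavy c) (holds someHeavy c))
          where
            -- The coefficient 2 covers the exceptional colourings with `w` = 0, where the left side
            -- is 2.
            point : ∀ w f → (f ≡ false → 1 ≤ w) → 1 + 𝟙 (not (w ≡ᵇ 1)) ≤ w + 2 * 𝟙 f
            point w             true  h = ≤-trans (+-monoʳ-≤ 1 (𝟙≤1 _)) (m≤n+m 2 w)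
            point zero          false h = ⊥-elim (<⇒≱ z<s (h refl))
            point (suc zero)    false h = ≤-refl
            point (suc (suc w)) false h = s≤s (s≤s z≤n)
        bX : b * X ≤ 4 * z * len₁ + 2 * (b * B)
        bX = +-cancelˡ-≤ (b * len₁) _ _ (begin
          b * len₁ + b * X                             ≡⟨ sym (*-distribˡ-+ b len₁ X) ⟩
          b * (len₁ + X)                               ≤⟨ *-monoʳ-≤ b X-bound ⟩
          b * (V + 2 * B)                              ≡⟨ *-distribˡ-+ b V (2 * B) ⟩
          b * V + b * (2 * B)                          ≤⟨ +-monoˡ-≤ (b * (2 * B)) bV≤ ⟩
          (b + 4 * z) * len₁ + b * (2 * B)             ≡⟨ q₄ b z len₁ B ⟩
          b * len₁ + (4 * z * len₁ + 2 * (b * B)) ∎)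
          where q₄ : ∀ b z x B → (b + 4 * z) * x + b * (2 * B) ≡ b * x + (4 * z * x + 2 * (b * B))
                q₄ = solve-∀

-- The star of the dictator

∑-insertAt : ∀ {A : Set} (xs : List A) n (i : Fin (suc n)) (f : Vec A (suc n) → ℕ) →
  ∑ (vecs xs (suc n)) f ≡ ∑ xs (λ a → ∑ (vecs xs n) (λ w → f (insertAt w i a)))
∑-insertAt xs n fz f = ∑-vecs xs n f
∑-insertAt xs (suc n) (fs i) f = begin
  ∑ (vecs xs (suc (suc n))) f                                                      ≡⟨ ∑-vecs xs (suc n) f ⟩
  ∑ xs (λ b → ∑ (vecs xs (suc n)) (λ v → f (b ∷ v)))                               ≡⟨ ∑-cong xs (λ b → ∑-insertAt xs n i (λ v → f (b ∷ v))) ⟩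
  ∑ xs (λ b → ∑ xs (λ a → ∑ (vecs xs n) (λ w → f (b ∷ insertAt w i a))))           ≡⟨ ∑-swap xs xs (λ b a → ∑ (vecs xs n) (λ w → f (b ∷ insertAt w i a))) ⟩
  ∑ xs (λ a → ∑ xs (λ b → ∑ (vecs xs n) (λ w → f (b ∷ insertAt w i a))))           ≡⟨ ∑-cong xs (λ a → sym (∑-vecs xs n (λ w → f (insertAt w (fs i) a)))) ⟩
  ∑ xs (λ a → ∑ (vecs xs (suc n)) (λ w → f (insertAt w (fs i) a))) ∎
  where open ≡-Reasoning

card-insertAt : ∀ {n} (w : Vec Bool n) i b → card (insertAt w i b) ≡ 𝟙 b + card w
card-insertAt w       fz     b = refl
card-insertAt (x ∷ w) (fs i) b = trans (cong (𝟙 x +_) (card-insertAt w i b)) (l (𝟙 x) (𝟙 b) (card w))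
  where l : ∀ x b c → x + (b + c) ≡ b + (x + c)
        l = solve-∀

co : ∀ {n} → Fin (suc n) → Vec Bool (suc n)
co {n} i = insertAt (full n) i false

sub-full : ∀ {n} (A : Vec Bool n) → sub A (full n) ≡ true
sub-full []          = refl
sub-full (true ∷ A)  = sub-full A
sub-full (false ∷ A) = sub-full A

sub-co : ∀ {n} (w : Vec Bool n) i b → sub (insertAt w i b) (co i) ≡ not b
sub-co w           fz     true  = refl
sub-co w           fz     false = sub-full w
sub-co (true ∷ w)  (fs i) b     = sub-co w i b
sub-co (false ∷ w) (fs i) b     = sub-co w i b

co-∩ : ∀ {n} (W : Vec Bool n) i b → co i ∩ insertAt W i b ≡ insertAt W i false
co-∩ W       fz     b = cong (false ∷_) (full-∩ W)
co-∩ (x ∷ W) (fs i) b = cong (x ∷_) (co-∩ W i b)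

card-co-∩ : ∀ {n} i (W : Vec Bool (suc n)) → card W ≤ suc (card (co i ∩ W))
card-co-∩ fz (true ∷ W)  = s≤s (≤-reflexive (cong card (sym (full-∩ W))))
card-co-∩ fz (false ∷ W) = m≤n⇒m≤1+n (≤-reflexive (cong card (sym (full-∩ W))))
card-co-∩ {suc n} (fs i) (true ∷ W)  = s≤s (card-co-∩ i W)
card-co-∩ {suc n} (fs i) (false ∷ W) = card-co-∩ i W

∁-cls : ∀ {n} (c : Vec ℕ n) → ∁ (cls 0 c) ≡ mapᵛ (λ j → not (j ≡ᵇ 0)) c
∁-cls []      = refl
∁-cls (x ∷ c) = cong (_ ∷_) (∁-cls c)

#-not-zero : ∀ d → # (upTo (suc d)) (λ j → not (j ≡ᵇ 0)) ≡ d
#-not-zero d = trans (∑<-suc d (λ j → 𝟙 (not (j ≡ᵇ 0)))) (trans (∑-one (upTo d)) (length-upTo d))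

module Star {n′ k : ℕ} (S : Scale (suc n′) k) (m : Vec Bool (suc n′) → Bool) (u : ∀ A → m A ≡ true → card A ≡ k)
  (d K K₀ : ℕ) (1≤d : 1 ≤ d) (K₀≤K : K₀ ≤ K) (kd≤ : k * d ≤ (d ∸ 1) * suc n′) (n-big : 2 * (d * d * (d * suc d)) ≤ suc n′) (i : Fin (suc n′))
  (dict : Most K₀ (letters (suc d) (suc n′)) (λ c → not (Density.light S K m (∁ (cls (lookup c i) c))) ≡ true)) where

  open Density S

  private
    n = suc n′
    r = suc d
    L = letters r n
    len = length L
    p : ℕ → Bool
    p j = not (j ≡ᵇ 0)
    Σd = ∑ L (λ c → density m (co i ∩ mapᵛ p c))
    large : Vec ℕ n → Bool
    large c = k ≤ᵇ card (co i ∩ mapᵛ p c)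
    G = # L large

  -- If `i` has colour 0, the complement of class 0 is the complement of the class of `i`, hence
  -- almost always sparse. The set `co i ∩ mapᵛ p c` does not depend on the colour of `i`, so that
  -- fixing this colour to 0 costs only a factor `r`.
  upper : K₀ * Σd ≤ r * (2 * (D * len))
  upper = begin
    K₀ * Σd                                                              ≡⟨ cong (K₀ *_) (∑-insertAt (upTo r) n′ i (λ c → density m (co i ∩ mapᵛ p c))) ⟩
    K₀ * ∑< r (λ a → ∑ W (λ w → density m (co i ∩ mapᵛ p (insertAt w i a))))
      ≡⟨ cong (K₀ *_) (trans (∑-cong (upTo r) (λ a → ∑-cong W (λ w → cong (density m) (fixed w a)))) (∑<-const r _)) ⟩
    K₀ * (r * ∑ W (λ w → density m (mapᵛ p (insertAt w i 0))))             ≡⟨ q₁ K₀ r _ ⟩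
    r * (K₀ * ∑ W (λ w → density m (mapᵛ p (insertAt w i 0))))             ≡⟨ cong (r *_) (sym (∑-*ˡ W K₀ _)) ⟩
    r * ∑ W (λ w → K₀ * density m (mapᵛ p (insertAt w i 0)))               ≤⟨ *-monoʳ-≤ r (∑-mono W λ w → point w _ refl) ⟩
    r * ∑ W (λ w → D + K₀ * D * 𝟙 (bad dict (insertAt w i 0)))             ≡⟨ cong (r *_) (∑-+ W (λ _ → D) (λ w → K₀ * D * 𝟙 (bad dict (insertAt w i 0)))) ⟩
    r * (∑ W (λ _ → D) + ∑ W (λ w → K₀ * D * 𝟙 (bad dict (insertAt w i 0))))
      ≡⟨ cong (r *_) (cong₂ _+_ (trans (∑-const W D) (*-comm (length W) D)) (trans (∑-*ˡ W (K₀ * D) _) (q₂ K₀ D _))) ⟩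
    r * (D * length W + D * (K₀ * ∑ W (λ w → 𝟙 (bad dict (insertAt w i 0)))))
      ≤⟨ *-monoʳ-≤ r (+-mono-≤ (*-monoʳ-≤ D W≤len) (*-monoʳ-≤ D (≤-trans (*-monoʳ-≤ K₀ bad≤) (few dict)))) ⟩
    r * (D * len + D * len)                                              ≡⟨ q₃ r (D * len) ⟩
    r * (2 * (D * len)) ∎
    where
      open ≤-Reasoning
      W = letters r n′
      q₁ : ∀ K r x → K * (r * x) ≡ r * (K * x)
      q₁ = solve-∀
      q₂ : ∀ K D x → K * D * x ≡ D * (K * x)
      q₂ = solve-∀
      q₃ : ∀ r x → r * (x + x) ≡ r * (2 * x)
      q₃ = solve-∀
      fixed : ∀ w a → co i ∩ mapᵛ p (insertAt w i a) ≡ mapᵛ p (insertAt w i 0)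
      fixed w a = trans (cong (co i ∩_) (map-insertAt p a w i)) (trans (co-∩ (mapᵛ p w) i (p a)) (sym (map-insertAt p 0 w i)))
      W≤len : length W ≤ len
      W≤len = subst₂ _≤_ (sym (length-letters r n′)) (sym (length-letters r n)) (m≤n*m (r ^ n′) r)
      bad≤ : ∑ W (λ w → 𝟙 (bad dict (insertAt w i 0))) ≤ # L (bad dict)
      bad≤ = ≤-trans (∑<-term r (λ a → ∑ W (λ w → 𝟙 (bad dict (insertAt w i a)))) 0 z<s)
        (≤-reflexive (sym (∑-insertAt (upTo r) n′ i (𝟙 ∘ bad dict))))
      point : ∀ w f → bad dict (insertAt w i 0) ≡ f →
        K₀ * density m (mapᵛ p (insertAt w i 0)) ≤ D + K₀ * D * 𝟙 (bad dict (insertAt w i 0))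
      point w true  q = ≤-trans (*-monoʳ-≤ K₀ (density≤D u (mapᵛ p (insertAt w i 0))))
        (≤-trans (≤-reflexive (trans (sym (*-identityʳ (K₀ * D))) (cong (K₀ * D *_) (sym (𝟙-of q))))) (m≤n+m _ D))
      point w false q = ≤-trans (*-monoˡ-≤ _ K₀≤K) (≤-trans (<⇒≤ (light-false K m (mapᵛ p c) is-heavy)) (m≤m+n D _))
        where
          c = insertAt w i 0
          notTrue : ∀ {b} → not b ≡ true → b ≡ false
          notTrue {false} e = refl
          is-heavy : light K m (mapᵛ p c) ≡ false
          is-heavy = trans (cong (light K m) (trans (sym (∁-cls c)) (cong (λ a → ∁ (cls a c)) (sym (insertAt-lookup w i 0)))))
            (notTrue (holds dict c q))

  -- Chebyshev's inequality: the complement of class 0 has n d / (d + 1) elements on average, which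
  -- exceeds `k` by a fixed proportion of n.
  lower : len ≤ 2 * G
  lower = +-cancelʳ-≤ len len (2 * G) (begin
    len + len                          ≡⟨ q₀ len ⟩
    2 * len                            ≤⟨ *-monoʳ-≤ 2 split ⟩
    2 * (G + B)                        ≡⟨ *-distribˡ-+ 2 G B ⟩
    2 * G + 2 * B                      ≤⟨ +-monoʳ-≤ (2 * G) rare ⟩
    2 * G + len ∎)
    where
      open ≤-Reasoning
      q₀ : ∀ x → x + x ≡ 2 * x
      q₀ = solve-∀
      small : Vec ℕ n → Bool
      -- `suc k` rather than `k`, because the removal of `i` may cost one element.
      small c = card (mapᵛ p c) <ᵇ suc k
      B = # L small
      split : len ≤ G + B
      split = subst₂ _≤_ (∑-one L) (∑-+ L _ _) (∑-mono L λ c → either c _ refl)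
        where either : ∀ c b → large c ≡ b → 1 ≤ 𝟙 (large c) + 𝟙 (small c)
              either c true  q = ≤-trans (≤-reflexive (sym (𝟙-of q))) (m≤m+n _ _)
              either c false q = ≤-trans (≤-reflexive (sym (𝟙-of (<ᵇ-yes (s≤s (≤-trans (card-co-∩ i (mapᵛ p c)) (≰⇒> λ le → subst IsTrue q (≤⇒≤ᵇ le)))))))) (m≤n+m _ (𝟙 (large c)))
      e = n * d ∸ r * k
      d≡ : suc (d ∸ 1) ≡ d
      d≡ = m+[n∸m]≡n 1≤d
      -- From (d + 1) (d - 1) + 1 = d²: the scaled distance `e` between mean and threshold is at
      -- least n / d.
      margin : d * (r * k) + n ≤ d * (n * d)
      margin = begin
        d * (r * k) + n                          ≡⟨ cong (_+ n) (q₁ d r k) ⟩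
        r * (k * d) + n                          ≤⟨ +-monoˡ-≤ n (*-monoʳ-≤ r kd≤) ⟩
        suc d * ((d ∸ 1) * n) + n                ≡⟨ cong (λ t → suc t * ((d ∸ 1) * n) + n) (sym d≡) ⟩
        suc (suc (d ∸ 1)) * ((d ∸ 1) * n) + n    ≡⟨ q₂ (d ∸ 1) n ⟩
        suc (d ∸ 1) * (n * suc (d ∸ 1))          ≡⟨ cong (λ t → t * (n * t)) d≡ ⟩
        d * (n * d) ∎
        where q₁ : ∀ d r k → d * (r * k) ≡ r * (k * d)
              q₁ = solve-∀
              q₂ : ∀ t n → suc (suc t) * (t * n) + n ≡ suc t * (n * suc t)
              q₂ = solve-∀
      rk≤ : r * k ≤ n * d
      rk≤ = *-cancelˡ-≤ d {{>-nonZero 1≤d}} (≤-trans (m≤m+n _ n) margin)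
      e+ : r * k + e ≡ n * d
      e+ = m+[n∸m]≡n rk≤
      n≤de : n ≤ d * e
      n≤de = +-cancelˡ-≤ (d * (r * k)) _ _ (≤-trans margin (≤-reflexive (trans (cong (d *_) (sym e+)) (*-distribˡ-+ d (r * k) e))))
      raw : e * e * B ≤ n * (d * r) * r ^ n
      raw = subst₂ (λ a N → e * e * B ≤ n * (a * N) * N ^ n) (#-not-zero d) (length-upTo r) (chebyshev (upTo r) p n e small h)
        where h : ∀ v → small v ≡ true → length (upTo r) * card (mapᵛ p v) + e ≤ n * # (upTo r) p
              h v q = subst₂ (λ N a → N * card (mapᵛ p v) + e ≤ n * a) (sym (length-upTo r)) (sym (#-not-zero d))
                (≤-trans (+-monoˡ-≤ e (*-monoʳ-≤ r (s≤s⁻¹ (<ᵇ⇒< (card (mapᵛ p v)) (suc k) (subst IsTrue (sym q) _))))) (≤-reflexive e+))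
      rare : 2 * B ≤ len
      rare = *-cancelˡ-≤ (d * d * (d * r)) {{m*n≢0 (d * d) (d * r) {{m*n≢0 d d {{>-nonZero 1≤d}} {{>-nonZero 1≤d}}}} {{m*n≢0 d r {{>-nonZero 1≤d}}}}}} (*-cancelˡ-≤ n (begin
        n * (d * d * (d * r) * (2 * B))           ≡⟨ q₁ n (d * d * (d * r)) B ⟩
        2 * (d * d * (d * r)) * (n * B)           ≤⟨ *-monoˡ-≤ (n * B) n-big ⟩
        n * (n * B)                               ≡⟨ sym (*-assoc n n B) ⟩
        n * n * B                                 ≤⟨ *-monoˡ-≤ B (*-mono-≤ n≤de n≤de) ⟩
        d * e * (d * e) * B                       ≡⟨ q₂ d e B ⟩
        d * d * (e * e * B)                       ≤⟨ *-monoʳ-≤ (d * d) raw ⟩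
        d * d * (n * (d * r) * r ^ n)             ≡⟨ q₃ n d r (r ^ n) ⟩
        n * (d * d * (d * r) * r ^ n)             ≡⟨ cong (λ t → n * (d * d * (d * r) * t)) (sym (length-letters r n)) ⟩
        n * (d * d * (d * r) * len) ∎))
        where q₁ : ∀ n w B → n * (w * (2 * B)) ≡ 2 * w * (n * B)
              q₁ = solve-∀
              q₂ : ∀ d e B → d * e * (d * e) * B ≡ d * d * (e * e * B)
              q₂ = solve-∀
              q₃ : ∀ n d r x → d * d * (n * (d * r) * x) ≡ n * (d * d * (d * r) * x)
              q₃ = solve-∀

  -- By `average-density` for `co i`, the density of the members avoiding `i` is the average bounded
  -- in `upper`, divided by the proportion of large sets bounded in `lower`.
  few-outside : K₀ * m ⟨ co i ⟩ ≤ 4 * r * choose n′ k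
  few-outside = *-cancelˡ-≤ (D * len) {{m*n≢0 D len {{>-nonZero D>0}} {{>-nonZero len>0}}}} (begin
    D * len * (K₀ * F)                ≤⟨ *-monoˡ-≤ (K₀ * F) (*-monoʳ-≤ D lower) ⟩
    D * (2 * G) * (K₀ * F)            ≡⟨ q₁ D G K₀ F ⟩
    2 * K₀ * (F * (D * G))            ≡⟨ cong (2 * K₀ *_) (sym average) ⟩
    2 * K₀ * (choose n′ k * Σd)       ≡⟨ q₂ K₀ (choose n′ k) Σd ⟩
    2 * choose n′ k * (K₀ * Σd)       ≤⟨ *-monoʳ-≤ (2 * choose n′ k) upper ⟩
    2 * choose n′ k * (r * (2 * (D * len))) ≡⟨ q₃ (choose n′ k) r (D * len) ⟩
    D * len * (4 * r * choose n′ k) ∎)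
    where
      open ≤-Reasoning
      F = m ⟨ co i ⟩
      len>0 : 0 < len
      len>0 = subst (0 <_) (sym (length-letters r n)) (m^n>0 r n)
      card-co : card (co i) ≡ n′
      card-co = trans (card-insertAt (full n′) i false) (card-full n′)
      average : choose n′ k * Σd ≡ F * (D * G)
      average = trans (cong (λ t → choose t k * Σd) (sym card-co)) (average-density (upTo r) p (co i) u)
      q₁ : ∀ D G K F → D * (2 * G) * (K * F) ≡ 2 * K * (F * (D * G))
      q₁ = solve-∀
      q₂ : ∀ K c s → 2 * K * (c * s) ≡ 2 * c * (K * s)
      q₂ = solve-∀
      q₃ : ∀ c r x → 2 * c * (r * (2 * x)) ≡ x * (4 * r * c)
      q₃ = solve-∀

  missing-from-star : ℕ → ℕ
  missing-from-star k′ = # (subsets n′) (λ w → kset k′ w ∧ not (m (insertAt w i true)))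

  -- The star lacks what the whole family lacks plus what lies outside the star. Each part is
  -- allotted half of the budget 1 / K₂: the first by `2 * K₂ ≤ e`, the second by `K₀`, which
  -- combines 4 r from `few-outside`, z from C(n - 1, k) ≤ z C(n - 1, k - 1), and 2 K₂.
  star-nearly-full : ∀ k′ z K₂ e → k ≡ suc k′ → suc n′ ≤ z * k → 0 < z → 0 < K₂ → K₀ ≡ 8 * r * z * K₂ → 2 * K₂ ≤ e →
    e * choose n′ k′ ≤ e * m ⟨ full n ⟩ + choose n′ k′ → K₂ * missing-from-star k′ ≤ choose n′ k′
  star-nearly-full k′ z K₂ e refl n≤zk z>0 K₂>0 refl e-big dense =
    *-cancelˡ-≤ (2 * e) {{>-nonZero (≤-trans (*-mono-≤ {1} {2} {1} (s≤s z≤n) K₂>0) (≤-trans e-big (m≤n*m e 2)))}} (begin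
      2 * e * (K₂ * B)                     ≡⟨ q₁ e K₂ B ⟩
      2 * K₂ * (e * B)                     ≤⟨ *-monoʳ-≤ (2 * K₂) eB ⟩
      2 * K₂ * (e * F + c)                 ≡⟨ q₂ K₂ e F c ⟩
      e * (2 * K₂ * F) + 2 * K₂ * c        ≤⟨ +-mono-≤ (*-monoʳ-≤ e KF) (*-monoˡ-≤ c e-big) ⟩
      e * c + e * c                        ≡⟨ q₃ e c ⟩
      2 * e * c ∎)
    where
      open ≤-Reasoning
      B = missing-from-star k′
      F = m ⟨ co i ⟩
      c = choose n′ k′
      g = # (subsets n′) (λ w → m (insertAt w i true))
      q₁ : ∀ e K B → 2 * e * (K * B) ≡ 2 * K * (e * B)
      q₁ = solve-∀
      q₂ : ∀ K e F c → 2 * K * (e * F + c) ≡ e * (2 * K * F) + 2 * K * c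
      q₂ = solve-∀
      q₃ : ∀ e c → e * c + e * c ≡ 2 * e * c
      q₃ = solve-∀
      star : g + B ≡ c
      star = trans (sym (∑-+ (subsets n′) _ _)) (trans (∑-cong (subsets n′) λ w → point w _ refl)
        (trans (kset⟨⟩ k′ (full n′)) (cong (λ t → choose t k′) (card-full n′))))
        where point : ∀ w b → m (insertAt w i true) ≡ b → 𝟙 (m (insertAt w i true)) + 𝟙 (kset k′ w ∧ not (m (insertAt w i true))) ≡ 𝟙 (kset k′ w ∧ sub w (full n′))
              point w true  q rewrite q | ≡ᵇ-of {card w} {k′} (suc-injective (trans (sym (card-insertAt w i true)) (u _ q))) | sub-full w = refl
              point w false q rewrite q | sub-full w = refl
      total : m ⟨ full n ⟩ ≡ F + g
      total = trans (∑-insertAt (false ∷ true ∷ []) n′ i (λ A → 𝟙 (m A ∧ sub A (full n))))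
        (cong₂ _+_ left (trans (+-identityʳ _) (∑-cong (subsets n′) λ w → cong 𝟙 (and-full (insertAt w i true)))))
        where
          and-full : ∀ A → m A ∧ sub A (full n) ≡ m A
          and-full A rewrite sub-full A with m A
          ... | true  = refl
          ... | false = refl
          left : ∑ (subsets n′) (λ w → 𝟙 (m (insertAt w i false) ∧ sub (insertAt w i false) (full n))) ≡ F
          left = sym (trans (∑-insertAt (false ∷ true ∷ []) n′ i (λ A → 𝟙 (m A ∧ sub A (co i))))
            (trans (cong₂ _+_ (∑-cong (subsets n′) λ w → cong (λ b → 𝟙 (m (insertAt w i false) ∧ b)) (trans (sub-co w i false) (sym (sub-full (insertAt w i false)))))
              (trans (+-identityʳ _) (trans (∑-cong (subsets n′) λ w → trans (cong (λ b → 𝟙 (m (insertAt w i true) ∧ b)) (sub-co w i true)) (cong 𝟙 (∧-false (m (insertAt w i true))))) (∑-zero (subsets n′)))))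
              (+-identityʳ _)))
      eB : e * B ≤ e * F + c
      eB = +-cancelʳ-≤ (e * g) _ _ (begin
        e * B + e * g          ≡⟨ trans (+-comm (e * B) _) (trans (sym (*-distribˡ-+ e g B)) (cong (e *_) star)) ⟩
        e * c                  ≤⟨ dense ⟩
        e * m ⟨ full n ⟩ + c   ≡⟨ cong (λ t → e * t + c) total ⟩
        e * (F + g) + c        ≡⟨ q e F g c ⟩
        e * F + c + e * g ∎)
        where q : ∀ e F g c → e * (F + g) + c ≡ e * F + c + e * g
              q = solve-∀
      choose≤ : choose n′ (suc k′) ≤ z * c
      choose≤ = *-cancelˡ-≤ (suc k′) (begin
        suc k′ * choose n′ (suc k′)           ≤⟨ *-monoʳ-≤ (suc k′) (m≤n+m (choose n′ (suc k′)) c) ⟩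
        suc k′ * choose (suc n′) (suc k′)     ≡⟨ absorb n′ k′ ⟩
        suc n′ * c                            ≤⟨ *-monoˡ-≤ c n≤zk ⟩
        z * suc k′ * c                        ≡⟨ q z (suc k′) c ⟩
        suc k′ * (z * c) ∎)
        where q : ∀ z k c → z * k * c ≡ k * (z * c)
              q = solve-∀
      KF : 2 * K₂ * F ≤ c
      KF = *-cancelˡ-≤ (4 * r * z) {{m*n≢0 (4 * r) z {{m*n≢0 4 r}} {{>-nonZero z>0}}}} (begin
        4 * r * z * (2 * K₂ * F)      ≡⟨ q r z K₂ F ⟩
        8 * r * z * K₂ * F            ≤⟨ few-outside ⟩
        4 * r * choose n′ (suc k′)    ≤⟨ *-monoʳ-≤ (4 * r) choose≤ ⟩
        4 * r * (z * c)               ≡⟨ sym (*-assoc (4 * r) z c) ⟩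
        4 * r * z * c ∎)
        where q : ∀ r z K F → 4 * r * z * (2 * K * F) ≡ 8 * r * z * K * F
              q = solve-∀

-- Shuffles

module _ {A : Set} where

  ins : A → ∀ {n} → Vec A n → List (Vec A (suc n))
  ins x []      = (x ∷ []) ∷ []
  ins x (y ∷ v) = (x ∷ y ∷ v) ∷ map (y ∷_) (ins x v)

  -- Lists the rearrangements with multiplicity. One random rearrangement moves several sets
  -- simultaneously and so keeps their mutual position, while each of them becomes uniform.
  shuffle : ∀ {n} → Vec A n → List (Vec A n)
  shuffle []      = [] ∷ []
  shuffle (x ∷ v) = concatMap (ins x) (shuffle v)

  ins-pos : ∀ x {n} (v : Vec A n) → 1 ≤ length (ins x v)
  ins-pos x []      = s≤s z≤n
  ins-pos x (y ∷ v) = s≤s z≤n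

  shuffle-pos : ∀ {n} (v : Vec A n) → 0 < length (shuffle v)
  shuffle-pos []      = s≤s z≤n
  shuffle-pos (x ∷ v) = ≤-trans (shuffle-pos v) (subst₂ _≤_ (∑-one (shuffle v)) (trans (sym (∑-concatMap (ins x) (shuffle v) (λ _ → 1))) (∑-one (shuffle (x ∷ v))))
    (∑-mono (shuffle v) λ w → ≤-trans (ins-pos x w) (≤-reflexive (sym (∑-one (ins x w))))))

module _ {A B : Set} (t : A → B) where

  ins-map : ∀ x {n} (v : Vec A n) (f : Vec B (suc n) → ℕ) → ∑ (ins x v) (f ∘ mapᵛ t) ≡ ∑ (ins (t x) (mapᵛ t v)) f
  ins-map x []      f = refl
  ins-map x (y ∷ v) f = cong (f (t x ∷ t y ∷ mapᵛ t v) +_)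
    (trans (∑-map (y ∷_) (ins x v) (f ∘ mapᵛ t)) (trans (ins-map x v (λ w → f (t y ∷ w))) (sym (∑-map (t y ∷_) (ins (t x) (mapᵛ t v)) f))))

  shuffle-map : ∀ {n} (v : Vec A n) (f : Vec B n → ℕ) → ∑ (shuffle v) (f ∘ mapᵛ t) ≡ ∑ (shuffle (mapᵛ t v)) f
  shuffle-map []      f = refl
  shuffle-map (x ∷ v) f = trans (∑-concatMap (ins x) (shuffle v) (f ∘ mapᵛ t)) (trans (∑-cong (shuffle v) λ w → ins-map x w f)
    (trans (shuffle-map v (λ w → ∑ (ins (t x) w) f)) (sym (∑-concatMap (ins (t x)) (shuffle (mapᵛ t v)) f))))

level : ∀ n → ℕ → (Vec Bool n → ℕ) → ℕ
level n c f = ∑ (subsets n) (λ w → 𝟙 (kset c w) * f w)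

level-zero : ∀ n f → level (suc n) 0 f ≡ level n 0 (f ∘ (false ∷_))
level-zero n f = trans (∑-subsets n (λ w → 𝟙 (kset 0 w) * f w)) (trans (cong (level n 0 (f ∘ (false ∷_)) +_) (∑-zero (subsets n))) (+-identityʳ _))

level-suc : ∀ n c f → level (suc n) (suc c) f ≡ level n (suc c) (f ∘ (false ∷_)) + level n c (f ∘ (true ∷_))
level-suc n c f = ∑-subsets n (λ w → 𝟙 (kset (suc c) w) * f w)

level-+ : ∀ n c f g → level n c (λ w → f w + g w) ≡ level n c f + level n c g
level-+ n c f g = trans (∑-cong (subsets n) λ w → *-distribˡ-+ (𝟙 (kset c w)) (f w) (g w)) (∑-+ (subsets n) _ _)

level-cong : ∀ n c {f g : Vec Bool n → ℕ} → (∀ w → f w ≡ g w) → level n c f ≡ level n c g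
level-cong n c h = ∑-cong (subsets n) λ w → cong (𝟙 (kset c w) *_) (h w)

-- A word with c + 1 letters `true` arises by insertion once for each of these letters.
level-ins : ∀ n c f → level n c (λ w → ∑ (ins true w) f) ≡ suc c * level (suc n) (suc c) f
level-ins zero zero f = l (f (true ∷ []))
  where l : ∀ x → 1 * (x + 0) + 0 ≡ 1 * (0 * f (false ∷ []) + (1 * x + 0))
        l = λ x → trans (+-identityʳ _) (cong (1 *_) (cong (_+ 0) (sym (*-identityˡ x))))
level-ins zero (suc c) f = sym (*-zeroʳ (suc (suc c)))
level-ins (suc n) c f = trans (cases c) (sym (cong (suc c *_) (level-suc (suc n) c f)))
  where
    open ≡-Reasoning
    f₀ f₁ : Vec Bool (suc n) → ℕ
    f₀ = f ∘ (false ∷_)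
    f₁ = f ∘ (true ∷_)
    behead : ∀ b c → level n c (λ w → ∑ (ins true (b ∷ w)) f) ≡ level n c (λ w → f (true ∷ b ∷ w)) + suc c * level (suc n) (suc c) (f ∘ (b ∷_))
    behead b c = trans (level-cong n c λ w → cong (f (true ∷ b ∷ w) +_) (∑-map (b ∷_) (ins true w) f))
      (trans (level-+ n c (λ w → f (true ∷ b ∷ w)) (λ w → ∑ (ins true w) (f ∘ (b ∷_)))) (cong (level n c (λ w → f (true ∷ b ∷ w)) +_) (level-ins n c (f ∘ (b ∷_)))))
    cases : ∀ c → level (suc n) c (λ w → ∑ (ins true w) f) ≡ suc c * (level (suc n) (suc c) f₀ + level (suc n) c f₁)
    cases zero = begin
      level (suc n) 0 (λ w → ∑ (ins true w) f)                 ≡⟨ level-zero n _ ⟩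
      level n 0 (λ w → ∑ (ins true (false ∷ w)) f)             ≡⟨ behead false 0 ⟩
      level n 0 (f₁ ∘ (false ∷_)) + 1 * level (suc n) 1 f₀     ≡⟨ cong (_+ 1 * level (suc n) 1 f₀) (sym (level-zero n f₁)) ⟩
      level (suc n) 0 f₁ + 1 * level (suc n) 1 f₀              ≡⟨ l (level (suc n) 0 f₁) (level (suc n) 1 f₀) ⟩
      1 * (level (suc n) 1 f₀ + level (suc n) 0 f₁) ∎
      where l : ∀ x y → x + 1 * y ≡ 1 * (y + x)
            l = solve-∀
    cases (suc c) = begin
      level (suc n) (suc c) (λ w → ∑ (ins true w) f)           ≡⟨ level-suc n c _ ⟩
      level n (suc c) (λ w → ∑ (ins true (false ∷ w)) f) + level n c (λ w → ∑ (ins true (true ∷ w)) f)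
        ≡⟨ cong₂ _+_ (behead false (suc c)) (behead true c) ⟩
      level n (suc c) (f₁ ∘ (false ∷_)) + suc (suc c) * X + (level n c (f₁ ∘ (true ∷_)) + suc c * Y)
        ≡⟨ l (level n (suc c) (f₁ ∘ (false ∷_))) (level n c (f₁ ∘ (true ∷_))) X Y c ⟩
      suc (suc c) * X + ((level n (suc c) (f₁ ∘ (false ∷_)) + level n c (f₁ ∘ (true ∷_))) + suc c * Y)
        ≡⟨ cong (λ t → suc (suc c) * X + (t + suc c * Y)) (sym (level-suc n c f₁)) ⟩
      suc (suc c) * X + (Y + suc c * Y)                        ≡⟨ l′ X Y c ⟩
      suc (suc c) * (X + Y) ∎
      where
        X = level (suc n) (suc (suc c)) f₀
        Y = level (suc n) (suc c) f₁
        l : ∀ p q x y c → p + suc (suc c) * x + (q + suc c * y) ≡ suc (suc c) * x + ((p + q) + suc c * y)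
        l = solve-∀
        l′ : ∀ x y c → suc (suc c) * x + (y + suc c * y) ≡ suc (suc c) * (x + y)
        l′ = solve-∀

∁∁ : ∀ {n} (v : Vec Bool n) → ∁ (∁ v) ≡ v
∁∁ []          = refl
∁∁ (true ∷ v)  = cong (true ∷_) (∁∁ v)
∁∁ (false ∷ v) = cong (false ∷_) (∁∁ v)

∑-∁ : ∀ n (f : Vec Bool n → ℕ) → ∑ (subsets n) (f ∘ ∁) ≡ ∑ (subsets n) f
∑-∁ zero    f = refl
∑-∁ (suc n) f = trans (∑-subsets n (f ∘ ∁)) (trans (cong₂ _+_ (∑-∁ n (f ∘ (true ∷_))) (∑-∁ n (f ∘ (false ∷_))))
  (trans (+-comm (∑ (subsets n) (f ∘ (true ∷_))) _) (sym (∑-subsets n f))))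

level-∁ : ∀ n c c′ f → c + c′ ≡ n → level n c′ (f ∘ ∁) ≡ level n c f
level-∁ n c c′ f e = trans (∑-cong (subsets n) λ w → cong (λ b → 𝟙 b * f (∁ w)) (same w)) (∑-∁ n (λ w → 𝟙 (kset c w) * f w))
  where
    same : ∀ w → kset c′ w ≡ kset c (∁ w)
    same w with card w ≟ c′
    ... | yes q = trans (≡ᵇ-of q) (sym (≡ᵇ-of (+-cancelʳ-≡ c′ _ _ (trans (trans (cong (card (∁ w) +_) (sym q)) (trans (+-comm (card (∁ w)) _) (card-∁ w))) (sym e)))))
    ... | no ne = trans (≡ᵇ-≢ ne) (sym (≡ᵇ-≢ {card (∁ w)} {c} λ q → ne (+-cancelˡ-≡ c _ _ (trans (trans (cong (_+ card w) (sym q)) (trans (+-comm (card (∁ w)) _) (card-∁ w))) (sym e)))))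

-- `γ` is c! (n - c)! with c = `card v`, the number of rearrangements that produce a given word.
-- Inserting `false` is inserting `true` into the complement.
shuffle-uniform : ∀ {n} (v : Vec Bool n) → ∃ λ γ → ∀ f → ∑ (shuffle v) f ≡ γ * level n (card v) f
shuffle-uniform [] = 1 , λ f → l (f [])
  where l : ∀ x → x + 0 ≡ 1 * (1 * x + 0)
        l = solve-∀
shuffle-uniform {suc n} (true ∷ v) with shuffle-uniform v
... | γ , h = γ * suc (card v) , λ f → trans (∑-concatMap (ins true) (shuffle v) f) (trans (h _)
      (trans (cong (γ *_) (level-ins n (card v) f)) (sym (*-assoc γ _ _))))
shuffle-uniform {suc n} (false ∷ v) with shuffle-uniform v
... | γ , h = γ * suc (card (∁ v)) , λ f → trans (∑-concatMap (ins false) (shuffle v) f) (trans (h _)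
      (trans (cong (γ *_) (step f)) (sym (*-assoc γ _ _))))
  where
    open ≡-Reasoning
    step : ∀ f → level n (card v) (λ w → ∑ (ins false w) f) ≡ suc (card (∁ v)) * level (suc n) (card v) f
    step f = begin
      level n (card v) (λ w → ∑ (ins false w) f)                   ≡⟨ sym (level-∁ n (card v) (card (∁ v)) (λ w → ∑ (ins false w) f) (card-∁ v)) ⟩
      level n (card (∁ v)) (λ w → ∑ (ins false (∁ w)) f)           ≡⟨ level-cong n (card (∁ v)) (λ w → sym (ins-map not true w f)) ⟩
      level n (card (∁ v)) (λ w → ∑ (ins true w) (f ∘ ∁))          ≡⟨ level-ins n (card (∁ v)) (f ∘ ∁) ⟩
      suc (card (∁ v)) * level (suc n) (suc (card (∁ v))) (f ∘ ∁)  ≡⟨ cong (suc (card (∁ v)) *_) (level-∁ (suc n) (card v) (suc (card (∁ v))) f (trans (+-suc (card v) _) (cong suc (card-∁ v)))) ⟩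
      suc (card (∁ v)) * level (suc n) (card v) f ∎

level-one : ∀ n c → level n c (λ _ → 1) ≡ choose n c
level-one n c = trans (∑-cong (subsets n) λ w → trans (*-identityʳ _) (cong 𝟙 (sym (and-true w))))
  (trans (kset⟨⟩ c (full n)) (cong (λ t → choose t c) (card-full n)))
  where and-true : ∀ w → kset c w ∧ sub w (full n) ≡ kset c w
        and-true w rewrite sub-full w with kset c w
        ... | true  = refl
        ... | false = refl

shuffle-marginal : ∀ {A : Set} {n} (v : Vec A n) (t : A → Bool) c → card (mapᵛ t v) ≡ c → ∀ f →
  choose n c * ∑ (shuffle v) (f ∘ mapᵛ t) ≡ length (shuffle v) * level n c f
shuffle-marginal {n = n} v t .(card (mapᵛ t v)) refl f with shuffle-uniform (mapᵛ t v)
... | γ , h = begin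
    choose n c * ∑ (shuffle v) (f ∘ mapᵛ t)      ≡⟨ cong (choose n c *_) (trans (shuffle-map t v f) (h f)) ⟩
    choose n c * (γ * level n c f)               ≡⟨ l (choose n c) γ (level n c f) ⟩
    γ * choose n c * level n c f                 ≡⟨ cong (_* level n c f) (sym size) ⟩
    length (shuffle v) * level n c f ∎
  where
    open ≡-Reasoning
    c = card (mapᵛ t v)
    l : ∀ x y z → x * (y * z) ≡ y * x * z
    l = solve-∀
    size : length (shuffle v) ≡ γ * choose n c
    size = trans (sym (∑-one (shuffle v))) (trans (shuffle-map t v (λ _ → 1)) (trans (h (λ _ → 1)) (cong (γ *_) (level-one n c))))

-- The image of a shuffled vector under `t` is a uniform c-set by `shuffle-marginal`, so a
-- proportion of c-sets is a proportion of shuffles.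
rare-shuffle : ∀ {A : Set} {n} (v : Vec A n) (t : A → Bool) c → card (mapᵛ t v) ≡ c → c ≤ n → ∀ K (f : Vec Bool n → Bool) →
  K * level n c (𝟙 ∘ f) ≤ choose n c → Most K (shuffle v) (λ w → f (mapᵛ t w) ≡ false)
rare-shuffle {n = n} v t c e c≤n K f h = most (f ∘ mapᵛ t) (*-cancelˡ-≤ (choose n c) {{>-nonZero (choose-pos n c c≤n)}} (begin
    choose n c * (K * # (shuffle v) (f ∘ mapᵛ t))     ≡⟨ l (choose n c) K _ ⟩
    K * (choose n c * # (shuffle v) (f ∘ mapᵛ t))     ≡⟨ cong (K *_) (shuffle-marginal v t c e (𝟙 ∘ f)) ⟩
    K * (length (shuffle v) * level n c (𝟙 ∘ f))      ≡⟨ l K (length (shuffle v)) _ ⟩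
    length (shuffle v) * (K * level n c (𝟙 ∘ f))      ≤⟨ *-monoʳ-≤ (length (shuffle v)) h ⟩
    length (shuffle v) * choose n c                   ≡⟨ *-comm (length (shuffle v)) _ ⟩
    choose n c * length (shuffle v) ∎)) λ _ q → q
  where open ≤-Reasoning
        l : ∀ x y z → x * (y * z) ≡ y * (x * z)
        l = solve-∀

-- Bootstrapping from an almost full star

rng : ℕ → ℕ → ℕ → Bool
rng s len e = (s ≤ᵇ e) ∧ (e <ᵇ s + len)

≤ᵇ-yes : ∀ {i j} → i ≤ j → (i ≤ᵇ j) ≡ true
≤ᵇ-yes {i} {j} l with i ≤ᵇ j | ≤⇒≤ᵇ l
... | true | _ = refl

≤ᵇ-no : ∀ {i j} → j < i → (i ≤ᵇ j) ≡ false
≤ᵇ-no {i} {j} l = ¬true⇒false λ e → <⇒≱ l (≤ᵇ⇒≤ i j (subst IsTrue (sym e) _))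

rng-intro : ∀ s len e → s ≤ e → e < s + len → rng s len e ≡ true
rng-intro s len e l l′ = cong₂ _∧_ (≤ᵇ-yes l) (<ᵇ-yes l′)

rng-lower : ∀ s len e → rng s len e ≡ true → s ≤ e
rng-lower s len e q = ≤ᵇ⇒≤ s e (subst IsTrue (sym (∧-trueˡ q)) _)

rng-upper : ∀ s len e → rng s len e ≡ true → e < s + len
rng-upper s len e q = <ᵇ⇒< e (s + len) (subst IsTrue (sym (∧-trueʳ {s ≤ᵇ e} q)) _)

∑<-rng : ∀ N s len → s + len ≤ N → ∑< N (𝟙 ∘ rng s len) ≡ len
∑<-rng N s len l = begin
  ∑< N (𝟙 ∘ rng s len)                           ≡⟨ cong (λ t → ∑< t (𝟙 ∘ rng s len)) (trans (sym (m+[n∸m]≡n l)) (+-assoc s len _)) ⟩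
  ∑< (s + (len + rest)) (𝟙 ∘ rng s len)          ≡⟨ trans (∑<-+ s (len + rest) _) (cong (∑< s (𝟙 ∘ rng s len) +_) (∑<-+ len rest _)) ⟩
  ∑< s (𝟙 ∘ rng s len) + (∑< len (λ j → 𝟙 (rng s len (s + j))) + ∑< rest (λ j → 𝟙 (rng s len (s + (len + j)))))
    ≡⟨ cong₂ _+_ (trans (∑<-cong s (λ j lj → cong (λ b → 𝟙 (b ∧ (j <ᵇ s + len))) (≤ᵇ-no lj))) (∑-zero (upTo s)))
        (cong₂ _+_ (trans (∑<-cong len (λ j lj → 𝟙-of (rng-intro s len (s + j) (m≤m+n s j) (+-monoʳ-< s lj)))) (trans (∑<-const len 1) (*-identityʳ len)))
                   (trans (∑-cong (upTo rest) (λ j → cong 𝟙 (trans (cong ((s ≤ᵇ s + (len + j)) ∧_) (<ᵇ-no (+-monoʳ-≤ s (m≤m+n len j)))) (∧-false _)))) (∑-zero (upTo rest)))) ⟩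
  0 + (len + 0)                                  ≡⟨ +-identityʳ len ⟩
  len ∎
  where open ≡-Reasoning
        rest = N ∸ (s + len)

tab : ∀ {A : Set} n → (ℕ → A) → Vec A n
tab zero    f = []
tab (suc n) f = f 0 ∷ tab n (f ∘ suc)

card-tab : ∀ {A : Set} n (f : ℕ → A) (t : A → Bool) → card (mapᵛ t (tab n f)) ≡ ∑< n (λ e → 𝟙 (t (f e)))
card-tab zero    f t = refl
card-tab (suc n) f t = trans (cong (𝟙 (t (f 0)) +_) (card-tab n (f ∘ suc) t)) (sym (∑<-suc n (λ e → 𝟙 (t (f e)))))

choose-avoid : ∀ y L x ν → suc y * x ≤ y * ν → suc y ^ L * choose x L ≤ y ^ L * choose ν L
choose-avoid y zero    x       ν       l = ≤-refl
choose-avoid y (suc L) zero    ν       l = ≤-trans (≤-reflexive (*-zeroʳ (suc y ^ suc L))) z≤n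
choose-avoid y (suc L) (suc x) zero    l = ⊥-elim (<⇒≱ z<s (≤-trans l (≤-reflexive (*-zeroʳ y))))
choose-avoid y (suc L) (suc x) (suc ν) l = *-cancelˡ-≤ (suc L) (begin
  suc L * (suc y * suc y ^ L * choose (suc x) (suc L)) ≡⟨ q₁ (suc L) (suc y) (suc y ^ L) (choose (suc x) (suc L)) ⟩
  suc y * suc y ^ L * (suc L * choose (suc x) (suc L)) ≡⟨ cong (suc y * suc y ^ L *_) (absorb x L) ⟩
  suc y * suc y ^ L * (suc x * choose x L)             ≡⟨ q₂ (suc y) (suc y ^ L) (suc x) (choose x L) ⟩
  suc y * suc x * (suc y ^ L * choose x L)             ≤⟨ *-mono-≤ l (choose-avoid y L x ν l′) ⟩
  y * suc ν * (y ^ L * choose ν L)                     ≡⟨ sym (q₂ y (y ^ L) (suc ν) (choose ν L)) ⟩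
  y * y ^ L * (suc ν * choose ν L)                     ≡⟨ cong (y * y ^ L *_) (sym (absorb ν L)) ⟩
  y * y ^ L * (suc L * choose (suc ν) (suc L))         ≡⟨ sym (q₁ (suc L) y (y ^ L) (choose (suc ν) (suc L))) ⟩
  suc L * (y * y ^ L * choose (suc ν) (suc L)) ∎)
  where
    open ≤-Reasoning
    q₁ : ∀ s y p c → s * (y * p * c) ≡ y * p * (s * c)
    q₁ = solve-∀
    q₂ : ∀ y p x c → y * p * (x * c) ≡ y * x * (p * c)
    q₂ = solve-∀
    l′ : suc y * x ≤ y * ν
    l′ = +-cancelʳ-≤ y _ _ (begin
      suc y * x + y         ≤⟨ +-monoʳ-≤ (suc y * x) (n≤1+n y) ⟩
      suc y * x + suc y     ≡⟨ trans (+-comm (suc y * x) _) (sym (*-suc (suc y) x)) ⟩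
      suc y * suc x         ≤⟨ l ⟩
      y * suc ν             ≡⟨ trans (*-suc y ν) (+-comm y _) ⟩
      y * ν + y ∎)

insertAt-cases : ∀ {A : Set} {n} (i x : Fin (suc n)) →
  x ≡ i ⊎ ∃ λ (x′ : Fin n) → ∀ (v : Vec A n) a → lookup (insertAt v i a) x ≡ lookup v x′
insertAt-cases fz     fz     = inj₁ refl
insertAt-cases fz     (fs x) = inj₂ (x , λ v a → refl)
insertAt-cases {n = suc n} (fs i) fz = inj₂ (fz , λ { (b ∷ v) a → refl })
insertAt-cases {n = suc n} (fs i) (fs x) with insertAt-cases i x
... | inj₁ e        = inj₁ (cong fs e)
... | inj₂ (x′ , h) = inj₂ (fs x′ , λ { (b ∷ v) a → h v a })

module Bootstrap {ν k′ : ℕ} (m : Vec Bool (suc ν) → Bool) (i : Fin (suc ν)) (d Y L : ℕ) (1≤d : 1 ≤ d) (free : NoSimplex d m)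
  (n≤zk : suc ν ≤ suc (suc Y) * suc k′) (kd≤ : suc k′ * d ≤ (d ∸ 1) * suc ν) (k≤n : suc k′ ≤ suc ν)
  (1≤L : 1 ≤ L) (L-big : 2 * (d * 2) * suc Y ≤ L) (dL≤ : d * L ≤ k′)
  (few-missing : 2 * (d * 2) * # (subsets ν) (λ w → kset k′ w ∧ not (m (insertAt w i true))) ≤ choose ν k′)
  (W : Vec Bool ν) (card-W : card W ≡ suc k′) (W∈m : m (insertAt W i false) ≡ true) where

  private
    instance
      L≢0 : NonZero L
      L≢0 = >-nonZero 1≤L
      d≢0 : NonZero d
      d≢0 = >-nonZero 1≤d
    k′≤ν : k′ ≤ ν
    k′≤ν = s≤s⁻¹ k≤n
    κ c ρ : ℕ
    κ = ν ∸ k′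
    κ+ : κ + k′ ≡ ν
    κ+ = m∸n+n≡m k′≤ν
    -- κ equals n - k, so the hypothesis on `k` says that `d` complements of members are together
    -- large enough to cover.
    dκ : suc ν ≤ d * κ
    dκ = +-cancelʳ-≤ (d * k′ + d) _ _ (begin
      suc ν + (d * k′ + d)               ≡⟨ cong (suc ν +_) (trans (+-comm (d * k′) d) (trans (sym (*-suc d k′)) (*-comm d (suc k′)))) ⟩
      suc ν + suc k′ * d                 ≤⟨ +-monoʳ-≤ (suc ν) kd≤ ⟩
      suc ν + (d ∸ 1) * suc ν            ≡⟨ cong (_* suc ν) (m+[n∸m]≡n 1≤d) ⟩
      d * suc ν                          ≡⟨ cong (λ t → d * suc t) (sym κ+) ⟩
      d * suc (κ + k′)                   ≡⟨ q d κ k′ ⟩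
      d * κ + (d * k′ + d) ∎)
      where open ≤-Reasoning
            q : ∀ d κ k → d * suc (κ + k) ≡ d * κ + (d * k + d)
            q = solve-∀
    L≤κ : L ≤ κ
    L≤κ = <⇒≤ (*-cancelˡ-< d L κ (≤-trans (s≤s (≤-trans dL≤ k′≤ν)) dκ))
    c = κ ∸ L
    c+ : c + L ≡ κ
    c+ = m∸n+n≡m L≤κ
    dL≤ν : d * L ≤ ν
    dL≤ν = ≤-trans dL≤ k′≤ν
    ρ = ν ∸ d * L
    ρ+ : ρ + d * L ≡ ν
    ρ+ = m∸n+n≡m dL≤ν
    c≤ρ : c ≤ ρ
    c≤ρ = +-cancelʳ-≤ (d * L) c ρ (begin
      c + d * L       ≤⟨ +-mono-≤ (m≤m+n c L) dL≤ ⟩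
      c + L + k′      ≡⟨ trans (cong (_+ k′) c+) (trans κ+ (sym ρ+)) ⟩
      ρ + d * L ∎)
      where open ≤-Reasoning
    ρ≤dc : ρ ≤ d * c
    ρ≤dc = +-cancelʳ-≤ (d * L) ρ (d * c) (begin
      ρ + d * L       ≡⟨ ρ+ ⟩
      ν               ≤⟨ n≤1+n ν ⟩
      suc ν           ≤⟨ dκ ⟩
      d * κ           ≡⟨ cong (d *_) (sym c+) ⟩
      d * (c + L)     ≡⟨ *-distribˡ-+ d c L ⟩
      d * c + d * L ∎)
      where open ≤-Reasoning
    -- Arc `j` would start at `j * c`; the cap `ρ ∸ c` keeps the last arcs inside the range, which
    -- `d` arcs still cover because ρ ≤ d c.
    st : ℕ → ℕ
    st j = (j * c) ⊓ (ρ ∸ c)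

    -- The complements of d members of the star: disjoint private blocks of length L, and arcs of length c covering the rest.
    private-block arc-block′ memb : ℕ → ℕ → Bool
    private-block j = rng (j * L) L
    arc-block′ j = rng (d * L + st j) c
    -- Numbers from `ν` on count as covered, so that `covered` applies to every letter of a shuffled
    -- word without a proof of its range.
    memb j e = (private-block j e ∨ arc-block′ j e) ∨ (ν ≤ᵇ e)

    block-end : ∀ j → j < d → j * L + L ≤ d * L
    block-end j l = ≤-trans (≤-reflexive (+-comm (j * L) L)) (*-monoˡ-≤ L l)
    arc-end : ∀ j → d * L + st j + c ≤ ν
    arc-end j = begin
      d * L + st j + c         ≤⟨ +-monoˡ-≤ c (+-monoʳ-≤ (d * L) (m⊓n≤n (j * c) (ρ ∸ c))) ⟩
      d * L + (ρ ∸ c) + c      ≡⟨ trans (+-assoc (d * L) _ c) (cong (d * L +_) (m∸n+n≡m c≤ρ)) ⟩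
      d * L + ρ                ≡⟨ trans (+-comm (d * L) ρ) ρ+ ⟩
      ν ∎
      where open ≤-Reasoning

    or-left : ∀ a b c → a ≡ true → (a ∨ b) ∨ c ≡ true
    or-left true b c e = refl
    or-mid : ∀ a b c → b ≡ true → (a ∨ b) ∨ c ≡ true
    or-mid true  true c e = refl
    or-mid false true c e = refl
    or-right : ∀ a c → c ≡ true → a ∨ c ≡ true
    or-right true  c e = refl
    or-right false c e = e

    covered : ∀ e → ∃ λ j → j < d × memb j e ≡ true
    covered e = go (ν ≤? e) (e <? d * L)
      where
        go : Dec (ν ≤ e) → Dec (e < d * L) → ∃ λ j → j < d × memb j e ≡ true
        go (yes l) _ = 0 , 1≤d , or-right (private-block 0 e ∨ arc-block′ 0 e) _ (≤ᵇ-yes l)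
        go (no _) (yes l) = j , m<n*o⇒m/o<n l , or-left (private-block j e) _ _ (rng-intro (j * L) L e
            (subst (j * L ≤_) (sym e≡) (m≤n+m (j * L) (e % L)))
            (subst (_< j * L + L) (sym e≡) (subst (_< j * L + L) (+-comm (j * L) (e % L)) (+-monoʳ-< (j * L) (m%n<n e L)))))
          where j = e div L
                e≡ : e ≡ e % L + j * L
                e≡ = m≡m%n+[m/n]*n e L
        go (no e<ν) (no dL≤e) = byC c refl
          where
            f = e ∸ d * L
            f+ : d * L + f ≡ e
            f+ = m+[n∸m]≡n (≮⇒≥ dL≤e)
            f<ρ : f < ρ
            f<ρ = +-cancelˡ-< (d * L) f ρ (subst₂ _<_ (sym f+) (trans (sym ρ+) (+-comm ρ (d * L))) (≰⇒> e<ν))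
            byC : ∀ c₀ → c₀ ≡ c → ∃ λ j → j < d × memb j e ≡ true
            byC zero q = ⊥-elim (<⇒≱ f<ρ (≤-trans ρ≤dc (≤-trans (≤-reflexive (trans (cong (d *_) (sym q)) (*-zeroʳ d))) z≤n)))
            byC (suc c₀) q = j , m<n*o⇒m/o<n (≤-trans f<ρ ρ≤dc) , or-mid (private-block j e) _ _
                (rng-intro (d * L + st j) c e lower′ upper′)
              where
                instance
                  c≢0 : NonZero c
                  c≢0 = subst NonZero q _
                j = f div c
                f≡ : f ≡ f % c + j * c
                f≡ = m≡m%n+[m/n]*n f c
                jc≤f : j * c ≤ f
                jc≤f = subst (j * c ≤_) (sym f≡) (m≤n+m (j * c) (f % c))
                lower′ : d * L + st j ≤ e
                lower′ = subst (d * L + st j ≤_) f+ (+-monoʳ-≤ (d * L) (≤-trans (m⊓n≤m (j * c) (ρ ∸ c)) jc≤f))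
                f<st+c : f < st j + c
                f<st+c = sel (⊓-sel (j * c) (ρ ∸ c))
                  where
                    sel : st j ≡ j * c ⊎ st j ≡ ρ ∸ c → f < st j + c
                    sel (inj₁ s) = subst (λ t → f < t + c) (sym s) (subst (_< j * c + c) (sym f≡) (subst (_< j * c + c) (+-comm (j * c) (f % c)) (+-monoʳ-< (j * c) (m%n<n f c))))
                    sel (inj₂ s) = subst (λ t → f < t + c) (sym s) (subst (f <_) (sym (m∸n+n≡m c≤ρ)) f<ρ)
                upper′ : e < d * L + st j + c
                upper′ = subst₂ _<_ f+ (sym (+-assoc (d * L) (st j) c)) (+-monoʳ-< (d * L) f<st+c)

    memb-count : ∀ j → j < d → ∑< ν (𝟙 ∘ memb j) ≡ κ
    memb-count j lj = begin
      ∑< ν (𝟙 ∘ memb j)                                              ≡⟨ ∑<-cong ν point ⟩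
      ∑< ν (λ e → 𝟙 (private-block j e) + 𝟙 (arc-block′ j e))         ≡⟨ ∑-+ (upTo ν) _ _ ⟩
      ∑< ν (𝟙 ∘ private-block j) + ∑< ν (𝟙 ∘ arc-block′ j)            ≡⟨ cong₂ _+_ (∑<-rng ν (j * L) L (≤-trans (block-end j lj) dL≤ν)) (∑<-rng ν (d * L + st j) c (arc-end j)) ⟩
      L + c                                                          ≡⟨ trans (+-comm L c) c+ ⟩
      κ ∎
      where
        open ≡-Reasoning
        disjoint : ∀ e → private-block j e ≡ true → arc-block′ j e ≡ true → ⊥
        disjoint e p q = <⇒≱ (<-≤-trans (rng-upper (j * L) L e p) (block-end j lj)) (≤-trans (m≤m+n (d * L) (st j)) (rng-lower (d * L + st j) c e q))
        point : ∀ e → e < ν → 𝟙 (memb j e) ≡ 𝟙 (private-block j e) + 𝟙 (arc-block′ j e)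
        point e le = trans (cong (λ b → 𝟙 ((private-block j e ∨ arc-block′ j e) ∨ b)) (≤ᵇ-no le)) (sum (private-block j e) (arc-block′ j e) (disjoint e))
          where sum : ∀ a b → (a ≡ true → b ≡ true → ⊥) → 𝟙 ((a ∨ b) ∨ false) ≡ 𝟙 a + 𝟙 b
                sum true  true  h = ⊥-elim (h refl refl)
                sum true  false h = refl
                sum false true  h = refl
                sum false false h = refl

    positions : Vec ℕ ν
    positions = tab ν id

    side : ℕ → ℕ → Bool
    side j e = not (memb j e)

    side-count : ∀ j → j < d → card (mapᵛ (side j) positions) ≡ k′
    side-count j lj = +-cancelˡ-≡ κ _ _ (trans (cong₂ _+_ (sym (memb-count j lj)) (card-tab ν id (side j)))
      (trans (#-total (upTo ν) (memb j)) (trans (length-upTo ν) (sym κ+))))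

    private-count : ∀ j → j < d → card (mapᵛ (private-block j) positions) ≡ L
    private-count j lj = trans (card-tab ν id (private-block j)) (∑<-rng ν (j * L) L (≤-trans (block-end j lj) dL≤ν))

    in-star : ∀ j → j < d → Most (2 * (d * 2)) (shuffle positions) (λ w → not (m (insertAt (mapᵛ (side j) w) i true)) ≡ false)
    in-star j lj = rare-shuffle positions (side j) k′ (side-count j lj) k′≤ν (2 * (d * 2)) (λ w → not (m (insertAt w i true)))
      (≤-trans (≤-reflexive (cong (2 * (d * 2) *_) (∑-cong (subsets ν) λ w → sym (𝟙-∧ (kset k′ w) _)))) few-missing)

    -- A random L-set avoids `W` with probability at most ((z - 1) / z) ^ L, because `W` contains at
    -- least the proportion 1 / z of the points; `L` makes this small by `exponential`.
    meets-W : ∀ j → j < d → Most (2 * (d * 2)) (shuffle positions) (λ w → sub (mapᵛ (private-block j) w) (∁ W) ≡ false)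
    meets-W j lj = rare-shuffle positions (private-block j) L (private-count j lj) (≤-trans (m≤n*m L d) dL≤ν) K (λ w → sub w (∁ W)) (begin
        K * level ν L (λ w → 𝟙 (sub w (∁ W)))   ≡⟨ cong (K *_) (trans (∑-cong (subsets ν) (λ w → sym (𝟙-∧ (kset L w) _))) (kset⟨⟩ L (∁ W))) ⟩
        K * choose x L                          ≤⟨ avoid ⟩
        choose ν L ∎)
      where
        open ≤-Reasoning
        K = 2 * (d * 2)
        z = suc (suc Y)
        x = card (∁ W)
        x+ : x + suc k′ ≡ ν
        x+ = trans (+-comm x _) (trans (cong (_+ x) (sym card-W)) (card-∁ W))
        zx≤ : z * x ≤ suc Y * ν
        zx≤ = +-cancelʳ-≤ ν _ _ (begin
          z * x + ν              ≤⟨ +-monoʳ-≤ (z * x) (≤-trans (n≤1+n ν) n≤zk) ⟩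
          z * x + z * suc k′     ≡⟨ sym (*-distribˡ-+ z x (suc k′)) ⟩
          z * (x + suc k′)       ≡⟨ cong (z *_) x+ ⟩
          z * ν                  ≡⟨ +-comm ν (suc Y * ν) ⟩
          suc Y * ν + ν ∎)
        avoid : K * choose x L ≤ choose ν L
        avoid = *-cancelˡ-≤ (z ^ L) {{m^n≢0 z L}} (begin
          z ^ L * (K * choose x L)         ≡⟨ q (z ^ L) K (choose x L) ⟩
          K * (z ^ L * choose x L)         ≤⟨ *-monoʳ-≤ K (choose-avoid (suc Y) L x ν zx≤) ⟩
          K * (suc Y ^ L * choose ν L)     ≡⟨ sym (*-assoc K (suc Y ^ L) _) ⟩
          K * suc Y ^ L * choose ν L       ≤⟨ *-monoˡ-≤ (choose ν L) (exponential Y K L L-big) ⟩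
          z ^ L * choose ν L ∎)
          where q : ∀ p K c → p * (K * c) ≡ K * (p * c)
                q = solve-∀

    -- There are 2 d events, each failing with probability at most 1 / (4 d).
    lucky : ∃ λ w → ∀ j → j < d → not (m (insertAt (mapᵛ (side j) w) i true)) ≡ false × sub (mapᵛ (private-block j) w) (∁ W) ≡ false
    lucky = most-∃ (shuffle-pos positions) (most-∀ d 2 _ λ j lj → most-× (d * 2) (in-star j lj) (meets-W j lj))

    sub-false : ∀ {n} (A X : Vec Bool n) → sub A (∁ X) ≡ false → ∃ λ x → lookup A x ≡ true × lookup X x ≡ true
    sub-false []          []          ()
    sub-false (true ∷ A)  (true ∷ X)  e = fz , refl , refl
    sub-false (true ∷ A)  (false ∷ X) e = let (x , p , q) = sub-false A X e in fs x , p , q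
    sub-false (false ∷ A) (_ ∷ X)     e = let (x , p , q) = sub-false A X e in fs x , p , q

  -- A member of m avoiding i would form a simplex with d members of the star of i.
  impossible : ⊥
  impossible = free A (simplex-of d A none some) members
    where
      w = proj₁ lucky
      star : ℕ → Vec Bool (suc ν)
      star j = insertAt (mapᵛ (side j) w) i true
      A : ℕ → Vec Bool (suc ν)
      A = upd d (insertAt W i false) star
      A-star : ∀ j → j < d → A j ≡ star j
      A-star j l = upd-off (insertAt W i false) star (<⇒≢ l)
      A-d : A d ≡ insertAt W i false
      A-d = upd-at d (insertAt W i false) star
      last? : ∀ {P : ℕ → Set} → (∀ j → j < d → P j) → P d → ∀ j → j < suc d → P j
      last? {P} h p j l = [ h j , (λ e → subst P (sym e) p) ]′ (m≤n⇒m<n∨m≡n (s≤s⁻¹ l))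
      members : ∀ j → j < suc d → m (A j) ≡ true
      members = last? (λ j l → trans (cong m (A-star j l)) (not-false′ (proj₁ (proj₂ lucky j l)))) (trans (cong m A-d) W∈m)
        where not-false′ : ∀ {b} → not b ≡ false → b ≡ true
              not-false′ {true} e = refl
      none : ∀ x → ∃ λ j → j < suc d × lookup (A j) x ≡ false
      none x = go (insertAt-cases i x)
        where
          go : _ → ∃ λ j → j < suc d × lookup (A j) x ≡ false
          go (inj₁ e) = d , ≤-refl , trans (cong₂ lookup A-d e) (insertAt-lookup W i false)
          go (inj₂ (x′ , h)) = j , m<n⇒m<1+n lj , trans (cong (λ V → lookup V x) (A-star j lj))
              (trans (h (mapᵛ (side j) w) true) (trans (lookup-map x′ (side j) w) (cong not (proj₂ (proj₂ cov)))))
            where cov = covered (lookup w x′)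
                  j = proj₁ cov
                  lj = proj₁ (proj₂ cov)
      -- All star members share `i`. If star member `j` is the one left out, a point of `W` in the
      -- private block of `j` serves: it lies in the complement of no other star member.
      some : ∀ j → j < suc d → ∃ λ x → ∀ j′ → j′ < suc d → j′ ≢ j → lookup (A j′) x ≡ true
      some = last? inner (i , λ j′ l′ ne → let lt = ≤∧≢⇒< (s≤s⁻¹ l′) ne in
          trans (cong (λ V → lookup V i) (A-star j′ lt)) (insertAt-lookup (mapᵛ (side j′) w) i true))
        where
          inner : ∀ j → j < d → ∃ λ x → ∀ j′ → j′ < suc d → j′ ≢ j → lookup (A j′) x ≡ true
          inner j lj = punchIn i x′ , last? {λ j′ → j′ ≢ j → lookup (A j′) (punchIn i x′) ≡ true} others
              (λ _ → trans (cong (λ V → lookup V (punchIn i x′)) A-d) (trans (insertAt-punchIn W i false x′) (proj₂ (proj₂ hit))))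
            where
              hit = sub-false (mapᵛ (private-block j) w) W (proj₂ (proj₂ lucky j lj))
              x′ = proj₁ hit
              e = lookup w x′
              e∈ : private-block j e ≡ true
              e∈ = trans (sym (lookup-map x′ (private-block j) w)) (proj₁ (proj₂ hit))
              e<dL : e < d * L
              e<dL = <-≤-trans (rng-upper (j * L) L e e∈) (block-end j lj)
              others : ∀ j′ → j′ < d → j′ ≢ j → lookup (A j′) (punchIn i x′) ≡ true
              others j′ l′ ne = trans (cong (λ V → lookup V (punchIn i x′)) (A-star j′ l′)) (trans (insertAt-punchIn (mapᵛ (side j′) w) i true x′)
                (trans (lookup-map x′ (side j′) w) (cong not outside)))
                where
                  not-private : private-block j′ e ≡ false
                  not-private = ¬true⇒false λ q → ne (≤-antisym
                    (block-of j′ j (rng-lower (j′ * L) L e q) (rng-upper (j * L) L e e∈))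
                    (block-of j j′ (rng-lower (j * L) L e e∈) (rng-upper (j′ * L) L e q)))
                    where block-of : ∀ a b → a * L ≤ e → e < b * L + L → a ≤ b
                          block-of a b p q = s≤s⁻¹ (*-cancelʳ-< L a (suc b) (≤-<-trans p (subst (e <_) (+-comm (b * L) L) q)))
                  outside : memb j′ e ≡ false
                  outside = trans (cong (λ b → (b ∨ arc-block′ j′ e) ∨ (ν ≤ᵇ e)) not-private)
                    (trans (cong (_∨ (ν ≤ᵇ e)) (¬true⇒false λ q → <⇒≱ e<dL (≤-trans (m≤m+n (d * L) (st j′)) (rng-lower (d * L + st j′) c e q))))
                      (≤ᵇ-no (<-≤-trans e<dL dL≤ν)))

module _ (d Y K₁ L b : ℕ) .{{_ : NonZero b}} (2≤d : 2 ≤ d) (2d≤b : d + d ≤ b) (b-big : 8 * (suc (suc Y) * K₁) ≤ b) (1≤K₁ : 1 ≤ K₁)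
  (K₀≤b : 8 * suc d * suc (suc Y) * (2 * (d * 2)) ≤ b) (L≡ : 2 * (d * 2) * suc Y ≤ L) (1≤L : 1 ≤ L)
  (dict : ∀ {n} (h : Vec Bool n → Bool) → Most K₁ (letters (suc d) n) (λ c → One (suc d) (λ a → h (cls a c))) →
    Σ (Fin n) λ i → Most (8 * suc d * suc (suc Y) * (2 * (d * 2))) (letters (suc d) n) (λ c → h (cls (lookup c i) c) ≡ true)) where

  private
    module As = Assembly d b (suc Y) K₁ 2≤d 2d≤b b-big 1≤K₁
    z K₀ K₂ : ℕ
    z = suc (suc Y)
    K₂ = 2 * (d * 2)
    K₀ = 8 * suc d * z * K₂
    N = Blocks.N d b
    1≤d : 1 ≤ d
    1≤d = ≤-trans (s≤s z≤n) 2≤d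

  sampling : ℕ
  sampling = 3 * (suc d * b)

  -- The first two terms serve `Assembly` and the Chebyshev estimate in `Star`. The third, with n ≤
  -- z k, forces `d * L ≤ k′`, the room for the private blocks.
  threshold : ℕ
  threshold = As.n₀ + 2 * (d * d * (d * suc d)) + z * (1 + d * L)

  centre : ∀ {ν k′} (m : Vec Bool (suc ν) → Bool) → (∀ A → m A ≡ true → card A ≡ suc k′) →
    threshold < suc ν → suc ν ≤ z * suc k′ → suc k′ * d ≤ (d ∸ 1) * suc ν → NoSimplex d m →
    sampling * choose ν k′ ≤ sampling * m ⟨ full (suc ν) ⟩ + choose ν k′ →
    ∃ λ i → ∀ A → m A ≡ true → lookup A i ≡ true
  centre {ν} {k′} m u big n≤zk kd≤ free dense = i , through
    where
      open ≤-Reasoning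
      n = suc ν
      k = suc k′
      S = scale n k
      k≤n : k ≤ n
      k≤n = *-cancelʳ-≤ k n d {{>-nonZero 1≤d}} (≤-trans kd≤ (≤-trans (*-monoˡ-≤ n (m∸n≤m d 1)) (≤-reflexive (*-comm d n))))
      n₀≤n : As.n₀ ≤ n
      n₀≤n = ≤-trans (≤-trans (m≤m+n _ _) (m≤m+n _ _)) (<⇒≤ big)
      dL≤k′ : d * L ≤ k′
      dL≤k′ = s≤s⁻¹ (<⇒≤ (*-cancelˡ-< z _ _ (<-≤-trans (≤-<-trans (m≤n+m (z * (1 + d * L)) (As.n₀ + 2 * (d * d * (d * suc d)))) big) n≤zk)))
      dense′ : sampling * (k * choose n k) ≤ n * (sampling * m ⟨ full n ⟩) + k * choose n k
      dense′ = begin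
        sampling * (k * choose n k)                        ≡⟨ cong (sampling *_) (absorb ν k′) ⟩
        sampling * (n * choose ν k′)                       ≡⟨ q sampling n (choose ν k′) ⟩
        n * (sampling * choose ν k′)                       ≤⟨ *-monoʳ-≤ n dense ⟩
        n * (sampling * m ⟨ full n ⟩ + choose ν k′)        ≡⟨ *-distribˡ-+ n _ (choose ν k′) ⟩
        n * (sampling * m ⟨ full n ⟩) + n * choose ν k′    ≡⟨ cong (n * (sampling * m ⟨ full n ⟩) +_) (sym (absorb ν k′)) ⟩
        n * (sampling * m ⟨ full n ⟩) + k * choose n k ∎
        where q : ∀ e n c → e * (n * c) ≡ n * (e * c)
              q = solve-∀
      module P = As.At S m u n₀≤n n≤zk kd≤ k≤n free dense′
      dictated : Σ (Fin n) λ i → Most K₀ (letters (suc d) n) (λ c → P.heavy (cls (lookup c i) c) ≡ true)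
      dictated = dict P.heavy P.almost-one-heavy
      i = proj₁ dictated
      b≤sampling : b ≤ sampling
      b≤sampling = ≤-trans (m≤n*m b (suc d)) (m≤n*m (suc d * b) 3)
      K₀≤K : K₀ ≤ As.K
      K₀≤K = ≤-trans K₀≤b (≤-trans b≤sampling (m≤m*n sampling (N * (N * (2 * N))) {{m*n≢0 N (N * (2 * N)) {{N≢0}} {{m*n≢0 N (2 * N) {{N≢0}} {{m*n≢0 2 N {{_}} {{N≢0}}}}}}}}))
        where N≢0 : NonZero N
              N≢0 = m*n≢0 (suc d) b
      K₂≤e : 2 * K₂ ≤ sampling
      K₂≤e = ≤-trans (*-monoˡ-≤ K₂ (≤-trans (m≤m*n 2 4) (≤-trans (m≤m*n 8 (suc d)) (m≤m*n (8 * suc d) z)))) (≤-trans K₀≤b b≤sampling)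
      K₂>0 : 0 < K₂
      K₂>0 = *-mono-≤ {1} {2} {1} (s≤s z≤n) (*-mono-≤ {1} {d} {1} 1≤d (s≤s z≤n))
      module St = Star S m u d As.K K₀ 1≤d K₀≤K kd≤ (≤-trans (≤-trans (m≤n+m (2 * (d * d * (d * suc d))) As.n₀) (m≤m+n _ (z * (1 + d * L)))) (<⇒≤ big)) i (proj₂ dictated)
      few-missing : K₂ * St.missing-from-star k′ ≤ choose ν k′
      few-missing = St.star-nearly-full k′ z K₂ sampling refl n≤zk z<s K₂>0 refl K₂≤e dense
      through : ∀ A → m A ≡ true → lookup A i ≡ true
      through A mA = decide (lookup A i) refl
        where
          decide : ∀ x → lookup A i ≡ x → lookup A i ≡ true
          decide true  q = q
          decide false q = ⊥-elim (Bootstrap.impossible m i d Y L 1≤d free n≤zk kd≤ k≤n 1≤L L≡ dL≤k′ few-missing W card-W (trans (cong m W≡) mA))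
            where
              W = removeAt A i
              W≡ : insertAt W i false ≡ A
              W≡ = trans (cong (insertAt W i) (sym q)) (insertAt-removeAt A i)
              card-W : card W ≡ k
              card-W = trans (sym (card-insertAt W i false)) (trans (cong card W≡) (u A mA))

-- Rational constants and lists of sets

open import Data.Vec.Properties using (≡-dec)
open import Data.Integer using (+_; -[1+_])
import Data.Integer as ℤ
import Data.Integer.Properties as ℤ
open import Data.Rational using (ℚ; mkℚ; Positive; 1ℚ; _/_; toℚᵘ) renaming (_*_ to _*ℚ_; _-_ to _-ℚ_; _≤_ to _≤ℚ_; -_ to -ℚ_)
open import Data.Rational.Properties using (normalize-pos; toℚᵘ-homo-*; toℚᵘ-homo-+; toℚᵘ-homo‿-; toℚᵘ-mono-≤; toℚᵘ-fromℚᵘ)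
open import Data.Rational.Unnormalised using (mkℚᵘ; *≤*) renaming (_≤_ to _≤ᵘ_; _*_ to _*ᵘ_; _+_ to _+ᵘ_; -_ to -ᵘ_; _≃_ to _≃ᵘ_)
import Data.Rational.Unnormalised.Properties as ℚᵘ
open import Data.Fin.Subset using (Subset; ∣_∣)
open import Data.List.Relation.Unary.All using (All)
import Data.List.Relation.Unary.All as All
open import Data.List.Relation.Unary.Any using (here; there)
open import Data.List.Relation.Unary.AllPairs using ([]; _∷_)
open import Data.List.Relation.Unary.Unique.Propositional using (Unique)
import Data.List.Membership.Propositional as L
import Data.Bool.Properties as Bool

-- The theorem over the natural numbers: 1 / (e + 1) stands for ε₀, and n ≤ (Y + 2) k replaces ζ n ≤
-- k.
record Centred (d Y e n₀ : ℕ) : Set where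
  constructor mkCentred
  field
    star-centre : ∀ {ν k′} (m : Vec Bool (suc ν) → Bool) → (∀ A → m A ≡ true → card A ≡ suc k′) →
      n₀ < suc ν → suc ν ≤ suc (suc Y) * suc k′ → suc k′ * d ≤ (d ∸ 1) * suc ν → NoSimplex d m →
      suc e * choose ν k′ ≤ suc e * m ⟨ full (suc ν) ⟩ + choose ν k′ → ∃ λ i → ∀ A → m A ≡ true → lookup A i ≡ true
open Centred

-- The order of choices: `K₀` from d and Y, then `K₁⁺` from `dictator`, then `b` as a sum dominating
-- every lower bound imposed on it, and last 1 / ε₀ = 3 (d + 1) b.
exists-centre : ∀ d → 2 ≤ d → ∀ Y → ∃ λ e → ∃ λ n₀ → Centred d Y e n₀
exists-centre d 2≤d Y = pred s , threshold d Y K₁⁺ L b 2≤d 2d≤b b-big 1≤K₁ K₀≤b ≤-refl 1≤L dict ,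
    mkCentred λ {ν} {k′} m u big n≤zk kd≤ free dense → centre d Y K₁⁺ L b 2≤d 2d≤b b-big 1≤K₁ K₀≤b ≤-refl 1≤L dict m u big n≤zk kd≤ free
      (subst (λ e → e * choose ν k′ ≤ e * m ⟨ full (suc ν) ⟩ + choose ν k′) (suc-pred s {{s≢0}}) dense)
  where
    3≤r : 3 ≤ suc d
    3≤r = s≤s 2≤d
    K₀ = 8 * suc d * suc (suc Y) * (2 * (d * 2))
    1≤K₂ : 1 ≤ 2 * (d * 2)
    1≤K₂ = *-mono-≤ {1} {2} {1} (s≤s z≤n) (*-mono-≤ {1} {d} {1} (≤-trans (s≤s z≤n) 2≤d) (s≤s z≤n))
    1≤K₀ : 1 ≤ K₀
    1≤K₀ = *-mono-≤ {1} {8 * suc d * suc (suc Y)} {1} (s≤s z≤n) 1≤K₂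
    found = dictator 3≤r K₀ 1≤K₀
    K₁⁺ = suc (proj₁ found)
    1≤K₁ : 1 ≤ K₁⁺
    1≤K₁ = s≤s z≤n
    dict : ∀ {n} (h : Vec Bool n → Bool) → Most K₁⁺ (letters (suc d) n) (λ c → One (suc d) (λ a → h (cls a c))) →
      Σ (Fin n) λ i → Most K₀ (letters (suc d) n) (λ c → h (cls (lookup c i) c) ≡ true)
    dict h U = proj₂ found h (most-weaken (n≤1+n (proj₁ found)) U)
    L b : ℕ
    L = 2 * (d * 2) * suc Y
    1≤L : 1 ≤ L
    1≤L = *-mono-≤ {1} {2 * (d * 2)} {1} 1≤K₂ (s≤s z≤n)
    b = d + d + (8 * (suc (suc Y) * K₁⁺) + K₀)
    2d≤b : d + d ≤ b
    2d≤b = m≤m+n (d + d) _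
    b-big : 8 * (suc (suc Y) * K₁⁺) ≤ b
    b-big = ≤-trans (m≤m+n _ K₀) (m≤n+m _ (d + d))
    K₀≤b : K₀ ≤ b
    K₀≤b = ≤-trans (m≤n+m K₀ (8 * (suc (suc Y) * K₁⁺))) (m≤n+m _ (d + d))
    instance
      b≢0 : NonZero b
      b≢0 = >-nonZero (≤-trans 1≤K₀ K₀≤b)
    s : ℕ
    s = 3 * (suc d * b)
    s≢0 : NonZero s
    s≢0 = m*n≢0 3 (suc d * b) {{_}} {{m*n≢0 (suc d) b}}

card≡∣∣ : ∀ {n} (A : Subset n) → card A ≡ ∣ A ∣
card≡∣∣ []          = refl
card≡∣∣ (true ∷ A)  = cong suc (card≡∣∣ A)
card≡∣∣ (false ∷ A) = card≡∣∣ A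

member : ∀ {n} → List (Subset n) → Subset n → Bool
member []      A = false
member (B ∷ F) A = does (≡-dec Bool._≟_ A B) ∨ member F A

member-sound : ∀ {n} (F : List (Subset n)) A → member F A ≡ true → A L.∈ F
member-sound (B ∷ F) A e with ≡-dec Bool._≟_ A B
... | yes q = here q
... | no _  = there (member-sound F A e)

member-complete : ∀ {n} (F : List (Subset n)) A → A L.∈ F → member F A ≡ true
member-complete (B ∷ F) A A∈ with ≡-dec Bool._≟_ A B | A∈
... | yes _ | _        = refl
... | no ne | here q   = ⊥-elim (ne q)
... | no _  | there A∈ = member-complete F A A∈

∑-subsets-term : ∀ n (f : Vec Bool n → ℕ) A → f A ≤ ∑ (subsets n) f
∑-subsets-term zero    f []          = m≤m+n _ 0
∑-subsets-term (suc n) f (true ∷ A)  = ≤-trans (∑-subsets-term n (f ∘ (true ∷_)) A) (≤-trans (m≤n+m _ _) (≤-reflexive (sym (∑-subsets n f))))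
∑-subsets-term (suc n) f (false ∷ A) = ≤-trans (∑-subsets-term n (f ∘ (false ∷_)) A) (≤-trans (m≤m+n _ _) (≤-reflexive (sym (∑-subsets n f))))

length≤#member : ∀ {n} (F : List (Subset n)) → Unique F → length F ≤ # (subsets n) (member F)
length≤#member []      u       = z≤n
length≤#member {n} (B ∷ F) (B∉F ∷ u) = begin
  1 + length F                                                     ≤⟨ +-mono-≤ one (length≤#member F u) ⟩
  # (subsets n) (λ A → does (eq A)) + # (subsets n) (member F)     ≡⟨ sym (∑-+ (subsets n) _ _) ⟩
  ∑ (subsets n) (λ A → 𝟙 (does (eq A)) + 𝟙 (member F A))           ≡⟨ ∑-cong (subsets n) (λ A → disjoint A) ⟩
  # (subsets n) (member (B ∷ F)) ∎
  where
    open ≤-Reasoning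
    eq : ∀ A → Dec (A ≡ B)
    eq A = ≡-dec Bool._≟_ A B
    one : 1 ≤ # (subsets n) (λ A → does (eq A))
    one = ≤-trans (≤-reflexive (sym self)) (∑-subsets-term n (λ A → 𝟙 (does (eq A))) B)
      where self : 𝟙 (does (eq B)) ≡ 1
            self with eq B
            ... | yes _ = refl
            ... | no ne = ⊥-elim (ne refl)
    disjoint : ∀ A → 𝟙 (does (eq A)) + 𝟙 (member F A) ≡ 𝟙 (member (B ∷ F) A)
    disjoint A with eq A
    ... | no _     = refl
    ... | yes refl with member F A in q
    ...   | false = refl
    ...   | true  = ⊥-elim (All.lookup B∉F (member-sound F A q) refl)

private
  ℕ-rational : ∀ n → toℚᵘ (+ n / 1) ≃ᵘ mkℚᵘ (+ n) 0
  ℕ-rational n = toℚᵘ-fromℚᵘ (mkℚᵘ (+ n) 0)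

-- A positive fraction is at least the reciprocal of its denominator, here q + 1.
ζ-bound : ∀ ζ → Positive ζ → ∃ λ Y → ∀ n k → ζ *ℚ (+ n / 1) ≤ℚ (+ k / 1) → n ≤ suc Y * k
ζ-bound ζ@(mkℚ (+ suc p) q _) _ = q , λ n k h → convert n k (ℚᵘ.≤-respˡ-≃ (ℚᵘ.≃-trans (toℚᵘ-homo-* ζ (+ n / 1)) (ℚᵘ.*-congˡ {toℚᵘ ζ} (ℕ-rational n)))
    (ℚᵘ.≤-respʳ-≃ (ℕ-rational k) (toℚᵘ-mono-≤ h)))
  where
    convert : ∀ n k → mkℚᵘ (+ suc p) q *ᵘ mkℚᵘ (+ n) 0 ≤ᵘ mkℚᵘ (+ k) 0 → n ≤ suc q * k
    convert n k (*≤* l) = ≤-trans (m≤n*m n (suc p)) (subst₂ _≤_ (*-identityʳ (suc p * n)) (trans (cong (k *_) (*-identityʳ (suc q))) (*-comm k (suc q)))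
      (ℤ.drop‿+≤+ (subst₂ ℤ._≤_ (trans (cong (ℤ._* + 1) (sym (ℤ.pos-* (suc p) n))) (sym (ℤ.pos-* (suc p * n) 1))) (sym (ℤ.pos-* k (suc q * 1))) l)))

ε-bound : ∀ e c f → (1ℚ -ℚ (+ 1 / suc e)) *ℚ (+ c / 1) ≤ℚ (+ f / 1) → suc e * c ≤ suc e * f + c
ε-bound e c f h = convert (ℚᵘ.≤-respˡ-≃ (ℚᵘ.≃-trans (toℚᵘ-homo-* (1ℚ -ℚ ε) (+ c / 1)) (ℚᵘ.*-cong factor (ℕ-rational c)))
    (ℚᵘ.≤-respʳ-≃ (ℕ-rational f) (toℚᵘ-mono-≤ h)))
  where
    ε = + 1 / suc e
    factor : toℚᵘ (1ℚ -ℚ ε) ≃ᵘ mkℚᵘ (+ 1) 0 +ᵘ -ᵘ mkℚᵘ (+ 1) e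
    factor = ℚᵘ.≃-trans (toℚᵘ-homo-+ 1ℚ (-ℚ ε)) (ℚᵘ.+-congʳ (mkℚᵘ (+ 1) 0) (ℚᵘ.≃-trans (toℚᵘ-homo‿- ε) (ℚᵘ.-‿cong (toℚᵘ-fromℚᵘ (mkℚᵘ (+ 1) e)))))
    convert : (mkℚᵘ (+ 1) 0 +ᵘ -ᵘ mkℚᵘ (+ 1) e) *ᵘ mkℚᵘ (+ c) 0 ≤ᵘ mkℚᵘ (+ f) 0 → suc e * c ≤ suc e * f + c
    convert (*≤* l) = subst (_≤ suc e * f + c) (+-comm (e * c) c) (+-monoˡ-≤ c ec≤)
      where
        numerator : + 1 ℤ.* + suc e ℤ.+ -[1+ 0 ] ℤ.* + 1 ≡ + e
        numerator = cong (λ t → t ℤ.+ -[1+ 0 ]) (ℤ.*-identityˡ (+ suc e))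
        ec≤ : e * c ≤ suc e * f
        ec≤ = subst₂ _≤_ (*-identityʳ (e * c)) (trans (cong (f *_) (trans (*-identityʳ _) (*-identityˡ (suc e)))) (*-comm f (suc e)))
          (ℤ.drop‿+≤+ (subst₂ ℤ._≤_ (trans (cong (λ t → t ℤ.* + c ℤ.* + 1) numerator) (trans (cong (ℤ._* + 1) (sym (ℤ.pos-* e c))) (sym (ℤ.pos-* (e * c) 1))))
            (sym (ℤ.pos-* f (1 * suc e * 1))) l))

Stable : ℕ → ℚ → ℚ → ℕ → Set
Stable d ζ ε₀ n₀ = (n k : ℕ) (F : List (Subset n)) → n₀ < n → ζ *ℚ (+ n / 1) ≤ℚ (+ k / 1) → k * d ≤ (d ∸ 1) * n →
  Unique F → All (λ A → ∣ A ∣ ≡ k) F → ¬ ContainsSimplex d F →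
  (1ℚ -ℚ ε₀) *ℚ (+ ((n ∸ 1) C (k ∸ 1)) / 1) ≤ℚ (+ length F / 1) → InStar F

module _ (d Y : ℕ) (ζ : ℚ) (bound : ∀ n k → ζ *ℚ (+ n / 1) ≤ℚ (+ k / 1) → n ≤ suc Y * k) where

  stable : ∀ e n₀ → Centred d Y e n₀ → Stable d ζ (+ 1 / suc e) n₀
  stable e n₀ centred (suc ν) zero F big ζn≤k = ⊥-elim (<⇒≱ z<s (≤-trans (bound (suc ν) 0 ζn≤k) (≤-reflexive (*-zeroʳ (suc Y)))))
  stable e n₀ centred (suc ν) (suc k′) F big ζn≤k kd≤ uniq sizes free dense = conclude (star-centre centred m uniform big n≤zk kd≤ simplex-free dense′)
    where
      m : Vec Bool (suc ν) → Bool
      m = member F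
      uniform : ∀ A → m A ≡ true → card A ≡ suc k′
      uniform A q = trans (card≡∣∣ A) (All.lookup sizes (member-sound F A q))
      -- One more than `ζ-bound` yields, so that z = Y + 2 is at least 2 and `exponential` can
      -- compare powers of z with powers of z - 1 = Y + 1.
      n≤zk : suc ν ≤ suc (suc Y) * suc k′
      n≤zk = ≤-trans (bound (suc ν) (suc k′) ζn≤k) (*-monoˡ-≤ (suc k′) (n≤1+n (suc Y)))
      simplex-free : NoSimplex d m
      simplex-free A simplex members = free ((λ j → A (toℕ j)) , simplex , λ j → member-sound F (A (toℕ j)) (members (toℕ j) (toℕ<n j)))
      size : length F ≤ m ⟨ full (suc ν) ⟩
      size = ≤-trans (length≤#member F uniq) (≤-reflexive (∑-cong (subsets (suc ν)) λ A → cong 𝟙 (sym (and-full A))))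
        where and-full : ∀ A → m A ∧ sub A (full (suc ν)) ≡ m A
              and-full A rewrite sub-full A with m A
              ... | true  = refl
              ... | false = refl
      dense′ : suc e * choose ν k′ ≤ suc e * m ⟨ full (suc ν) ⟩ + choose ν k′
      dense′ = subst (λ c → suc e * c ≤ suc e * m ⟨ full (suc ν) ⟩ + c) (sym (choose≡C ν k′))
        (≤-trans (ε-bound e (ν C k′) (length F) dense) (+-monoˡ-≤ (ν C k′) (*-monoʳ-≤ (suc e) size)))
      conclude : (∃ λ i → ∀ A → m A ≡ true → lookup A i ≡ true) → InStar F
      conclude (i , h) = i , λ A A∈F → lookup⇒[]= i A (h A (member-complete F A A∈F))

  exists-stable : (∃ λ e → ∃ λ n₀ → Centred d Y e n₀) → Σ ℚ λ ε₀ → Positive ε₀ × Σ ℕ λ n₀ → Stable d ζ ε₀ n₀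
  exists-stable (e , n₀ , centred) = + 1 / suc e , normalize-pos 1 (suc e) , n₀ , stable e n₀ centred

theorem10p1 : (d : ℕ) → 1 ≤ d → (ζ : ℚ) → Positive ζ →
    Σ ℚ λ ε₀ → Positive ε₀ × Σ ℕ λ n₀ →
    (n k : ℕ) (F : List (Subset n)) →
    n₀ < n →
    ζ *ℚ (+ n / 1) ≤ℚ (+ k / 1) →
    k * d ≤ (d ∸ 1) * n →
    Unique F →
    All (λ A → ∣ A ∣ ≡ k) F →
    ¬ ContainsSimplex d F →
    (1ℚ -ℚ ε₀) *ℚ (+ ((n ∸ 1) C (k ∸ 1)) / 1) ≤ℚ (+ length F / 1) →
    InStar F
-- For d = 1 the bound on `k` forces k = 0, and then ζ n ≤ k contradicts n > 0. The general argument
-- has d + 1 ≥ 3 colours.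
theorem10p1 (suc zero) _ ζ ζ>0 = + 1 / 1 , normalize-pos 1 1 , 0 , λ n k F n>0 ζn≤k kd≤ _ _ _ _ →
    ⊥-elim (<⇒≱ n>0 (≤-trans (proj₂ found n k ζn≤k) (≤-trans (*-monoʳ-≤ (suc (proj₁ found)) (≤-trans (≤-reflexive (sym (*-identityʳ k))) kd≤))
      (≤-reflexive (*-zeroʳ (suc (proj₁ found)))))))
  where found = ζ-bound ζ ζ>0
theorem10p1 (suc (suc d)) _ ζ ζ>0 = exists-stable (suc (suc d)) (proj₁ found) ζ (proj₂ found) (exists-centre (suc (suc d)) (s≤s (s≤s z≤n)) (proj₁ found))
  where found = ζ-bound ζ ζ>0
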